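{- Let $d \in \mathbb{N}$ and let $(G_n)_{n\ge 1}$ be a sequence of finite simple graphs with all vertex degrees at most $d$. If $(G_n)$ is weakly convergent and the family $\{G_n\}_{n\ge1}$ is hyperfinite, then $(G_n)$ is strongly convergent.
   Context: All graphs are finite, simple (no loops, no multiple edges), with vertex degree bounded by $d$; $\mathcal{G}_d$ denotes this class. For a graph $G$, $d_G$ is the shortest-path metric, and for $x \in V(G)$ and $r \in \mathbb{N}$, $B_r^G(x)$ is the subgraph induced by $G$ on $\{y : d_G(x,y)\le r\}$, rooted at $x$. Two rooted graphs are rooted isomorphic if there is a graph isomorphism between them mapping root to root. For a rooted isomorphism class $\alpha$ of radius $r$ (i.e. $r$ is the least integer with all vertices within distance $r$ of the root), let $p(G,\alpha)$ be the proportion of vertices $x \in V(G)$ with $B_r^G(x)$ rooted isomorphic to $\alpha$. Weak convergence: $(G_n)$ is weakly convergent if for every $r\in\mathbb{N}$ and every rooted isomorphism class $\alpha$ of radius $r$ with degrees at most $d$, the limit $\lim_{n\to\infty} p(G_n,\alpha)$ exists. Hyperfiniteness: a family $\mathcal{P}\subseteq\mathcal{G}_d$ is hyperfinite if for every $\varepsilon>0$ there is $K_\varepsilon\in\mathbb{N}$ such that from every $G\in\mathcal{P}$ one can remove fewer than $\varepsilon|E(G)|$ edges so that every connected component of the resulting graph has at most $K_\varepsilon$ vertices. Geometric distance: if $G,H$ are graphs on the same vertex set $V$ (vertices labeled $1,\dots,|V|$), let $\delta(G,H)$ be the proportion of $v\in V$ whose star (the $1$-ball around $v$, including the labels of its vertices,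 i.e. the set of neighbours of $v$) differs in $G$ and $H$. Let $\delta_S(G,H)=\min_{\sigma} \delta(G,H^\sigma)$, the minimum over all permutations $\sigma$ of $V$, with $H^\sigma$ the graph obtained by relabeling the vertices of $H$ by $\sigma$ (graphs with the same number of vertices are compared by identifying their vertex sets by any bijection). For arbitrary $G,H$, set $\delta_\rho(G,H)=\inf\{\delta_S(qG,pH) : p,q\in\mathbb{N},\ q|V(G)|=p|V(H)|\}$, where $qG$ is the disjoint union of $q$ copies of $G$; by convention $\delta=1$ between a graph and the empty graph. $\delta_\rho$ is a metric on isomorphism classes of such finite graphs. Strong convergence: $(G_n)$ is strongly convergent if the sequence of isomorphism classes of $G_n$ is a Cauchy sequence with respect to $\delta_\rho$. -}

module Defs where

open import Data.Nat as ℕ using (ℕ; zero; suc; _+_; _∸_; _≤_)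
open import Data.Bool using (Bool; true; false; _∧_; _∨_; _xor_; if_then_else_)
open import Data.Fin as Fin using (Fin; toℕ; cast; quotRem)
open import Data.Fin.Permutation using (Permutation′; _⟨$⟩ˡ_)
open import Data.Product using (Σ; ∃; ∃-syntax; _×_; _,_; proj₁; proj₂)
open import Data.Sum using (_⊎_)
open import Data.Integer using (+_)
open import Data.Rational as ℚ using (ℚ; 0ℚ; 1ℚ; _/_; _-_; ∣_∣; _*_)
open import Relation.Nullary using (¬_)
open import Relation.Nullary.Decidable using (⌊_⌋)
open import Relation.Binary.PropositionalEquality using (_≡_)

record Graph : Set where
  field
    size   : ℕ
    adj    : Fin size → Fin size → Bool
    sym    : ∀ i j → adj i j ≡ adj j i
    irrefl : ∀ i → adj i i ≡ false
open Graph public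

countF : (n : ℕ) → (Fin n → Bool) → ℕ
countF zero    f = 0
countF (suc n) f = (if f Fin.zero then 1 else 0) + countF n (λ i → f (Fin.suc i))

sumF : (n : ℕ) → (Fin n → ℕ) → ℕ
sumF zero    f = 0
sumF (suc n) f = f Fin.zero + sumF n (λ i → f (Fin.suc i))

anyF : (n : ℕ) → (Fin n → Bool) → Bool
anyF zero    f = false
anyF (suc n) f = f Fin.zero ∨ anyF n (λ i → f (Fin.suc i))

degree : (G : Graph) → Fin (size G) → ℕ
degree G i = countF (size G) (λ j → adj G i j)

MaxDegLe : ℕ → Graph → Set
MaxDegLe d G = ∀ i → degree G i ≤ d

reach : {n : ℕ} → (Fin n → Fin n → Bool) → ℕ → Fin n → Fin n → Bool
reach A zero    x y = ⌊ x Fin.≟ y ⌋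
reach {n} A (suc r) x y = reach A r x y ∨ anyF n (λ z → A x z ∧ reach A r z y)

numEdges : {n : ℕ} → (Fin n → Fin n → Bool) → ℕ
numEdges {n} A = sumF n (λ i → countF n (λ j → (toℕ i ℕ.<ᵇ toℕ j) ∧ A i j))

-- Rationals from naturals; proportions (0 for the empty graph)

ℕtoℚ : ℕ → ℚ
ℕtoℚ k = + k / 1

frac : ℕ → ℕ → ℚ
frac c zero    = 0ℚ
frac c (suc n) = + c / suc n

HasCount : (n : ℕ) → (Fin n → Set) → ℕ → Set
HasCount n P c =
  Σ (Fin n → Bool) λ b → (∀ x → (b x ≡ true → P x) × (P x → b x ≡ true)) × countF n b ≡ c

record Rooted : Set where
  field
    graph : Graph
    root  : Fin (size graph)
open Rooted public

HasRadius : Rooted → ℕ → Set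
HasRadius α r =
  (∀ v → reach (adj (graph α)) r (root α) v ≡ true) ×
  (∀ r′ → r′ ℕ.< r → ∃[ v ] reach (adj (graph α)) r′ (root α) v ≡ false)

-- B_r^G(x) (induced subgraph on the r-ball, rooted at x) is rooted isomorphic to α:
-- an injective map from α onto the ball, root to x, preserving adjacency and non-adjacency.
BallIso : (G : Graph) → ℕ → Fin (size G) → Rooted → Set
BallIso G r x α =
  Σ (Fin (size (graph α)) → Fin (size G)) λ f →
    (∀ i j → f i ≡ f j → i ≡ j) ×
    (f (root α) ≡ x) ×
    (∀ i → reach (adj G) r x (f i) ≡ true) ×
    (∀ y → reach (adj G) r x y ≡ true → ∃[ i ] f i ≡ y) ×
    (∀ i j → adj (graph α) i j ≡ adj G (f i) (f j))

-- q = p(G, α) where r is the radius of α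
Prop : Graph → Rooted → ℕ → ℚ → Set
Prop G α r q = Σ ℕ λ c → HasCount (size G) (λ x → BallIso G r x α) c × q ≡ frac c (size G)

-- Weak convergence: for each α of radius r with degrees ≤ d, (p(G_n,α))_n is Cauchy
-- (equivalently, converges in ℝ).

WeaklyConvergent : ℕ → (ℕ → Graph) → Set
WeaklyConvergent d G =
  ∀ (r : ℕ) (α : Rooted) → HasRadius α r → MaxDegLe d (graph α) →
  ∀ (ε : ℚ) → 0ℚ ℚ.< ε → ∃[ N ] ∀ m k → N ≤ m → N ≤ k →
  ∀ qm qk → Prop (G m) α r qm → Prop (G k) α r qk → ∣ qm - qk ∣ ℚ.< ε

Hyperfinite : (ℕ → Graph) → Set
Hyperfinite G =
  ∀ (ε : ℚ) → 0ℚ ℚ.< ε → ∃[ K ] ∀ n →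
    Σ (Fin (size (G n)) → Fin (size (G n)) → Bool) λ H →
      (∀ i j → H i j ≡ H j i) ×
      (∀ i j → H i j ≡ true → adj (G n) i j ≡ true) ×
      (ℕtoℚ (numEdges (adj (G n)) ∸ numEdges H) ℚ.< ε * ℕtoℚ (numEdges (adj (G n)))) ×
      (∀ x → countF (size (G n)) (λ y → reach H (size (G n)) x y) ≤ K)

copies : (q : ℕ) (G : Graph) → Fin (q ℕ.* size G) → Fin (q ℕ.* size G) → Bool
copies q G a b with quotRem {q} (size G) a | quotRem {q} (size G) b
... | (ia , ca) | (ib , cb) = ⌊ ca Fin.≟ cb ⌋ ∧ adj G ia ib

DeltaLt : (N : ℕ) → (Fin N → Fin N → Bool) → (Fin N → Fin N → Bool) → ℚ → Set
DeltaLt N A B ε =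
  frac (countF N (λ v → anyF N (λ u → A v u xor B v u))) N ℚ.< ε

-- H^σ : relabel vertex i of H as σ i
relabel : {N : ℕ} → Permutation′ N → (Fin N → Fin N → Bool) → Fin N → Fin N → Bool
relabel σ B i j = B (σ ⟨$⟩ˡ i) (σ ⟨$⟩ˡ j)

-- δ_S(A,B) < ε  (δ_S is a minimum over permutations)
DeltaSLt : (N : ℕ) → (Fin N → Fin N → Bool) → (Fin N → Fin N → Bool) → ℚ → Set
DeltaSLt N A B ε = ∃[ σ ] DeltaLt N A (relabel σ B) ε

castAdj : {m n : ℕ} → m ≡ n → (Fin m → Fin m → Bool) → Fin n → Fin n → Bool
castAdj e A i j = A (cast (Relation.Binary.PropositionalEquality.sym e) i)
                    (cast (Relation.Binary.PropositionalEquality.sym e) j)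

-- δ_ρ(G,H) < ε  (δ_ρ is an infimum over p,q ≥ 1 with q|V(G)| = p|V(H)|;
-- δ = 1 by convention between a nonempty graph and the empty graph)
DeltaRhoLt : Graph → Graph → ℚ → Set
DeltaRhoLt G H ε =
  ((((size G ≡ 0) × ¬ (size H ≡ 0)) ⊎ ((¬ (size G ≡ 0)) × size H ≡ 0)) × 1ℚ ℚ.< ε) ⊎
  (Σ ℕ λ p → Σ ℕ λ q → 1 ≤ p × 1 ≤ q ×
     Σ (q ℕ.* size G ≡ p ℕ.* size H) λ e →
       DeltaSLt (p ℕ.* size H) (castAdj e (copies q G)) (copies p H) ε)

StronglyConvergent : (ℕ → Graph) → Set
StronglyConvergent G =
  ∀ (ε : ℚ) → 0ℚ ℚ.< ε → ∃[ N ] ∀ m k → N ≤ m → N ≤ k → DeltaRhoLt (G m) (G k) ε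

{-# OPTIONS --safe #-}
module Submission where

-- Let G and H be two members of the sequence with similar ball statistics; after passing to copies they have equally
-- many vertices, and vertices with isomorphic balls are matched by a permutation π.  Hyperfiniteness splits G into
-- parts of size at most p and H into much coarser parts of size at most q.  Each coarse part of H is mapped to G by a
-- local isomorphism θ chosen uniformly among those agreeing with π up to the type of a large ball; taking t copies
-- makes "uniformly" exact.  Pulling back the partition of G along θ then splits t copies of H, up to few vertices,
-- into parts of the same isomorphism types as those of t copies of G.  The two families have almost the same
-- frequencies: the mean of a function on G over the vertices with the same R-ball hardly changes when R is replaced by
-- R + 2K, for a suitable R from a bounded list, because the squares of these means sum to a bounded increasing energy.
-- Matching parts of the same type gives the required identification.

open import Defs
open import Data.Nat as ℕ using (ℕ; zero; suc; _+_; _*_; _∸_; _^_; _≤_; _<_; z≤n; s≤s; ∣_-_∣; _!)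
open import Data.Nat.Properties hiding (_≟_)
open import Data.Bool using (Bool; true; false; _∧_; _∨_; not; if_then_else_; _xor_)
open import Data.Fin as Fin using (Fin; toℕ; combine; _≟_)
import Data.Fin.Properties as Finₚ
open import Data.Product using (Σ; ∃-syntax; _×_; _,_; proj₁; proj₂)
open import Data.Sum using (_⊎_; inj₁; inj₂)
open import Data.Maybe as Maybe using (Maybe; just; nothing; fromMaybe)
open import Function using (_∘_)
open import Relation.Binary.Definitions using (tri<; tri≈; tri>)
open import Relation.Nullary using (¬_; Dec; yes; no; contradiction)
open import Relation.Nullary.Decidable using (⌊_⌋)
open import Relation.Binary.PropositionalEquality using (_≡_; _≢_; refl; cong; cong₂; trans; subst; module ≡-Reasoning) renaming (sym to ≡-sym)
open import Data.Fin.Permutation as Perm using (Permutation′; permutation; transpose; insert; remove; _⟨$⟩ʳ_; _⟨$⟩ˡ_; inverseˡ; inverseʳ; _∘ₚ_; flip; insert-remove)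
import Data.Fin.Permutation.Components as PC
open import Data.Nat.Divisibility using (_∣_; divides; ∣-trans; m∣m*n; m≤n⇒m!∣n!)
open import Data.Bool.Properties using (∨-comm; ∨-idem; ∧-zeroʳ; ∧-identityʳ; not-involutive) renaming (_≟_ to _≟ᵇ_)
open import Relation.Nullary.Decidable using (map′; _×-dec_; _→-dec_)
open import Data.List as List using (List; _∷_; length; lookup; concatMap; allFin; upTo)
open import Data.List.Membership.Propositional using (_∈_; lose)
open import Data.List.Membership.Propositional.Properties using (∈-map⁺; ∈-concatMap⁺; ∈-allFin; ∈-upTo⁺)
open import Data.List.Relation.Unary.Any as Any using (there)
open import Data.List.Relation.Unary.Any.Properties using (lookup-index)
open import Data.Integer as ℤ using (-[1+_])
import Data.Integer.Properties as ℤₚ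
open import Data.Rational as ℚ using (ℚ; 0ℚ)
import Data.Rational.Properties as ℚₚ
open import Data.Rational.Unnormalised as ℚᵘ using (mkℚᵘ)
import Data.Rational.Unnormalised.Properties as ℚᵘₚ
open import Relation.Binary.PropositionalEquality using (subst₂)
open import Data.Nat.Solver using (module +-*-Solver)
open import Algebra.Properties.CommutativeSemigroup *-commutativeSemigroup using (x∙yz≈y∙xz)

-- In the code the overview's G is `B`, with the fine partition `P`, and its H is `A`, with the
-- coarse partition `Q`; the name `H` itself mostly denotes a precision constant or a subgraph. The
-- obstacle: `π` respects ball types but no edges, while a hyperfinite partition is not determined
-- by balls of any fixed radius, so the parts of B cannot be read off from ball types in A. A local
-- isomorphism on a whole coarse part transfers all edges deep inside it. The cuts cost the vertices
-- from which another coarse part is reachable in p + 1 steps, which is why q is chosen after p. One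
-- local isomorphism per part could still land where the fine parts look untypical. Averaging over
-- all of them replaces the indicator of a part type by its mean over large balls, whereas `π` only
-- controls means over smaller balls; this gap is what the energy argument closes. It offers l * l
-- candidate radii with l computed from p and q, so the final radius, and with it the accuracy
-- demanded of the ball statistics, is fixed before any two graphs are compared.

private variable
  k m n : ℕ

-- Booleans and decisions

⌊⌋-intro : ∀ {P : Set} (d : Dec P) → P → ⌊ d ⌋ ≡ true
⌊⌋-intro (yes _) p = refl
⌊⌋-intro (no ¬p) p = contradiction p ¬p

⌊⌋-elim : ∀ {P : Set} (d : Dec P) → ⌊ d ⌋ ≡ true → P
⌊⌋-elim (yes p) _ = p

⌊⌋-false : ∀ {P : Set} (d : Dec P) → ¬ P → ⌊ d ⌋ ≡ false
⌊⌋-false (yes p) ¬p = contradiction p ¬p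
⌊⌋-false (no _)  _  = refl

≢true⇒≡false : ∀ {b} → b ≢ true → b ≡ false
≢true⇒≡false {true}  h = contradiction refl h
≢true⇒≡false {false} _ = refl

true≢false : ∀ {b} → b ≡ true → b ≢ false
true≢false refl ()

not-true : ∀ {b} → not b ≡ true → b ≡ false
not-true {false} _ = refl

⇔⇒≡ : ∀ {a b} → (a ≡ true → b ≡ true) → (b ≡ true → a ≡ true) → a ≡ b
⇔⇒≡ {true}  {b}     f g = ≡-sym (f refl)
⇔⇒≡ {false} {true}  f g = g refl
⇔⇒≡ {false} {false} f g = refl

∧-intro : ∀ {a b} → a ≡ true → b ≡ true → a ∧ b ≡ true
∧-intro refl refl = refl

∧-elimˡ : ∀ {a b} → a ∧ b ≡ true → a ≡ true
∧-elimˡ {true} _ = refl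

∧-elimʳ : ∀ {a b} → a ∧ b ≡ true → b ≡ true
∧-elimʳ {true} h = h

∨-introˡ : ∀ {a b} → a ≡ true → a ∨ b ≡ true
∨-introˡ refl = refl

∨-introʳ : ∀ {a b} → b ≡ true → a ∨ b ≡ true
∨-introʳ {true}  _ = refl
∨-introʳ {false} h = h

∨-elim : ∀ {a b} → a ∨ b ≡ true → a ≡ true ⊎ b ≡ true
∨-elim {true}  _ = inj₁ refl
∨-elim {false} h = inj₂ h

anyF-intro : ∀ {n} (f : Fin n → Bool) x → f x ≡ true → anyF n f ≡ true
anyF-intro f Fin.zero    h = ∨-introˡ h
anyF-intro f (Fin.suc x) h = ∨-introʳ (anyF-intro (f ∘ Fin.suc) x h)

anyF-elim : ∀ {n} (f : Fin n → Bool) → anyF n f ≡ true → ∃[ x ] f x ≡ true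
anyF-elim {suc n} f h with ∨-elim {f Fin.zero} h
... | inj₁ p = Fin.zero , p
... | inj₂ p with anyF-elim (f ∘ Fin.suc) p
...   | x , q = Fin.suc x , q

anyF-false : ∀ {n} (f : Fin n → Bool) → anyF n f ≡ false → ∀ x → f x ≡ false
anyF-false f h x = ≢true⇒≡false λ p → true≢false (anyF-intro f x p) h

-- Indicators and finite sums

𝟙 : Bool → ℕ
𝟙 b = if b then 1 else 0

𝟙≤1 : ∀ b → 𝟙 b ≤ 1
𝟙≤1 true  = ≤-refl
𝟙≤1 false = z≤n

𝟙-mono : ∀ {a b} → (a ≡ true → b ≡ true) → 𝟙 a ≤ 𝟙 b
𝟙-mono {true}  h = ≤-reflexive (cong 𝟙 (≡-sym (h refl)))
𝟙-mono {false} h = z≤n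

𝟙-∨ : ∀ a b → 𝟙 (a ∨ b) ≤ 𝟙 a + 𝟙 b
𝟙-∨ true  b = s≤s z≤n
𝟙-∨ false b = ≤-refl

𝟙-∧ : ∀ a b → 𝟙 (a ∧ b) ≡ 𝟙 a * 𝟙 b
𝟙-∧ true  b = ≡-sym (+-identityʳ _)
𝟙-∧ false b = refl

𝟙-true : ∀ {b} c → b ≡ true → 𝟙 b * c ≡ c
𝟙-true c refl = +-identityʳ c

𝟙*-≤ : ∀ b {m n} → (b ≡ true → m ≤ n) → 𝟙 b * m ≤ 𝟙 b * n
𝟙*-≤ true  h = *-monoʳ-≤ 1 (h refl)
𝟙*-≤ false h = z≤n

𝟙*-≤′ : ∀ b {m n} → (b ≡ true → m ≤ n) → 𝟙 b * m ≤ n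
𝟙*-≤′ true  h = ≤-trans (≤-reflexive (+-identityʳ _)) (h refl)
𝟙*-≤′ false h = z≤n

𝟙*-cong : ∀ b {m n} → (b ≡ true → m ≡ n) → 𝟙 b * m ≡ 𝟙 b * n
𝟙*-cong true  h = cong (1 *_) (h refl)
𝟙*-cong false h = refl

opaque
  ∑ : ∀ {n} → (Fin n → ℕ) → ℕ
  ∑ {n} f = sumF n f

syntax ∑ (λ x → e) = ∑[ x ] e

infix 2 ∑

opaque
  unfolding ∑

  ∑-cong : {f g : Fin n → ℕ} → (∀ x → f x ≡ g x) → ∑ f ≡ ∑ g
  ∑-cong {zero}  h = refl
  ∑-cong {suc n} h = cong₂ _+_ (h Fin.zero) (∑-cong (h ∘ Fin.suc))

  ∑-mono : {f g : Fin n → ℕ} → (∀ x → f x ≤ g x) → ∑ f ≤ ∑ g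
  ∑-mono {zero}  h = z≤n
  ∑-mono {suc n} h = +-mono-≤ (h Fin.zero) (∑-mono (h ∘ Fin.suc))

  countF≡∑ : (f : Fin n → Bool) → countF n f ≡ ∑ (𝟙 ∘ f)
  countF≡∑ {zero}  f = refl
  countF≡∑ {suc n} f = cong (𝟙 (f Fin.zero) +_) (countF≡∑ (f ∘ Fin.suc))

  ∑-const : ∀ n c → ∑ {n} (λ _ → c) ≡ n * c
  ∑-const zero    c = refl
  ∑-const (suc n) c = cong (c +_) (∑-const n c)

∑-zero : ∑ {n} (λ _ → 0) ≡ 0
∑-zero {n} = trans (∑-const n 0) (*-zeroʳ n)

+-exchange : ∀ a b c d → (a + b) + (c + d) ≡ (a + c) + (b + d)
+-exchange a b c d = begin
  (a + b) + (c + d) ≡⟨ +-assoc a b (c + d) ⟩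
  a + (b + (c + d)) ≡⟨ cong (a +_) (+-assoc b c d) ⟨
  a + ((b + c) + d) ≡⟨ cong (λ e → a + (e + d)) (+-comm b c) ⟩
  a + ((c + b) + d) ≡⟨ cong (a +_) (+-assoc c b d) ⟩
  a + (c + (b + d)) ≡⟨ +-assoc a c (b + d) ⟨
  (a + c) + (b + d) ∎
  where open ≡-Reasoning

opaque
  unfolding ∑

  ∑-+ : (f g : Fin n → ℕ) → ∑ (λ x → f x + g x) ≡ ∑ f + ∑ g
  ∑-+ {zero}  f g = refl
  ∑-+ {suc n} f g = trans (cong (f Fin.zero + g Fin.zero +_) (∑-+ (f ∘ Fin.suc) (g ∘ Fin.suc)))
    (+-exchange (f Fin.zero) (g Fin.zero) _ _)

  ∑-*ˡ : ∀ c (f : Fin n → ℕ) → c * ∑ f ≡ ∑ (λ x → c * f x)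
  ∑-*ˡ {zero}  c f = *-zeroʳ c
  ∑-*ˡ {suc n} c f = trans (*-distribˡ-+ c (f Fin.zero) _) (cong (c * f Fin.zero +_) (∑-*ˡ c (f ∘ Fin.suc)))

∑-*ʳ : ∀ c (f : Fin n → ℕ) → ∑ f * c ≡ ∑ (λ x → f x * c)
∑-*ʳ c f = trans (*-comm _ c) (trans (∑-*ˡ c f) (∑-cong λ x → *-comm c (f x)))

opaque
  unfolding ∑

  ∑-swap : (f : Fin m → Fin n → ℕ) → (∑[ x ] ∑[ y ] f x y) ≡ (∑[ y ] ∑[ x ] f x y)
  ∑-swap {zero}  {n} f = ≡-sym (∑-zero {n})
  ∑-swap {suc m} f = trans (cong (∑ (f Fin.zero) +_) (∑-swap (f ∘ Fin.suc)))
    (≡-sym (∑-+ (f Fin.zero) (λ y → ∑[ x ] f (Fin.suc x) y)))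

  ≤-∑ : (f : Fin n → ℕ) → ∀ x → f x ≤ ∑ f
  ≤-∑ f Fin.zero    = m≤m+n _ _
  ≤-∑ f (Fin.suc x) = ≤-trans (≤-∑ (f ∘ Fin.suc) x) (m≤n+m _ _)

≟-comm : (x y : Fin n) → ⌊ x ≟ y ⌋ ≡ ⌊ y ≟ x ⌋
≟-comm x y = ⇔⇒≡ (λ h → ⌊⌋-intro (y ≟ x) (≡-sym (⌊⌋-elim (x ≟ y) h)))
                 (λ h → ⌊⌋-intro (x ≟ y) (≡-sym (⌊⌋-elim (y ≟ x) h)))

≟-suc : (x y : Fin n) → ⌊ Fin.suc x ≟ Fin.suc y ⌋ ≡ ⌊ x ≟ y ⌋
≟-suc x y = ⇔⇒≡ (λ h → ⌊⌋-intro (x ≟ y) (Finₚ.suc-injective (⌊⌋-elim (Fin.suc x ≟ Fin.suc y) h)))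
                (λ h → ⌊⌋-intro (Fin.suc x ≟ Fin.suc y) (cong Fin.suc (⌊⌋-elim (x ≟ y) h)))

opaque
  unfolding ∑

  ∑-δ : ∀ x (f : Fin n → ℕ) → (∑[ y ] 𝟙 ⌊ x ≟ y ⌋ * f y) ≡ f x
  ∑-δ {suc n} Fin.zero    f = trans (cong₂ _+_ (+-identityʳ _) (∑-zero {n})) (+-identityʳ _)
  ∑-δ {suc n} (Fin.suc x) f = trans (∑-cong λ y → cong (λ b → 𝟙 b * f (Fin.suc y)) (≟-suc x y)) (∑-δ x (f ∘ Fin.suc))

∑-δ₁ : ∀ (x : Fin n) → (∑[ y ] 𝟙 ⌊ x ≟ y ⌋) ≡ 1
∑-δ₁ x = trans (∑-cong λ y → ≡-sym (*-identityʳ _)) (∑-δ x (λ _ → 1))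

∑-fibre : (φ : Fin m → Fin n) (f : Fin m → ℕ) → ∑ f ≡ (∑[ y ] ∑[ x ] 𝟙 ⌊ φ x ≟ y ⌋ * f x)
∑-fibre φ f = trans (∑-cong λ x → ≡-sym (∑-δ (φ x) (λ _ → f x))) (∑-swap (λ x y → 𝟙 ⌊ φ x ≟ y ⌋ * f x))

opaque
  unfolding ∑

  ∑-splitAt : ∀ m (f : Fin (m + n) → ℕ) → ∑ f ≡ ∑ (λ x → f (x Fin.↑ˡ n)) + ∑ (λ y → f (m Fin.↑ʳ y))
  ∑-splitAt zero    f = refl
  ∑-splitAt (suc m) f = trans (cong (f Fin.zero +_) (∑-splitAt m (f ∘ Fin.suc))) (≡-sym (+-assoc (f Fin.zero) _ _))

  ∑-combine : ∀ m {n} (f : Fin (m * n) → ℕ) → ∑ f ≡ (∑[ c ] ∑[ x ] f (combine {m} {n} c x))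
  ∑-combine zero        f = refl
  ∑-combine (suc m) {n} f = trans (∑-splitAt n f) (cong (∑ (λ x → f (x Fin.↑ˡ (m * n))) +_) (∑-combine m (f ∘ (n Fin.↑ʳ_))))

∑-all-0 : (f : Fin n → ℕ) → (∀ x → f x ≡ 0) → ∑ f ≡ 0
∑-all-0 {n} f h = trans (∑-cong h) (∑-zero {n})

opaque
  unfolding ∑

  ∑≤1 : (P : Fin n → Bool) → (∀ x y → P x ≡ true → P y ≡ true → x ≡ y) → ∑ (𝟙 ∘ P) ≤ 1
  ∑≤1 {zero}  P h = z≤n
  ∑≤1 {suc n} P h with P Fin.zero in eq
  ... | false = ∑≤1 (P ∘ Fin.suc) λ x y p q → Finₚ.suc-injective (h _ _ p q)
  ... | true  = ≤-reflexive (cong suc (∑-all-0 {n} (𝟙 ∘ P ∘ Fin.suc) λ x → cong 𝟙 (≢true⇒≡false λ p → contradiction (h Fin.zero (Fin.suc x) eq p) λ ())))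

-- Double counting over the fibres of `φ`, each of which contains at most one point of `P`.
∑-inj : (P : Fin m → Bool) (φ : Fin m → Fin n) →
  (∀ x y → P x ≡ true → P y ≡ true → φ x ≡ φ y → x ≡ y) →
  (f : Fin n → ℕ) → (∑[ x ] 𝟙 (P x) * f (φ x)) ≤ ∑ f
∑-inj P φ inj f = begin
  (∑[ x ] 𝟙 (P x) * f (φ x))                           ≡⟨ ∑-fibre φ _ ⟩
  (∑[ y ] ∑[ x ] 𝟙 ⌊ φ x ≟ y ⌋ * (𝟙 (P x) * f (φ x))) ≡⟨ ∑-cong (λ y → ∑-cong (λ x → pt x y)) ⟩
  (∑[ y ] ∑[ x ] 𝟙 (⌊ φ x ≟ y ⌋ ∧ P x) * f y)          ≡⟨ ∑-cong (λ y → ∑-*ʳ (f y) (λ x → 𝟙 (⌊ φ x ≟ y ⌋ ∧ P x))) ⟨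
  (∑[ y ] (∑[ x ] 𝟙 (⌊ φ x ≟ y ⌋ ∧ P x)) * f y)        ≤⟨ ∑-mono (λ y → *-monoˡ-≤ (f y) (∑≤1 _ (one y))) ⟩
  (∑[ y ] 1 * f y)                                      ≡⟨ ∑-cong (λ y → *-identityˡ _) ⟩
  ∑ f                                                  ∎
  where
  open ≤-Reasoning
  pt : ∀ x y → 𝟙 ⌊ φ x ≟ y ⌋ * (𝟙 (P x) * f (φ x)) ≡ 𝟙 (⌊ φ x ≟ y ⌋ ∧ P x) * f y
  pt x y with φ x ≟ y
  ... | yes refl = +-identityʳ _
  ... | no  _    = refl
  one : ∀ y a b → ⌊ φ a ≟ y ⌋ ∧ P a ≡ true → ⌊ φ b ≟ y ⌋ ∧ P b ≡ true → a ≡ b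
  one y a b p q = inj a b (∧-elimʳ {⌊ φ a ≟ y ⌋} p) (∧-elimʳ {⌊ φ b ≟ y ⌋} q)
    (trans (⌊⌋-elim (φ a ≟ y) (∧-elimˡ p)) (≡-sym (⌊⌋-elim (φ b ≟ y) (∧-elimˡ q))))

count-inj : (P : Fin m → Bool) (Q : Fin n → Bool) (φ : Fin m → Fin n) →
  (∀ x → P x ≡ true → Q (φ x) ≡ true) →
  (∀ x y → P x ≡ true → P y ≡ true → φ x ≡ φ y → x ≡ y) →
  ∑ (𝟙 ∘ P) ≤ ∑ (𝟙 ∘ Q)
count-inj P Q φ h inj = ≤-trans (∑-mono λ x → lem x (P x) refl) (∑-inj P φ inj (𝟙 ∘ Q))
  where
  lem : ∀ x b → P x ≡ b → 𝟙 b ≤ 𝟙 (P x) * 𝟙 (Q (φ x))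
  lem x true  e = ≤-reflexive (≡-sym (trans (cong₂ (λ a b → 𝟙 a * 𝟙 b) e (h x e)) refl))
  lem x false e = z≤n

∑-bij : (φ : Fin m → Fin n) (ψ : Fin n → Fin m) → (∀ x → ψ (φ x) ≡ x) → (∀ y → φ (ψ y) ≡ y) →
  (f : Fin n → ℕ) → ∑ (f ∘ φ) ≡ ∑ f
∑-bij φ ψ ψφ φψ f = ≤-antisym (half φ ψ ψφ f)
  (≤-trans (≤-reflexive (∑-cong λ y → cong f (≡-sym (φψ y)))) (half ψ φ φψ (f ∘ φ)))
  where
  half : ∀ {m n} (φ : Fin m → Fin n) (ψ : Fin n → Fin m) → (∀ x → ψ (φ x) ≡ x) → (f : Fin n → ℕ) → ∑ (f ∘ φ) ≤ ∑ f
  half φ ψ e f = ≤-trans (≤-reflexive (∑-cong λ x → ≡-sym (*-identityˡ _)))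
    (∑-inj (λ _ → true) φ (λ x y _ _ h → trans (≡-sym (e x)) (trans (cong ψ h) (e y))) f)

opaque
  unfolding ∑

  ∣∑-∑∣≤ : (f g : Fin n → ℕ) → ∣ ∑ f - ∑ g ∣ ≤ (∑[ x ] ∣ f x - g x ∣)
  ∣∑-∑∣≤ {zero}  f g = z≤n
  ∣∑-∑∣≤ {suc n} f g = ≤-trans (∣+-+∣≤ (f Fin.zero) (g Fin.zero) _ _) (+-monoʳ-≤ _ (∣∑-∑∣≤ (f ∘ Fin.suc) (g ∘ Fin.suc)))
    where
    ∣+-+∣≤ : ∀ a b c d → ∣ a + c - b + d ∣ ≤ ∣ a - b ∣ + ∣ c - d ∣
    ∣+-+∣≤ a b c d = begin
      ∣ a + c - b + d ∣                     ≤⟨ ∣-∣-triangle (a + c) (b + c) (b + d) ⟩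
      ∣ a + c - b + c ∣ + ∣ b + c - b + d ∣ ≡⟨ cong₂ _+_ (∣a+c∣ a b c) (∣m+n-m+o∣≡∣n-o∣ b c d) ⟩
      ∣ a - b ∣ + ∣ c - d ∣                 ∎
      where
      open ≤-Reasoning
      ∣a+c∣ : ∀ a b c → ∣ a + c - b + c ∣ ≡ ∣ a - b ∣
      ∣a+c∣ a b c = trans (cong₂ ∣_-_∣ (+-comm a c) (+-comm b c)) (∣m+n-m+o∣≡∣n-o∣ c a b)

record Enumeration {n : ℕ} (P : Fin n → Bool) (m : ℕ) : Set where
  field
    elem      : Fin m → Fin n
    sound     : ∀ i → P (elem i) ≡ true
    complete  : ∀ x → P x ≡ true → ∃[ i ] elem i ≡ x
    injective : ∀ i j → elem i ≡ elem j → i ≡ j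

opaque
  unfolding ∑

  enumerate : (P : Fin n → Bool) → Enumeration P (∑ (𝟙 ∘ P))
  enumerate {zero}  P = record { elem = λ () ; sound = λ () ; complete = λ () ; injective = λ () }
  enumerate {suc n} P with P Fin.zero in eq | enumerate (P ∘ Fin.suc)
  ... | false | E = record
    { elem = Fin.suc ∘ E.elem
    ; sound = E.sound
    ; complete = λ { Fin.zero p → contradiction (trans (≡-sym p) eq) (λ ())
                   ; (Fin.suc x) p → proj₁ (E.complete x p) , cong Fin.suc (proj₂ (E.complete x p)) }
    ; injective = λ i j h → E.injective i j (Finₚ.suc-injective h) }
    where module E = Enumeration E
  ... | true  | E = record
    { elem = λ { Fin.zero → Fin.zero ; (Fin.suc i) → Fin.suc (E.elem i) }
    ; sound = λ { Fin.zero → eq ; (Fin.suc i) → E.sound i }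
    ; complete = λ { Fin.zero p → Fin.zero , refl
                   ; (Fin.suc x) p → Fin.suc (proj₁ (E.complete x p)) , cong Fin.suc (proj₂ (E.complete x p)) }
    ; injective = λ { Fin.zero Fin.zero h → refl
                    ; (Fin.suc i) (Fin.suc j) h → cong Fin.suc (E.injective i j (Finₚ.suc-injective h)) } }
    where module E = Enumeration E

∑-enum : {P : Fin n → Bool} (E : Enumeration P m) (f : Fin n → ℕ) →
  ∑ (f ∘ Enumeration.elem E) ≡ (∑[ x ] 𝟙 (P x) * f x)
∑-enum {P = P} E f = ≤-antisym
  (≤-trans (≤-reflexive (∑-cong λ i → ≡-sym (trans (*-identityˡ _) (𝟙-true _ (sound i)))))
    (∑-inj (λ _ → true) elem (λ i j _ _ → injective i j) (λ x → 𝟙 (P x) * f x)))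
  (≤-trans (∑-mono λ x → lem x (P x) refl) (≤-reflexive (≡-sym (∑-fibre elem (f ∘ elem)))))
  where
  open Enumeration E
  lem : ∀ x b → P x ≡ b → 𝟙 b * f x ≤ (∑[ i ] 𝟙 ⌊ elem i ≟ x ⌋ * f (elem i))
  lem x false e = z≤n
  lem x true  e with complete x e
  ... | i , refl = ≤-trans (≤-reflexive (cong (λ b → 𝟙 b * f (elem i)) (≡-sym (⌊⌋-intro (elem i ≟ elem i) refl))))
                     (≤-∑ (λ j → 𝟙 ⌊ elem j ≟ elem i ⌋ * f (elem j)) i)

-- Permutations

perm-injective : (π : Permutation′ n) → ∀ {x y} → π ⟨$⟩ʳ x ≡ π ⟨$⟩ʳ y → x ≡ y
perm-injective π h = trans (≡-sym (inverseˡ π)) (trans (cong (π ⟨$⟩ˡ_) h) (inverseˡ π))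

∑-perm : (π : Permutation′ n) (f : Fin n → ℕ) → (∑[ x ] f (π ⟨$⟩ʳ x)) ≡ ∑ f
∑-perm π f = ∑-bij (π ⟨$⟩ʳ_) (π ⟨$⟩ˡ_) (λ _ → inverseˡ π) (λ _ → inverseʳ π) f

transpose-first : (i j : Fin n) → transpose i j ⟨$⟩ʳ i ≡ j
transpose-first i j with i ≟ i
... | yes _  = refl
... | no i≢i = contradiction refl i≢i

transpose-other : (i j : Fin n) {k : Fin n} → k ≢ i → k ≢ j → transpose i j ⟨$⟩ʳ k ≡ k
transpose-other i j {k} k≢i k≢j with k ≟ i
... | yes e = contradiction e k≢i
... | no  _ with k ≟ j
...   | yes e = contradiction e k≢j
...   | no  _ = refl

opaque
  -- Local maps are built on part of the vertex set only, but relabellings must be permutations. The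
  -- points are treated in increasing order, and the permutation is corrected by one transposition
  -- at each point of `P`.
  extend-injection : (P : Fin n → Bool) (φ : Fin n → Fin n) →
    (∀ x y → P x ≡ true → P y ≡ true → φ x ≡ φ y → x ≡ y) →
    ∃[ π ] ∀ x → P x ≡ true → π ⟨$⟩ʳ x ≡ φ x
  extend-injection {n} P φ inj = proj₁ (go n ≤-refl) , λ x → proj₂ (go n ≤-refl) x (Finₚ.toℕ<n x)
    where
    go : ∀ b → b ≤ n → Σ (Permutation′ n) λ π → ∀ x → toℕ x < b → P x ≡ true → π ⟨$⟩ʳ x ≡ φ x
    go zero    _   = Perm.id , λ x ()
    go (suc b) b<n with go b (<⇒≤ b<n) | P (Fin.fromℕ< b<n) in eq
    ... | π , h | Pc = step Pc eq
      where
      c : Fin n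
      c = Fin.fromℕ< b<n
      split : ∀ x → toℕ x < suc b → toℕ x < b ⊎ x ≡ c
      split x x<1+b with m≤n⇒m<n∨m≡n (≤-pred x<1+b)
      ... | inj₁ x<b = inj₁ x<b
      ... | inj₂ x≡b = inj₂ (Finₚ.toℕ-injective (trans x≡b (≡-sym (Finₚ.toℕ-fromℕ< b<n))))
      step : ∀ v → P c ≡ v → Σ (Permutation′ n) λ π → ∀ x → toℕ x < suc b → P x ≡ true → π ⟨$⟩ʳ x ≡ φ x
      step false Pc = π , λ x x<1+b Px → case x Px (split x x<1+b)
        where
        case : ∀ x → P x ≡ true → toℕ x < b ⊎ x ≡ c → π ⟨$⟩ʳ x ≡ φ x
        case x Px (inj₁ x<b)  = h x x<b Px
        case x Px (inj₂ refl) = contradiction Pc (true≢false Px)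
      -- The transposition sends c to `φ c`. Earlier points keep their images: these differ from the
      -- old image of c because π is injective, and from `φ c` because `φ` is injective on `P`.
      step true  Pc = π ∘ₚ transpose (π ⟨$⟩ʳ c) (φ c) , λ x x<1+b Px → case x Px (split x x<1+b)
        where
        case : ∀ x → P x ≡ true → toℕ x < b ⊎ x ≡ c → transpose (π ⟨$⟩ʳ c) (φ c) ⟨$⟩ʳ (π ⟨$⟩ʳ x) ≡ φ x
        case x Px (inj₂ refl) = transpose-first (π ⟨$⟩ʳ c) (φ c)
        case x Px (inj₁ x<b)  = trans (transpose-other (π ⟨$⟩ʳ c) (φ c) (x≢c ∘ perm-injective π)
            (λ e → x≢c (inj x c Px Pc (trans (≡-sym (h x x<b Px)) e)))) (h x x<b Px)
          where
          x≢c : x ≢ c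
          x≢c refl = <-irrefl (Finₚ.toℕ-fromℕ< b<n) x<b

∑-mono-< : {f g : Fin n → ℕ} → (∀ x → f x ≤ g x) → ∀ x → f x < g x → ∑ f < ∑ g
∑-mono-< {n} {f} {g} f≤g x fx<gx = begin-strict
  ∑ f                                        <⟨ n<1+n _ ⟩
  1 + ∑ f                                    ≡⟨ cong (_+ ∑ f) (∑-δ₁ x) ⟨
  (∑[ y ] 𝟙 ⌊ x ≟ y ⌋) + ∑ f                 ≡⟨ ∑-+ (λ y → 𝟙 ⌊ x ≟ y ⌋) f ⟨
  ∑ (λ y → 𝟙 ⌊ x ≟ y ⌋ + f y)                ≤⟨ ∑-mono pt ⟩
  ∑ g                                        ∎
  where
  open ≤-Reasoning
  pt : ∀ y → 𝟙 ⌊ x ≟ y ⌋ + f y ≤ g y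
  pt y with x ≟ y
  ... | yes refl = fx<gx
  ... | no  _    = f≤g y

mismatch : (γ₁ γ₂ : Fin n → Fin m) → Permutation′ n → Fin n → Bool
mismatch γ₁ γ₂ π x = not ⌊ γ₂ (π ⟨$⟩ʳ x) ≟ γ₁ x ⌋

-- As long as two mismatched points can be repaired by a transposition, do so; when none is left,
-- every colour is used up on one of the two sides.
opaque
  match-colours : (γ₁ γ₂ : Fin n → Fin m) → ∃[ π ]
    ∑ (𝟙 ∘ mismatch γ₁ γ₂ π) ≤ (∑[ c ] ∣ (∑[ x ] 𝟙 ⌊ γ₁ x ≟ c ⌋) - (∑[ x ] 𝟙 ⌊ γ₂ x ≟ c ⌋) ∣)
  match-colours {n} {m} γ₁ γ₂ = go _ Perm.id ≤-refl
    where
    cnt₁ cnt₂ : Fin m → ℕ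
    cnt₁ c = ∑[ x ] 𝟙 ⌊ γ₁ x ≟ c ⌋
    cnt₂ c = ∑[ x ] 𝟙 ⌊ γ₂ x ≟ c ⌋
    mis : Permutation′ n → Fin n → Bool
    mis = mismatch γ₁ γ₂
    swappable : Permutation′ n → Fin n → Fin n → Bool
    swappable π x y = mis π x ∧ (mis π y ∧ ⌊ γ₂ (π ⟨$⟩ʳ y) ≟ γ₁ x ⌋)
    mis-false : ∀ π x → mis π x ≡ false → γ₂ (π ⟨$⟩ʳ x) ≡ γ₁ x
    mis-false π x h with γ₂ (π ⟨$⟩ʳ x) ≟ γ₁ x
    ... | yes e = e
    mis-≡ : ∀ π x → γ₂ (π ⟨$⟩ʳ x) ≡ γ₁ x → mis π x ≡ false
    mis-≡ π x h with γ₂ (π ⟨$⟩ʳ x) ≟ γ₁ x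
    ... | yes _ = refl
    ... | no ne = contradiction h ne
    colourwise : ∀ π → (∀ x y → swappable π x y ≡ false) → ∀ c →
      (∑[ x ] 𝟙 ⌊ γ₁ x ≟ c ⌋ * 𝟙 (mis π x)) ≤ ∣ cnt₁ c - cnt₂ c ∣
    colourwise π stuck c with anyF n (λ x → ⌊ γ₁ x ≟ c ⌋ ∧ mis π x) in eq
    ... | false = ≤-trans (≤-reflexive (∑-all-0 _ λ x → trans (≡-sym (𝟙-∧ ⌊ γ₁ x ≟ c ⌋ _)) (cong 𝟙 (anyF-false _ eq x)))) z≤n
    ... | true with anyF-elim _ eq
    ...   | x , q = ≤-trans (m+n≤o⇒m≤o∸n _ both) (≤-trans (m∸n≤∣m-n∣ (cnt₁ c) (cnt₂ c)) ≤-refl)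
      where
      γx : γ₁ x ≡ c
      γx = ⌊⌋-elim (γ₁ x ≟ c) (∧-elimˡ q)
      -- Since x is a mismatched point that wants colour c, no mismatched y can receive colour c.
      -- Hence the points receiving c are all matched, have `γ₁`-colour c, and are disjoint from the
      -- mismatched points of that colour.
      pt : ∀ y → 𝟙 ⌊ γ₁ y ≟ c ⌋ * 𝟙 (mis π y) + 𝟙 ⌊ γ₂ (π ⟨$⟩ʳ y) ≟ c ⌋ ≤ 𝟙 ⌊ γ₁ y ≟ c ⌋
      pt y with γ₂ (π ⟨$⟩ʳ y) ≟ c | mis π y in my
      ... | no _  | true  = ≤-reflexive (trans (+-identityʳ _) (*-identityʳ _))
      ... | no _  | false = ≤-trans (≤-reflexive (trans (+-identityʳ _) (*-zeroʳ (𝟙 ⌊ γ₁ y ≟ c ⌋)))) z≤n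
      ... | yes e | true  = contradiction (stuck x y)
              (true≢false (∧-intro (∧-elimʳ {⌊ γ₁ x ≟ c ⌋} q) (∧-intro my (⌊⌋-intro (_ ≟ _) (trans e (≡-sym γx))))))
      ... | yes e | false = ≤-reflexive (cong₂ _+_ (*-zeroʳ (𝟙 ⌊ γ₁ y ≟ c ⌋))
              (≡-sym (cong 𝟙 (⌊⌋-intro (_ ≟ c) (trans (≡-sym (mis-false π y my)) e)))))
      both : (∑[ y ] 𝟙 ⌊ γ₁ y ≟ c ⌋ * 𝟙 (mis π y)) + cnt₂ c ≤ cnt₁ c
      both = ≤-trans (≤-reflexive (trans (cong ((∑[ y ] 𝟙 ⌊ γ₁ y ≟ c ⌋ * 𝟙 (mis π y)) +_) (≡-sym (∑-perm π (λ y → 𝟙 ⌊ γ₂ y ≟ c ⌋)))) (≡-sym (∑-+ (λ y → 𝟙 ⌊ γ₁ y ≟ c ⌋ * 𝟙 (mis π y)) _))))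
               (∑-mono pt)
    go : ∀ b π → ∑ (𝟙 ∘ mis π) ≤ b → ∃[ π ] ∑ (𝟙 ∘ mis π) ≤ (∑[ c ] ∣ cnt₁ c - cnt₂ c ∣)
    go b π h with anyF n (λ x → anyF n (λ y → swappable π x y)) in eq
    ... | false = π , ≤-trans (≤-reflexive (∑-fibre γ₁ _))
                        (∑-mono (colourwise π λ x y → anyF-false _ (anyF-false _ eq x) y))
    ... | true with anyF-elim _ eq
    ...   | x , q with anyF-elim _ q
    ...     | y , r = continue b (≤-trans fewer h)
      where
      π′ : Permutation′ n
      π′ = transpose x y ∘ₚ π
      mx : mis π x ≡ true
      mx = ∧-elimˡ r
      my : mis π y ≡ true
      my = ∧-elimˡ (∧-elimʳ {mis π x} r)
      m′x : mis π′ x ≡ false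
      m′x = mis-≡ π′ x (trans (cong (γ₂ ∘ (π ⟨$⟩ʳ_)) (transpose-first x y)) (⌊⌋-elim (_ ≟ _) (∧-elimʳ {mis π y} (∧-elimʳ {mis π x} r))))
      -- The swap repairs x, and y was mismatched already, so no new mismatch can arise.
      pt : ∀ u → 𝟙 (mis π′ u) ≤ 𝟙 (mis π u)
      pt u = by (u ≟ x) (u ≟ y)
        where
        by : Dec (u ≡ x) → Dec (u ≡ y) → 𝟙 (mis π′ u) ≤ 𝟙 (mis π u)
        by (yes u≡x) _         = ≤-trans (≤-reflexive (cong 𝟙 (trans (cong (mis π′) u≡x) m′x))) z≤n
        by (no _)    (yes u≡y) = ≤-trans (𝟙≤1 (mis π′ u)) (≤-reflexive (≡-sym (cong 𝟙 (trans (cong (mis π) u≡y) my))))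
        by (no u≢x)  (no u≢y)  = ≤-reflexive (cong (λ v → 𝟙 (not ⌊ γ₂ (π ⟨$⟩ʳ v) ≟ γ₁ u ⌋)) (transpose-other x y u≢x u≢y))
      fewer : ∑ (𝟙 ∘ mis π′) < ∑ (𝟙 ∘ mis π)
      fewer = ∑-mono-< pt x (≤-reflexive (trans (cong (suc ∘ 𝟙) m′x) (≡-sym (cong 𝟙 mx))))
      continue : ∀ b → ∑ (𝟙 ∘ mis π′) < b → ∃[ π ] ∑ (𝟙 ∘ mis π) ≤ (∑[ c ] ∣ cnt₁ c - cnt₂ c ∣)
      continue (suc b) lt = go b π′ (≤-pred lt)

opaque
  -- Lehmer code: the image of 0, followed by the code of the remaining permutation. A finite index
  -- set makes the search for local isomorphisms decidable and lets them be counted and averaged.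
  decodePerm : ∀ n → Fin (n !) → Permutation′ n
  decodePerm zero    _ = Perm.id
  decodePerm (suc n) c = insert Fin.zero (Fin.quotient (n !) c) (decodePerm n (Fin.remainder {suc n} (n !) c))

  encodePerm : ∀ n → Permutation′ n → Fin (n !)
  encodePerm zero    _ = Fin.zero
  encodePerm (suc n) π = combine (π ⟨$⟩ʳ Fin.zero) (encodePerm n (remove Fin.zero π))

  insert-cong : ∀ (j : Fin (suc n)) {π ρ : Permutation′ n} → (∀ x → π ⟨$⟩ʳ x ≡ ρ ⟨$⟩ʳ x) →
    ∀ x → insert Fin.zero j π ⟨$⟩ʳ x ≡ insert Fin.zero j ρ ⟨$⟩ʳ x
  insert-cong j h Fin.zero    = refl
  insert-cong j {π} {ρ} h (Fin.suc x) = cong (Fin.punchIn j) (h x)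

  decode-encode : ∀ n (π : Permutation′ n) x → decodePerm n (encodePerm n π) ⟨$⟩ʳ x ≡ π ⟨$⟩ʳ x
  decode-encode (suc n) π x = trans
    (cong (λ p → insert Fin.zero (proj₁ p) (decodePerm n (proj₂ p)) ⟨$⟩ʳ x)
      (Finₚ.remQuot-combine (π ⟨$⟩ʳ Fin.zero) (encodePerm n (remove Fin.zero π))))
    (trans (insert-cong (π ⟨$⟩ʳ Fin.zero) (decode-encode n (remove Fin.zero π)) x) (insert-remove Fin.zero π x))

  decode-injective : ∀ n (a b : Fin (n !)) → (∀ x → decodePerm n a ⟨$⟩ʳ x ≡ decodePerm n b ⟨$⟩ʳ x) → a ≡ b
  decode-injective zero    Fin.zero Fin.zero h = refl
  decode-injective (suc n) a b h = trans (≡-sym (Finₚ.combine-remQuot {suc n} (n !) a))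
    (trans (cong₂ combine (h Fin.zero) (decode-injective n _ _ tails)) (Finₚ.combine-remQuot {suc n} (n !) b))
    where
    j : Fin (suc n)
    j = Fin.quotient {suc n} (n !) a
    tails : ∀ x → decodePerm n (Fin.remainder {suc n} (n !) a) ⟨$⟩ʳ x ≡ decodePerm n (Fin.remainder {suc n} (n !) b) ⟨$⟩ʳ x
    tails x = Finₚ.punchIn-injective j _ _ (trans (h (Fin.suc x)) (cong (λ i → Fin.punchIn i _) (≡-sym (h Fin.zero))))

-- Walks, balls and local isomorphisms

Adj : ℕ → Set
Adj n = Fin n → Fin n → Bool

Symmetric : Adj n → Set
Symmetric A = ∀ x y → A x y ≡ A y x

-- As `here` is available at every r, the index bounds the length from above: a walk exists exactly
-- when the distance is at most r.
data Walk {n : ℕ} (A : Adj n) : ℕ → Fin n → Fin n → Set where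
  here : ∀ {r x} → Walk A r x x
  step : ∀ {r x y z} → A x z ≡ true → Walk A r z y → Walk A (suc r) x y

reach⇒walk : (A : Adj n) → ∀ r {x y} → reach A r x y ≡ true → Walk A r x y
reach⇒walk A zero    {x} {y} h with ⌊⌋-elim (x ≟ y) h
... | refl = here
reach⇒walk A (suc r) {x} {y} h with ∨-elim {reach A r x y} h
... | inj₁ p = mono (reach⇒walk A r p)
  where
  mono : ∀ {r x y} → Walk A r x y → Walk A (suc r) x y
  mono here       = here
  mono (step a w) = step a (mono w)
... | inj₂ p with anyF-elim (λ z → A x z ∧ reach A r z y) p
...   | z , q = step (∧-elimˡ q) (reach⇒walk A r (∧-elimʳ {A x z} q))

walk⇒reach : (A : Adj n) → ∀ {r x y} → Walk A r x y → reach A r x y ≡ true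
walk⇒reach A {zero}  {x} here = ⌊⌋-intro (x ≟ x) refl
walk⇒reach A {suc r} {x} here = ∨-introˡ (walk⇒reach A {r} {x} here)
walk⇒reach A {suc r} {x} {y} (step {z = z} a w) =
  ∨-introʳ {reach A r x y} (anyF-intro (λ z → A x z ∧ reach A r z y) z (∧-intro a (walk⇒reach A w)))

walk-mono : {A : Adj n} → ∀ {r s x y} → r ≤ s → Walk A r x y → Walk A s x y
walk-mono r≤s       here       = here
walk-mono (s≤s r≤s) (step a w) = step a (walk-mono r≤s w)

walk-++ : {A : Adj n} → ∀ {r s x y z} → Walk A r x y → Walk A s y z → Walk A (r + s) x z
walk-++ {r = r} here v       = walk-mono (m≤n+m _ r) v
walk-++ (step a w) v = step a (walk-++ w v)

walk-snoc : {A : Adj n} → ∀ {r x y z} → Walk A r x y → A y z ≡ true → Walk A (suc r) x z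
walk-snoc here       b = step b here
walk-snoc (step a w) b = step a (walk-snoc w b)

walk-sym : {A : Adj n} → Symmetric A → ∀ {r x y} → Walk A r x y → Walk A r y x
walk-sym S here                       = here
walk-sym S (step {x = x} {z = z} a w) = walk-snoc (walk-sym S w) (trans (S z x) a)

reach-sym : {A : Adj n} → Symmetric A → ∀ r x y → reach A r x y ≡ reach A r y x
reach-sym {A = A} S r x y = ⇔⇒≡ (λ h → walk⇒reach A (walk-sym S (reach⇒walk A r h)))
                                (λ h → walk⇒reach A (walk-sym S (reach⇒walk A r h)))

𝟙-anyF : (f : Fin n → Bool) → 𝟙 (anyF n f) ≤ ∑ (𝟙 ∘ f)
𝟙-anyF {n} f with anyF n f in eq
... | false = z≤n
... | true with anyF-elim f eq
...   | x , fx = ≤-trans (≤-reflexive (≡-sym (cong 𝟙 fx))) (≤-∑ (𝟙 ∘ f) x)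

DegreeBound : ℕ → Adj n → Set
DegreeBound d A = ∀ x → (∑[ y ] 𝟙 (A x y)) ≤ d

-- The ball of radius r + 1 is covered by the r-ball around x and the r-balls around its at most d
-- neighbours.
ball-size : ∀ {d} {A : Adj n} → DegreeBound d A → ∀ r x → (∑[ y ] 𝟙 (reach A r x y)) ≤ suc d ^ r
ball-size D zero    x = ≤-reflexive (∑-δ₁ x)
ball-size {n} {d} {A} D (suc r) x = begin
  (∑[ y ] 𝟙 (reach A r x y ∨ anyF n (λ z → A x z ∧ reach A r z y)))
    ≤⟨ ∑-mono (λ y → ≤-trans (𝟙-∨ (reach A r x y) _) (+-monoʳ-≤ _ (𝟙-anyF (λ z → A x z ∧ reach A r z y)))) ⟩
  (∑[ y ] (𝟙 (reach A r x y) + (∑[ z ] 𝟙 (A x z ∧ reach A r z y))))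
    ≡⟨ ∑-+ (λ y → 𝟙 (reach A r x y)) _ ⟩
  (∑[ y ] 𝟙 (reach A r x y)) + (∑[ y ] ∑[ z ] 𝟙 (A x z ∧ reach A r z y))
    ≡⟨ cong ((∑[ y ] 𝟙 (reach A r x y)) +_) (∑-swap (λ y z → 𝟙 (A x z ∧ reach A r z y))) ⟩
  (∑[ y ] 𝟙 (reach A r x y)) + (∑[ z ] ∑[ y ] 𝟙 (A x z ∧ reach A r z y))
    ≤⟨ +-mono-≤ (ball-size D r x) (∑-mono inner) ⟩
  suc d ^ r + (∑[ z ] 𝟙 (A x z) * suc d ^ r)
    ≡⟨ cong (suc d ^ r +_) (∑-*ʳ (suc d ^ r) (λ z → 𝟙 (A x z))) ⟨
  suc d ^ r + (∑[ z ] 𝟙 (A x z)) * suc d ^ r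
    ≤⟨ +-monoʳ-≤ (suc d ^ r) (*-monoˡ-≤ (suc d ^ r) (D x)) ⟩
  suc d ^ r + d * suc d ^ r ∎
  where
  open ≤-Reasoning
  inner : ∀ z → (∑[ y ] 𝟙 (A x z ∧ reach A r z y)) ≤ 𝟙 (A x z) * suc d ^ r
  inner z = begin
    (∑[ y ] 𝟙 (A x z ∧ reach A r z y))         ≡⟨ ∑-cong (λ y → 𝟙-∧ (A x z) _) ⟩
    (∑[ y ] 𝟙 (A x z) * 𝟙 (reach A r z y))     ≡⟨ ∑-*ˡ (𝟙 (A x z)) (λ y → 𝟙 (reach A r z y)) ⟨
    𝟙 (A x z) * (∑[ y ] 𝟙 (reach A r z y))     ≤⟨ *-monoʳ-≤ (𝟙 (A x z)) (ball-size D r z) ⟩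
    𝟙 (A x z) * suc d ^ r                      ∎

-- A local isomorphism around x, encoded as a permutation of all vertices that preserves the full
-- stars inside the R-ball and is arbitrary elsewhere. Totality makes composition and inversion
-- unconditional.
record Good {n : ℕ} (A B : Adj n) (θ : Permutation′ n) (R : ℕ) (x : Fin n) : Set where
  constructor good
  field
    star : ∀ u → Walk A R x u → ∀ v → A u v ≡ B (θ ⟨$⟩ʳ u) (θ ⟨$⟩ʳ v)
open Good

module _ {A B : Adj n} (θ : Permutation′ n) where

  good-mono : ∀ {R S x} → R ≤ S → Good A B θ S x → Good A B θ R x
  good-mono R≤S g = good λ u w → star g u (walk-mono R≤S w)

  good-recentre : ∀ {k R x u} → Good A B θ (k + R) x → Walk A k x u → Good A B θ R u
  good-recentre g w = good λ v w′ → star g v (walk-++ w w′)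

  good-cong : ∀ {θ′ : Permutation′ n} {R x} → (∀ u → θ ⟨$⟩ʳ u ≡ θ′ ⟨$⟩ʳ u) → Good A B θ R x → Good A B θ′ R x
  good-cong h g = good λ u w v → trans (star g u w v) (cong₂ B (h u) (h v))

  -- The length may be R + 1: the last edge leaves from a vertex at distance at most R, whose whole
  -- star is preserved. The same allowance holds for lifting walks back.
  good-walk : ∀ {r R x u} → Good A B θ R x → r ≤ suc R → Walk A r x u → Walk B r (θ ⟨$⟩ʳ x) (θ ⟨$⟩ʳ u)
  good-walk {r} {R} {x} g r≤1+R = go 0 here r≤1+R
    where
    go : ∀ p {r z u} → Walk A p x z → p + r ≤ suc R → Walk A r z u → Walk B r (θ ⟨$⟩ʳ z) (θ ⟨$⟩ʳ u)
    go p xz h here = here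
    go p {suc r} {z} xz h (step {z = z′} a w) =
      step (trans (≡-sym (star g z (walk-mono (m+n≤o⇒m≤o p h′) xz) z′)) a) (go (suc p) (walk-snoc xz a) (s≤s h′) w)
      where
      h′ : p + r ≤ R
      h′ = ≤-pred (subst (_≤ suc R) (+-suc p r) h)

  good-walk⁻ : ∀ {r R x w} → Good A B θ R x → r ≤ suc R → Walk B r (θ ⟨$⟩ʳ x) w → Walk A r x (θ ⟨$⟩ˡ w)
  good-walk⁻ {r} {R} {x} g r≤1+R W = go 0 here r≤1+R W refl
    where
    go : ∀ p {r z y w} → Walk A p x z → p + r ≤ suc R → Walk B r y w → θ ⟨$⟩ʳ z ≡ y → Walk A r z (θ ⟨$⟩ˡ w)
    go p {r} {z} xz h here refl = subst (Walk A r z) (≡-sym (inverseˡ θ)) here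
    go p {suc r} {z} xz h (step {z = y′} b w) refl = step a (go (suc p) (walk-snoc xz a) (s≤s h′) w (inverseʳ θ))
      where
      h′ : p + r ≤ R
      h′ = ≤-pred (subst (_≤ suc R) (+-suc p r) h)
      a : A z (θ ⟨$⟩ˡ y′) ≡ true
      a = trans (star g z (walk-mono (m+n≤o⇒m≤o p h′) xz) (θ ⟨$⟩ˡ y′)) (trans (cong (B (θ ⟨$⟩ʳ z)) (inverseʳ θ)) b)

good-flip : {A B : Adj n} (θ : Permutation′ n) → ∀ {R x} → Good A B θ R x → Good B A (flip θ) R (θ ⟨$⟩ʳ x)
good-flip {B = B} θ g = good λ u w v → ≡-sym (trans (star g _ (good-walk⁻ θ g (n≤1+n _) w) _) (cong₂ B (inverseʳ θ) (inverseʳ θ)))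

good-∘ : {A B C : Adj n} (θ ψ : Permutation′ n) → ∀ {R x} →
  Good A B θ R x → Good B C ψ R (θ ⟨$⟩ʳ x) → Good A C (θ ∘ₚ ψ) R x
good-∘ θ ψ g h = good λ u w v → trans (star g u w v) (star h _ (good-walk θ g (n≤1+n _) w) _)

opaque
  good? : (A B : Adj n) (θ : Permutation′ n) (R : ℕ) (x : Fin n) → Dec (Good A B θ R x)
  good? A B θ R x = map′
    (λ h → good λ u w → h u (walk⇒reach A w))
    (λ g u r → star g u (reach⇒walk A R r))
    (Finₚ.all? λ u → (reach A R x u ≟ᵇ true) →-dec (Finₚ.all? λ v → A u v ≟ᵇ B (θ ⟨$⟩ʳ u) (θ ⟨$⟩ʳ v)))

Similar : Adj n → Adj n → ℕ → Fin n → Fin n → Set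
Similar A B R x y = ∃[ θ ] Good A B θ R x × θ ⟨$⟩ʳ x ≡ y

similar-refl : {A : Adj n} → ∀ {R} x → Similar A A R x x
similar-refl x = Perm.id , good (λ _ _ _ → refl) , refl

similar-sym : {A B : Adj n} → ∀ {R x y} → Similar A B R x y → Similar B A R y x
similar-sym (θ , g , refl) = flip θ , good-flip θ g , inverseˡ θ

similar-trans : {A B C : Adj n} → ∀ {R x y z} → Similar A B R x y → Similar B C R y z → Similar A C R x z
similar-trans (θ , g , refl) (ψ , h , refl) = θ ∘ₚ ψ , good-∘ θ ψ g h , refl

similar-mono : {A B : Adj n} → ∀ {R S x y} → R ≤ S → Similar A B S x y → Similar A B R x y
similar-mono R≤S (θ , g , e) = θ , good-mono θ R≤S g , e

opaque
  similar? : (A B : Adj n) (R : ℕ) (x y : Fin n) → Dec (Similar A B R x y)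
  similar? {n} A B R x y = map′
    (λ (c , g , e) → decodePerm n c , g , e)
    (λ (θ , g , e) → encodePerm n θ , good-cong θ (λ u → ≡-sym (decode-encode n θ u)) g , trans (decode-encode n θ x) e)
    (Finₚ.any? λ c → good? A B (decodePerm n c) R x ×-dec (decodePerm n c ⟨$⟩ʳ x ≟ y))

-- Means over classes and their energy

record IsEquiv {n : ℕ} (_~_ : Adj n) : Set where
  field
    ~-refl  : ∀ x → x ~ x ≡ true
    ~-sym   : ∀ {x y} → x ~ y ≡ true → y ~ x ≡ true
    ~-trans : ∀ {x y z} → x ~ y ≡ true → y ~ z ≡ true → x ~ z ≡ true

m∣n! : 1 ≤ m → m ≤ n → m ∣ n !
m∣n! {suc m} _ m≤n = ∣-trans (m∣m*n (m !)) (m≤n⇒m!∣n! m≤n)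

open IsEquiv

module Average {n : ℕ} (_~_ : Adj n) (isEquiv : IsEquiv _~_) where

  class : Fin n → ℕ
  class x = ∑[ y ] 𝟙 (x ~ y)

  ~-cong : ∀ {x y} → x ~ y ≡ true → ∀ z → x ~ z ≡ y ~ z
  ~-cong h z = ⇔⇒≡ (~-trans isEquiv (~-sym isEquiv h)) (~-trans isEquiv h)

  1≤class : ∀ x → 1 ≤ class x
  1≤class x = ≤-trans (≤-reflexive (≡-sym (cong 𝟙 (~-refl isEquiv x)))) (≤-∑ (λ y → 𝟙 (x ~ y)) x)

  class≤n : ∀ x → class x ≤ n
  class≤n x = ≤-trans (∑-mono λ y → 𝟙≤1 (x ~ y)) (≤-reflexive (trans (∑-const n 1) (*-identityʳ n)))

  weight : Fin n → ℕ
  weight x = _∣_.quotient (m∣n! (1≤class x) (class≤n x))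

  weight*class : ∀ x → weight x * class x ≡ n !
  weight*class x = ≡-sym (_∣_.equality (m∣n! (1≤class x) (class≤n x)))

  weight-cong : ∀ {x y} → x ~ y ≡ true → weight x ≡ weight y
  weight-cong {x} {y} h = *-cancelʳ-≡ (weight x) (weight y) (class x) {{ℕ.>-nonZero (1≤class x)}}
    (trans (weight*class x) (trans (≡-sym (weight*class y)) (cong (weight y *_) (∑-cong λ z → cong 𝟙 (≡-sym (~-cong h z))))))

  -- n ! times the mean of f over the class of x; the factor n ! clears all denominators.
  avg : (Fin n → ℕ) → Fin n → ℕ
  avg f x = weight x * (∑[ y ] 𝟙 (x ~ y) * f y)

  avg-cong : ∀ f {x y} → x ~ y ≡ true → avg f x ≡ avg f y
  avg-cong f h = cong₂ _*_ (weight-cong h) (∑-cong λ z → cong (λ b → 𝟙 b * f z) (~-cong h z))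

  avg-≤ : ∀ f → (∀ x → f x ≤ 1) → ∀ x → avg f x ≤ n !
  avg-≤ f f≤1 x = ≤-trans
    (*-monoʳ-≤ (weight x) (∑-mono λ y → ≤-trans (*-monoʳ-≤ (𝟙 (x ~ y)) (f≤1 y)) (≤-reflexive (*-identityʳ _))))
    (≤-reflexive (weight*class x))

  -- The defining property of conditional expectation. After exchanging the two summations each y is
  -- counted once per member of its class, and `weight` times the class size is n !.
  ∑-avg : ∀ f (p : Fin n → ℕ) → (∀ {x y} → x ~ y ≡ true → p x ≡ p y) →
    (∑[ x ] p x * avg f x) ≡ n ! * (∑[ x ] p x * f x)
  ∑-avg f p p-cong = begin
    (∑[ x ] p x * avg f x)                                     ≡⟨ ∑-cong (λ x → trans (≡-sym (*-assoc (p x) _ _)) (∑-*ˡ (p x * weight x) (λ y → 𝟙 (x ~ y) * f y))) ⟩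
    (∑[ x ] ∑[ y ] (p x * weight x) * (𝟙 (x ~ y) * f y))       ≡⟨ ∑-cong (λ x → ∑-cong (λ y → swap x y)) ⟩
    (∑[ x ] ∑[ y ] 𝟙 (y ~ x) * ((p y * weight y) * f y))       ≡⟨ ∑-swap (λ x y → 𝟙 (y ~ x) * ((p y * weight y) * f y)) ⟩
    (∑[ y ] ∑[ x ] 𝟙 (y ~ x) * ((p y * weight y) * f y))       ≡⟨ ∑-cong (λ y → ∑-*ʳ _ (λ x → 𝟙 (y ~ x))) ⟨
    (∑[ y ] class y * ((p y * weight y) * f y))                ≡⟨ ∑-cong (λ y → collect y) ⟩
    (∑[ y ] n ! * (p y * f y))                                 ≡⟨ ∑-*ˡ (n !) (λ y → p y * f y) ⟨
    n ! * (∑[ y ] p y * f y)                                   ∎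
    where
    open ≡-Reasoning
    open +-*-Solver
    comm3 : ∀ a b c → a * (b * c) ≡ b * (a * c)
    comm3 = solve 3 (λ a b c → a :* (b :* c) := b :* (a :* c)) refl
    swap : ∀ x y → (p x * weight x) * (𝟙 (x ~ y) * f y) ≡ 𝟙 (y ~ x) * ((p y * weight y) * f y)
    swap x y = trans (comm3 (p x * weight x) (𝟙 (x ~ y)) (f y))
      (trans (𝟙*-cong (x ~ y) (λ h → cong (_* f y) (cong₂ _*_ (p-cong h) (weight-cong h))))
        (cong (λ b → 𝟙 b * ((p y * weight y) * f y)) (⇔⇒≡ (~-sym isEquiv) (~-sym isEquiv))))
    collect : ∀ y → class y * ((p y * weight y) * f y) ≡ n ! * (p y * f y)
    collect y = trans (solve 4 (λ c p w f → c :* ((p :* w) :* f) := (w :* c) :* (p :* f)) refl (class y) (p y) (weight y) (f y))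
      (cong (_* (p y * f y)) (weight*class y))

open Average using (avg; avg-cong; avg-≤; ∑-avg)

∣-∣²+2* : ∀ a b → ∣ a - b ∣ * ∣ a - b ∣ + 2 * (a * b) ≡ a * a + b * b
∣-∣²+2* a b with ≤-total a b
... | inj₁ a≤b = trans (cong₂ (λ u v → u * u + 2 * (a * v)) (m≤n⇒∣m-n∣≡n∸m a≤b) (≡-sym (m+[n∸m]≡n a≤b)))
      (trans (solve 2 (λ a c → c :* c :+ con 2 :* (a :* (a :+ c)) := a :* a :+ (a :+ c) :* (a :+ c)) refl a (b ∸ a))
        (cong (λ v → a * a + v * v) (m+[n∸m]≡n a≤b)))
  where open +-*-Solver
... | inj₂ b≤a = trans (cong₂ (λ u v → u * u + 2 * (v * b)) (m≤n⇒∣n-m∣≡n∸m b≤a) (≡-sym (m+[n∸m]≡n b≤a)))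
      (trans (solve 2 (λ b c → c :* c :+ con 2 :* ((b :+ c) :* b) := (b :+ c) :* (b :+ c) :+ b :* b) refl b (a ∸ b))
        (cong (λ v → v * v + b * b) (m+[n∸m]≡n b≤a)))
  where open +-*-Solver

2*≤squares : ∀ a b → 2 * (a * b) ≤ a * a + b * b
2*≤squares a b = ≤-trans (m≤n+m _ (∣ a - b ∣ * ∣ a - b ∣)) (≤-reflexive (∣-∣²+2* a b))

-- The mean over the coarser classes is the orthogonal projection of the mean over the finer ones,
-- so the energy grows by exactly the squared distance of the two.
pythagoras : {_~_ _≈_ : Adj n} (E : IsEquiv _~_) (F : IsEquiv _≈_) → (∀ {x y} → x ≈ y ≡ true → x ~ y ≡ true) →
  ∀ f → (∑[ x ] ∣ avg _≈_ F f x - avg _~_ E f x ∣ * ∣ avg _≈_ F f x - avg _~_ E f x ∣)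
        + (∑[ x ] avg _~_ E f x * avg _~_ E f x)
      ≡ (∑[ x ] avg _≈_ F f x * avg _≈_ F f x)
pythagoras {n} {_~_} {_≈_} E F finer f = +-cancelʳ-≡ (∑[ x ] b x * b x) _ _ (begin
  ((∑[ x ] ∣ a x - b x ∣ * ∣ a x - b x ∣) + B) + B   ≡⟨ +-assoc _ B B ⟩
  D + (B + B)                                        ≡⟨ cong (λ e → D + (B + e)) (+-identityʳ B) ⟨
  D + 2 * B                                          ≡⟨ cong (λ e → D + 2 * e) ab ⟨
  D + 2 * (∑[ x ] a x * b x)                         ≡⟨ cong (D +_) (∑-*ˡ 2 (λ x → a x * b x)) ⟩
  D + (∑[ x ] 2 * (a x * b x))                       ≡⟨ ∑-+ (λ x → ∣ a x - b x ∣ * ∣ a x - b x ∣) _ ⟨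
  (∑[ x ] (∣ a x - b x ∣ * ∣ a x - b x ∣ + 2 * (a x * b x))) ≡⟨ ∑-cong (λ x → ∣-∣²+2* (a x) (b x)) ⟩
  (∑[ x ] (a x * a x + b x * b x))                   ≡⟨ ∑-+ (λ x → a x * a x) _ ⟩
  (∑[ x ] a x * a x) + B                             ∎)
  where
  open ≡-Reasoning
  a b : Fin n → ℕ
  a = avg _≈_ F f
  b = avg _~_ E f
  B D : ℕ
  B = ∑[ x ] b x * b x
  D = ∑[ x ] ∣ a x - b x ∣ * ∣ a x - b x ∣
  -- Orthogonality: b is constant on the classes of both relations, so both inner products equal n !
  -- times the inner product of b with f.
  ab : (∑[ x ] a x * b x) ≡ B
  ab = trans (∑-cong λ x → *-comm (a x) (b x)) (trans (∑-avg _≈_ F f b (avg-cong _~_ E f ∘ finer))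
         (≡-sym (∑-avg _~_ E f b (avg-cong _~_ E f))))

-- Pigeonhole: if J times every one of the first J increments exceeded B, then `e J` would exceed B.
-- No monotonicity of e is assumed, because a non-increasing step has truncated difference 0 and is
-- accepted at once.
small-increment : ∀ (e : ℕ → ℕ) J B → 1 ≤ J → e J ≤ B → ∃[ i ] i < J × J * (e (suc i) ∸ e i) ≤ B
small-increment e J B 1≤J eJ≤B with search J
  where
  search : ∀ j → (∃[ i ] i < j × J * (e (suc i) ∸ e i) ≤ B) ⊎ j * suc B ≤ J * e j
  search zero    = inj₂ z≤n
  search (suc j) with search j
  ... | inj₁ (i , i<j , h) = inj₁ (i , m<n⇒m<1+n i<j , h)
  ... | inj₂ h with J * (e (suc j) ∸ e j) ℕ.≤? B
  ...   | yes p = inj₁ (j , n<1+n j , p)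
  ...   | no ¬p = inj₂ (begin
          suc j * suc B                       ≤⟨ +-mono-≤ (≰⇒> ¬p) h ⟩
          J * (e (suc j) ∸ e j) + J * e j     ≡⟨ *-distribˡ-+ J (e (suc j) ∸ e j) (e j) ⟨
          J * (e (suc j) ∸ e j + e j)         ≡⟨ cong (J *_) (m∸n+n≡m increasing) ⟩
          J * e (suc j)                       ∎)
    where
    open ≤-Reasoning
    increasing : e j ≤ e (suc j)
    increasing with ≤-total (e j) (e (suc j))
    ... | inj₁ le = le
    ... | inj₂ ge = contradiction (≤-trans (≤-reflexive (trans (cong (J *_) (m≤n⇒m∸n≡0 ge)) (*-zeroʳ J))) z≤n) ¬p
... | inj₁ r = r
... | inj₂ h = contradiction (≤-trans h (*-monoʳ-≤ J eJ≤B)) (<⇒≱ (*-monoʳ-< J {{ℕ.>-nonZero 1≤J}} (n<1+n B)))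

-- A chain of ever finer equivalences has a step at which no mean changes much on average, because
-- the energies (sums of squared means) increase along the chain and are bounded.
module _ {n k : ℕ} (_~⟨_⟩_ : Fin n → ℕ → Fin n → Bool) where
  private
    rel : ℕ → Adj n
    rel i x y = x ~⟨ i ⟩ y

  regular-step : (E : ∀ i → IsEquiv (rel i)) → (∀ i {x y} → rel (suc i) x y ≡ true → rel i x y ≡ true) →
    (f : Fin k → Fin n → ℕ) → (∀ c x → f c x ≤ 1) → ∀ l → 1 ≤ l →
    ∃[ i ] i < l * l ×
      l * (∑[ c ] ∑[ x ] ∣ avg (rel (suc i)) (E (suc i)) (f c) x - avg (rel i) (E i) (f c) x ∣) ≤ 2 * (k * n) * n !
  regular-step E finer f f≤1 l 1≤l = i , i<J , *-cancelʳ-≤ _ _ L {{ℕ.>-nonZero (1≤n! n)}} (begin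
    l * (∑[ c ] ∑[ x ] g c x) * L                       ≡⟨ solve 3 (λ l s L → l :* s :* L := L :* l :* s) refl l (∑[ c ] ∑[ x ] g c x) L ⟩
    L * l * (∑[ c ] ∑[ x ] g c x)                       ≡⟨ trans (∑-*ˡ (L * l) (λ c → ∑[ x ] g c x)) (∑-cong (λ c → ∑-*ˡ (L * l) (g c))) ⟩
    (∑[ c ] ∑[ x ] L * l * g c x)                       ≤⟨ ∑-mono (λ c → ∑-mono (λ x → pt (g c x))) ⟩
    (∑[ c ] ∑[ x ] (L * L + l * l * (g c x * g c x)))   ≡⟨ trans (∑-cong λ c → ∑-+ {n} (λ _ → L * L) (λ x → l * l * (g c x * g c x))) (∑-+ {k} (λ _ → ∑ {n} (λ _ → L * L)) _) ⟩
    (∑ {k} λ _ → ∑ {n} (λ _ → L * L)) + (∑[ c ] ∑[ x ] l * l * (g c x * g c x))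
                                                        ≡⟨ cong₂ _+_ (trans (∑-const k _) (cong (k *_) (∑-const n (L * L))))
                                                             (trans (∑-cong λ c → ≡-sym (∑-*ˡ (l * l) (λ x → g c x * g c x))) (≡-sym (∑-*ˡ (l * l) (λ c → ∑[ x ] g c x * g c x)))) ⟩
    B + l * l * (∑[ c ] ∑[ x ] g c x * g c x)           ≡⟨ cong (λ s → B + l * l * s) increment ⟩
    B + l * l * (e (suc i) ∸ e i)                       ≤⟨ +-monoʳ-≤ B small ⟩
    B + B                                               ≡⟨ solve 3 (λ k n L → k :* (n :* (L :* L)) :+ k :* (n :* (L :* L)) := con 2 :* (k :* n) :* L :* L) refl k n L ⟩
    2 * (k * n) * L * L                                 ∎)
    where
    open ≤-Reasoning
    open +-*-Solver
    L B : ℕ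
    L = n !
    B = k * (n * (L * L))
    F : ℕ → Fin k → Fin n → ℕ
    F i c = avg (rel i) (E i) (f c)
    e : ℕ → ℕ
    e i = ∑[ c ] ∑[ x ] F i c x * F i c x
    e≤B : ∀ i → e i ≤ B
    e≤B i = ≤-trans (∑-mono λ c → ∑-mono λ x → *-mono-≤ (avg-≤ (rel i) (E i) (f c) (f≤1 c) x) (avg-≤ (rel i) (E i) (f c) (f≤1 c) x))
      (≤-reflexive (trans (∑-const k _) (cong (k *_) (∑-const n (L * L)))))
    found = small-increment e (l * l) B (*-mono-≤ 1≤l 1≤l) (e≤B (l * l))
    i = proj₁ found
    i<J = proj₁ (proj₂ found)
    small = proj₂ (proj₂ found)
    g : Fin k → Fin n → ℕ
    g c x = ∣ F (suc i) c x - F i c x ∣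
    increment : (∑[ c ] ∑[ x ] g c x * g c x) ≡ e (suc i) ∸ e i
    increment = trans (≡-sym (m+n∸n≡m _ (e i))) (cong (_∸ e i)
      (trans (≡-sym (∑-+ (λ c → ∑[ x ] g c x * g c x) _)) (∑-cong λ c → pythagoras (E i) (E (suc i)) (finer i) (f c))))
    -- An inequality between arithmetic and geometric means takes the place of Cauchy-Schwarz in
    -- passing from squared to absolute changes. With l * l candidate steps the square term also
    -- sums to at most B, which balances the two terms.
    pt : ∀ y → L * l * y ≤ L * L + l * l * (y * y)
    pt y = ≤-trans (m≤m+n _ _) (≤-trans (≤-reflexive (solve 3 (λ L l y → L :* l :* y :+ L :* l :* y := con 2 :* (L :* (l :* y))) refl L l y))
      (≤-trans (2*≤squares L (l * y)) (≤-reflexive (cong (L * L +_) (solve 2 (λ l y → (l :* y) :* (l :* y) := l :* l :* (y :* y)) refl l y)))))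

-- Equidistribution of local isomorphisms

similarᵇ : Adj n → ℕ → Adj n
similarᵇ B R x y = ⌊ similar? B B R x y ⌋

similarᵇ-isEquiv : (B : Adj n) (R : ℕ) → IsEquiv (similarᵇ B R)
similarᵇ-isEquiv B R = record
  { ~-refl  = λ x → ⌊⌋-intro (similar? B B R x x) (similar-refl x)
  ; ~-sym   = λ {x} {y} h → ⌊⌋-intro (similar? B B R y x) (similar-sym (⌊⌋-elim (similar? B B R x y) h))
  ; ~-trans = λ {x} {y} {z} h h′ → ⌊⌋-intro (similar? B B R x z)
      (similar-trans (⌊⌋-elim (similar? B B R x y) h) (⌊⌋-elim (similar? B B R y z) h′)) }

opaque
  mean : Adj n → ℕ → (Fin n → ℕ) → Fin n → ℕ
  mean B R = avg (similarᵇ B R) (similarᵇ-isEquiv B R)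

  mean-cong : (B : Adj n) (R : ℕ) (f : Fin n → ℕ) → ∀ {x y} → Similar B B R x y → mean B R f x ≡ mean B R f y
  mean-cong B R f {x} {y} s = avg-cong (similarᵇ B R) (similarᵇ-isEquiv B R) f (⌊⌋-intro (similar? B B R x y) s)

  mean-≤ : (B : Adj n) (R : ℕ) (f : Fin n → ℕ) → (∀ x → f x ≤ 1) → ∀ x → mean B R f x ≤ n !
  mean-≤ B R f h = avg-≤ (similarᵇ B R) (similarᵇ-isEquiv B R) f h

  ∑-*-mean : (B : Adj n) (R : ℕ) (f p : Fin n → ℕ) → (∀ {x y} → Similar B B R x y → p x ≡ p y) →
    (∑[ x ] p x * mean B R f x) ≡ n ! * (∑[ x ] p x * f x)
  ∑-*-mean B R f p p-cong = ∑-avg (similarᵇ B R) (similarᵇ-isEquiv B R) f p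
    λ {x} {y} h → p-cong (⌊⌋-elim (similar? B B R x y) h)

  ∑-mean : (B : Adj n) (R : ℕ) (f : Fin n → ℕ) → ∑ (mean B R f) ≡ n ! * ∑ f
  ∑-mean {n} B R f = trans (∑-cong λ x → ≡-sym (*-identityˡ _))
    (trans (∑-avg (similarᵇ B R) (similarᵇ-isEquiv B R) f (λ _ → 1) (λ _ → refl)) (cong (n ! *_) (∑-cong λ x → *-identityˡ _)))

record UniformSample {m : ℕ} (P : Fin m → Bool) (t : ℕ) : Set where
  field
    sample       : Fin t → Fin m
    sample-sound : ∀ c → P (sample c) ≡ true
    multiplicity : ℕ
    sample-sum   : ∀ f → ∑ (f ∘ sample) ≡ multiplicity * (∑[ x ] 𝟙 (P x) * f x)

-- Since m ! is divisible by the size of every nonempty subset, one number of samples serves all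
-- roots at once; the enumeration of `P` is repeated until that number is reached.
uniformSample : (P : Fin m → Bool) → ∃[ x ] P x ≡ true → UniformSample P (m !)
uniformSample {m} P (x , Px) = from (m∣n! 1≤count count≤m) (enumerate P)
  where
  1≤count : 1 ≤ ∑ (𝟙 ∘ P)
  1≤count = ≤-trans (≤-reflexive (≡-sym (cong 𝟙 Px))) (≤-∑ (𝟙 ∘ P) x)
  count≤m : ∑ (𝟙 ∘ P) ≤ m
  count≤m = ≤-trans (∑-mono (𝟙≤1 ∘ P)) (≤-reflexive (trans (∑-const m 1) (*-identityʳ m)))
  from : ∀ {t k} → k ∣ t → Enumeration P k → UniformSample P t
  from {k = k} (divides u refl) E = record
    { sample       = λ c → elem (Fin.remainder {u} k c)
    ; sample-sound = λ c → sound (Fin.remainder {u} k c)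
    ; multiplicity = u
    ; sample-sum   = λ f → trans (∑-combine u (λ c → f (elem (Fin.remainder {u} k c))))
        (trans (∑-cong λ c → trans (∑-cong λ i → cong (λ p → f (elem (proj₂ p))) (Finₚ.remQuot-combine {u} c i)) (∑-enum E f))
          (∑-const u _)) }
    where open Enumeration E

options : (A B : Adj n) → ℕ → Fin n → Fin (n !) → Bool
options {n} A B R r c = ⌊ good? A B (decodePerm n c) R r ⌋

module _ {n : ℕ} {A B : Adj n} (SB : Symmetric B) {R K : ℕ} (K≤1+R : K ≤ suc R) {r b : Fin n} (rb : Walk A K r b) where

  private
    hits : Fin n → ℕ
    hits z = ∑[ c ] 𝟙 (options A B R r c ∧ ⌊ decodePerm n c ⟨$⟩ʳ b ≟ z ⌋)

    -- Postcomposition with a similarity taking z to z′ sends options hitting z to options hitting z′.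
    hits-≤ : ∀ {z z′} → Similar B B (K + R) z z′ → hits z ≤ hits z′
    hits-≤ {z} {z′} (ψ , g , refl) = count-inj _ _ (λ c → encodePerm n (decodePerm n c ∘ₚ ψ)) sends inj
      where
      de : ∀ c x → decodePerm n (encodePerm n (decodePerm n c ∘ₚ ψ)) ⟨$⟩ʳ x ≡ ψ ⟨$⟩ʳ (decodePerm n c ⟨$⟩ʳ x)
      de c = decode-encode n (decodePerm n c ∘ₚ ψ)
      sends : ∀ c → options A B R r c ∧ ⌊ decodePerm n c ⟨$⟩ʳ b ≟ z ⌋ ≡ true →
        options A B R r (encodePerm n (decodePerm n c ∘ₚ ψ)) ∧ ⌊ decodePerm n (encodePerm n (decodePerm n c ∘ₚ ψ)) ⟨$⟩ʳ b ≟ z′ ⌋ ≡ true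
      sends c h = ∧-intro
          (⌊⌋-intro (good? A B _ R r) (good-cong (θ ∘ₚ ψ) (λ x → ≡-sym (de c x))
            (good-∘ θ ψ gθ (good-recentre ψ g (walk-sym SB (subst (Walk B K (θ ⟨$⟩ʳ r)) θb≡z (good-walk θ gθ K≤1+R rb)))))))
          (⌊⌋-intro (_ ≟ _) (trans (de c b) (cong (ψ ⟨$⟩ʳ_) θb≡z)))
        where
        θ = decodePerm n c
        gθ : Good A B θ R r
        gθ = ⌊⌋-elim (good? A B θ R r) (∧-elimˡ h)
        θb≡z : θ ⟨$⟩ʳ b ≡ z
        θb≡z = ⌊⌋-elim (_ ≟ _) (∧-elimʳ {options A B R r c} h)
      inj : ∀ c c′ → _ → _ → encodePerm n (decodePerm n c ∘ₚ ψ) ≡ encodePerm n (decodePerm n c′ ∘ₚ ψ) → c ≡ c′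
      inj c c′ _ _ e = decode-injective n c c′ λ x → perm-injective ψ
        (trans (≡-sym (de c x)) (trans (cong (λ d → decodePerm n d ⟨$⟩ʳ x) e) (de c′ x)))

  -- The number of options taking b to z depends only on the (K + R)-ball type of z, so f may be
  -- replaced by its mean over that type. The extra K is needed because the similarity is centred at
  -- z, while the composite has to be good at radius R around the image of r, up to K away.
  options-mean : (f : Fin n → ℕ) →
    (∑[ c ] 𝟙 (options A B R r c) * mean B (K + R) f (decodePerm n c ⟨$⟩ʳ b))
    ≡ n ! * (∑[ c ] 𝟙 (options A B R r c) * f (decodePerm n c ⟨$⟩ʳ b))
  options-mean f = trans (by-image (mean B (K + R) f))
    (trans (∑-*-mean B (K + R) f hits hits-cong)
      (cong (n ! *_) (≡-sym (by-image f))))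
    where
    hits-cong : ∀ {x y} → Similar B B (K + R) x y → hits x ≡ hits y
    hits-cong s = ≤-antisym (hits-≤ s) (hits-≤ (similar-sym s))
    by-image : (f : Fin n → ℕ) → (∑[ c ] 𝟙 (options A B R r c) * f (decodePerm n c ⟨$⟩ʳ b)) ≡ (∑[ z ] hits z * f z)
    by-image f = trans (∑-fibre (λ c → decodePerm n c ⟨$⟩ʳ b) _)
      (∑-cong λ z → trans (∑-cong λ c → pt c z) (≡-sym (∑-*ʳ (f z) (λ c → 𝟙 (options A B R r c ∧ ⌊ decodePerm n c ⟨$⟩ʳ b ≟ z ⌋)))))
      where
      pt : ∀ c z → 𝟙 ⌊ decodePerm n c ⟨$⟩ʳ b ≟ z ⌋ * (𝟙 (options A B R r c) * f (decodePerm n c ⟨$⟩ʳ b))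
                 ≡ 𝟙 (options A B R r c ∧ ⌊ decodePerm n c ⟨$⟩ʳ b ≟ z ⌋) * f z
      pt c z with decodePerm n c ⟨$⟩ʳ b ≟ z
      ... | yes refl = trans (+-identityʳ (𝟙 (options A B R r c) * f z)) (cong (_* f z) (trans (≡-sym (*-identityʳ (𝟙 (options A B R r c)))) (≡-sym (𝟙-∧ (options A B R r c) true))))
      ... | no  _    = cong (_* f z) (trans (≡-sym (*-zeroʳ (𝟙 (options A B R r c)))) (≡-sym (𝟙-∧ (options A B R r c) false)))

sampleOptions : {A B : Adj n} {R : ℕ} {r : Fin n} → ∃[ θ ] Good A B θ R r → UniformSample (options A B R r) ((n !) !)
sampleOptions {n} {A} {B} {R} {r} (θ , g) = uniformSample (options A B R r)
  (encodePerm n θ , ⌊⌋-intro (good? A B _ R r) (good-cong θ (λ x → ≡-sym (decode-encode n θ x)) g))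

opaque
  -- At an exceptional root no local isomorphism is known; the identity is a dummy there, and the
  -- whole part is charged to the error.
  chooser : (A B : Adj n) (R : ℕ) (r : Fin n) (e : Bool) → (e ≡ false → ∃[ θ ] Good A B θ R r) → Fin ((n !) !) → Permutation′ n
  chooser     A B R r true  _ _ = Perm.id
  chooser {n} A B R r false h c = decodePerm n (UniformSample.sample (sampleOptions (h refl)) c)

module _ {n : ℕ} {A B : Adj n} {R : ℕ} {r : Fin n} where

  opaque
    unfolding chooser

    chooser-good : ∀ e h c → e ≡ false → Good A B (chooser A B R r e h c) R r
    chooser-good false h c _ = ⌊⌋-elim (good? A B _ R r) (UniformSample.sample-sound (sampleOptions (h refl)) c)

    chooser-mean : Symmetric B → ∀ {K b} → K ≤ suc R → Walk A K r b → ∀ e h → e ≡ false → ∀ f →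
      (∑[ c ] mean B (K + R) f (chooser A B R r e h c ⟨$⟩ʳ b)) ≡ n ! * (∑[ c ] f (chooser A B R r e h c ⟨$⟩ʳ b))
    chooser-mean SB {K} {b} K≤1+R rb false h _ f = trans (sample-sum (λ c → mean B (K + R) f (decodePerm n c ⟨$⟩ʳ b)))
      (trans (cong (multiplicity *_) (options-mean SB K≤1+R rb f))
        (trans (x∙yz≈y∙xz multiplicity (n !) _) (cong (n ! *_) (≡-sym (sample-sum (λ c → f (decodePerm n c ⟨$⟩ʳ b)))))))
      where
      open UniformSample (sampleOptions (h refl))

-- Means are compared at level K i and level K (suc i); the transporting maps are good at the radius K + level K i
-- in between, which leaves room for moving by K from a root to a vertex of its part and back.
level : ℕ → ℕ → ℕ
level K zero    = 0
level K (suc i) = K + (K + level K i)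

level-mono : ∀ K {i j} → i ≤ j → level K i ≤ level K j
level-mono K z≤n     = z≤n
level-mono K (s≤s h) = +-monoʳ-≤ K (+-monoʳ-≤ K (level-mono K h))

module Transfer {n d : ℕ} {A B : Adj n} (SB : Symmetric B) (DB : DegreeBound d B) (K R₀ : ℕ)
  (π : Permutation′ n) (exc : Fin n → Bool) (sim : ∀ x → exc x ≡ false → Similar A B (K + R₀) x (π ⟨$⟩ʳ x))
  (root : Fin n → Fin n) (rooted : ∀ b → Walk A K (root b) b) where

  t : ℕ
  t = (n !) !

  R : ℕ
  R = K + R₀

  private
    option : ∀ r → exc r ≡ false → ∃[ θ ] Good A B θ R r
    option r e = proj₁ (sim r e) , proj₁ (proj₂ (sim r e))

  θ : Fin t → Fin n → Permutation′ n
  θ c r = chooser A B R r (exc r) (option r) c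

  θ-good : ∀ c r → exc r ≡ false → Good A B (θ c r) R r
  θ-good c r e = chooser-good (exc r) (option r) c e

  excᵣ : Fin n → Bool
  excᵣ b = exc b ∨ exc (root b)

  private
    L : ℕ
    L = n !

    X : ℕ
    X = ∑ (𝟙 ∘ excᵣ)

    before after g : (Fin n → ℕ) → Fin n → ℕ
    before f = mean B R₀ f
    after  f = mean B (K + R) f
    g f z = ∣ after f z - before f z ∣

    gBall : (Fin n → ℕ) → Fin n → ℕ
    gBall f y = ∑[ z ] 𝟙 (reach B K y z) * g f z

    K≤1+R : K ≤ suc R
    K≤1+R = m≤n⇒m≤1+n (m≤m+n K _)

    θ-similar : ∀ {j r x} → exc r ≡ false → ∀ c → Walk A j r x → j + R₀ ≤ R → Similar A B R₀ x (θ c r ⟨$⟩ʳ x)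
    θ-similar {r = r} e c w h = θ c r , good-recentre (θ c r) (good-mono (θ c r) h (θ-good c r e)) w , refl

    θ-π : ∀ {j r x} → exc r ≡ false → exc x ≡ false → ∀ c → Walk A j r x → j + R₀ ≤ R →
      Similar B B R₀ (θ c r ⟨$⟩ʳ x) (π ⟨$⟩ʳ x)
    θ-π {x = x} er ex c w h = similar-trans (similar-sym (θ-similar er c w h))
      (similar-mono (m≤n+m _ K) (sim x ex))

    ∑-before : ∀ f → (∑[ b ] t * before f (π ⟨$⟩ʳ b)) ≡ L * (t * ∑ f)
    ∑-before f = trans (≡-sym (∑-*ˡ t (λ b → before f (π ⟨$⟩ʳ b))))
      (trans (cong (t *_) (trans (∑-perm π (before f)) (∑-mean B R₀ f))) (x∙yz≈y∙xz t L _))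

    -- Off the exceptions the first term is a sum of means at radius K + R at the images of b, by
    -- uniformity. The second is the same sum with means at radius R₀, because every image of b is
    -- R₀-similar to `π` of b. At an exception both terms are at most t * n !.
    deviation : ∀ {f} → (∀ z → f z ≤ 1) → ∀ b → ∣ L * (∑[ s ] f (θ s (root b) ⟨$⟩ʳ b)) - t * before f (π ⟨$⟩ʳ b) ∣
      ≤ (∑[ s ] 𝟙 (not (exc (root b))) * g f (θ s (root b) ⟨$⟩ʳ b)) + 𝟙 (excᵣ b) * (t * L)
    deviation {f} f≤1 b = by (exc b) (exc (root b)) refl refl
      where
      open ≤-Reasoning
      exceptional : excᵣ b ≡ true → ∣ L * (∑[ s ] f (θ s (root b) ⟨$⟩ʳ b)) - t * before f (π ⟨$⟩ʳ b) ∣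
        ≤ (∑[ s ] 𝟙 (not (exc (root b))) * g f (θ s (root b) ⟨$⟩ʳ b)) + 𝟙 (excᵣ b) * (t * L)
      exceptional e = ≤-trans (∣m-n∣≤m⊔n (L * (∑[ s ] f (θ s (root b) ⟨$⟩ʳ b))) (t * before f (π ⟨$⟩ʳ b))) (≤-trans (⊔-lub
        (≤-trans (*-monoʳ-≤ L (≤-trans (∑-mono λ s → f≤1 (θ s (root b) ⟨$⟩ʳ b)) (≤-reflexive (trans (∑-const t 1) (*-identityʳ t))))) (≤-reflexive (*-comm L t)))
        (*-monoʳ-≤ t (mean-≤ B R₀ f f≤1 _)))
        (≤-trans (≤-reflexive (≡-sym (𝟙-true (t * L) e))) (m≤n+m _ _)))
      by : ∀ v w → exc b ≡ v → exc (root b) ≡ w → ∣ L * (∑[ s ] f (θ s (root b) ⟨$⟩ʳ b)) - t * before f (π ⟨$⟩ʳ b) ∣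
        ≤ (∑[ s ] 𝟙 (not (exc (root b))) * g f (θ s (root b) ⟨$⟩ʳ b)) + 𝟙 (excᵣ b) * (t * L)
      by true  _     eb _  = exceptional (∨-introˡ eb)
      by false true  _  er = exceptional (∨-introʳ {exc b} er)
      by false false eb er = begin
        ∣ L * (∑[ s ] f (θ s (root b) ⟨$⟩ʳ b)) - t * before f (π ⟨$⟩ʳ b) ∣
          ≡⟨ cong₂ ∣_-_∣ (≡-sym (chooser-mean SB K≤1+R (rooted b) (exc (root b)) (option (root b)) er f))
               (trans (≡-sym (∑-const t _)) (∑-cong λ s → ≡-sym (mean-cong B R₀ f (θ-π er eb s (rooted b) ≤-refl)))) ⟩
        ∣ (∑[ s ] after f (θ s (root b) ⟨$⟩ʳ b)) - (∑[ s ] before f (θ s (root b) ⟨$⟩ʳ b)) ∣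
          ≤⟨ ∣∑-∑∣≤ _ _ ⟩
        (∑[ s ] g f (θ s (root b) ⟨$⟩ʳ b))
          ≡⟨ ∑-cong (λ s → 𝟙-true (g f (θ s (root b) ⟨$⟩ʳ b)) (cong not er)) ⟨
        (∑[ s ] 𝟙 (not (exc (root b))) * g f (θ s (root b) ⟨$⟩ʳ b))
          ≤⟨ m≤m+n _ _ ⟩
        (∑[ s ] 𝟙 (not (exc (root b))) * g f (θ s (root b) ⟨$⟩ʳ b)) + 𝟙 (excᵣ b) * (t * L) ∎

    Δ : ℕ
    Δ = suc d ^ K

    ∑-gBall : ∀ f → ∑ (gBall f) ≤ Δ * ∑ (g f)
    ∑-gBall f = begin
      (∑[ y ] ∑[ z ] 𝟙 (reach B K y z) * g f z) ≡⟨ ∑-swap (λ y z → 𝟙 (reach B K y z) * g f z) ⟩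
      (∑[ z ] ∑[ y ] 𝟙 (reach B K y z) * g f z) ≡⟨ ∑-cong (λ z → trans (≡-sym (∑-*ʳ (g f z) (λ y → 𝟙 (reach B K y z)))) (cong (_* g f z) (∑-cong λ y → cong 𝟙 (reach-sym SB K y z)))) ⟩
      (∑[ z ] (∑[ y ] 𝟙 (reach B K z y)) * g f z) ≤⟨ ∑-mono (λ z → *-monoˡ-≤ (g f z) (ball-size DB K z)) ⟩
      (∑[ z ] Δ * g f z)                        ≡⟨ ∑-*ˡ Δ (g f) ⟨
      Δ * ∑ (g f)                               ∎
      where open ≤-Reasoning

    -- The images of a part lie in the K-ball around the image of its root, and the images of a root
    -- are uniformly distributed over a similarity class; so errors are transported without blow-up.
    transport : ∀ f → (∑[ b ] ∑[ s ] 𝟙 (not (exc (root b))) * g f (θ s (root b) ⟨$⟩ʳ b)) ≤ t * (Δ * ∑ (g f))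
    transport f = *-cancelˡ-≤ L {{ℕ.>-nonZero (1≤n! n)}} (begin
      L * (∑[ b ] ∑[ s ] 𝟙 (not (exc (root b))) * g f (θ s (root b) ⟨$⟩ʳ b))
        ≡⟨ cong (L *_) (∑-fibre root _) ⟩
      L * (∑[ r ] ∑[ b ] 𝟙 ⌊ root b ≟ r ⌋ * (∑[ s ] 𝟙 (not (exc (root b))) * g f (θ s (root b) ⟨$⟩ʳ b)))
        ≤⟨ *-monoʳ-≤ L (∑-mono fibre) ⟩
      L * (∑[ r ] 𝟙 (not (exc r)) * (∑[ s ] gBall f (θ s r ⟨$⟩ʳ r)))
        ≡⟨ trans (∑-*ˡ L (λ r → 𝟙 (not (exc r)) * (∑[ s ] gBall f (θ s r ⟨$⟩ʳ r)))) (∑-cong λ r → x∙yz≈y∙xz L (𝟙 (not (exc r))) _) ⟩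
      (∑[ r ] 𝟙 (not (exc r)) * (L * (∑[ s ] gBall f (θ s r ⟨$⟩ʳ r))))
        ≤⟨ ∑-mono (λ r → 𝟙*-≤′ (not (exc r)) (λ e → ≤-reflexive (uniform r (not-true e)))) ⟩
      (∑[ r ] t * mean B R (gBall f) (π ⟨$⟩ʳ r))
        ≡⟨ trans (≡-sym (∑-*ˡ t (λ r → mean B R (gBall f) (π ⟨$⟩ʳ r)))) (cong (t *_) (trans (∑-perm π (mean B R (gBall f))) (∑-mean B R (gBall f)))) ⟩
      t * (L * ∑ (gBall f))   ≡⟨ x∙yz≈y∙xz t L _ ⟩
      L * (t * ∑ (gBall f))   ≤⟨ *-monoʳ-≤ L (*-monoʳ-≤ t (∑-gBall f)) ⟩
      L * (t * (Δ * ∑ (g f))) ∎)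
      where
      open ≤-Reasoning
      uniform : ∀ r → exc r ≡ false → L * (∑[ s ] gBall f (θ s r ⟨$⟩ʳ r)) ≡ t * mean B R (gBall f) (π ⟨$⟩ʳ r)
      -- Here the root itself is tracked, so K is 0 and no radius is lost: its images are spread
      -- uniformly over the R-similarity class of `π` of r.
      uniform r e = trans (≡-sym (chooser-mean SB {0} z≤n here (exc r) (option r) e (gBall f)))
        (trans (∑-cong λ s → mean-cong B R (gBall f) (similar-trans (similar-sym (θ s r , θ-good s r e , refl)) (sim r e)))
          (∑-const t _))
      fibre : ∀ r → (∑[ b ] 𝟙 ⌊ root b ≟ r ⌋ * (∑[ s ] 𝟙 (not (exc (root b))) * g f (θ s (root b) ⟨$⟩ʳ b)))
        ≤ 𝟙 (not (exc r)) * (∑[ s ] gBall f (θ s r ⟨$⟩ʳ r))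
      fibre r = begin
        (∑[ b ] 𝟙 ⌊ root b ≟ r ⌋ * (∑[ s ] 𝟙 (not (exc (root b))) * g f (θ s (root b) ⟨$⟩ʳ b)))
          ≡⟨ ∑-cong (λ b → trans (𝟙*-cong ⌊ root b ≟ r ⌋ (λ e → cong (λ ρ → ∑[ s ] 𝟙 (not (exc ρ)) * g f (θ s ρ ⟨$⟩ʳ b)) (⌊⌋-elim (root b ≟ r) e)))
                (trans (cong (𝟙 ⌊ root b ≟ r ⌋ *_) (≡-sym (∑-*ˡ (𝟙 (not (exc r))) (λ s → g f (θ s r ⟨$⟩ʳ b))))) (x∙yz≈y∙xz (𝟙 ⌊ root b ≟ r ⌋) (𝟙 (not (exc r))) _))) ⟩
        (∑[ b ] 𝟙 (not (exc r)) * (𝟙 ⌊ root b ≟ r ⌋ * (∑[ s ] g f (θ s r ⟨$⟩ʳ b))))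
          ≡⟨ ∑-*ˡ (𝟙 (not (exc r))) (λ b → 𝟙 ⌊ root b ≟ r ⌋ * (∑[ s ] g f (θ s r ⟨$⟩ʳ b))) ⟨
        𝟙 (not (exc r)) * (∑[ b ] 𝟙 ⌊ root b ≟ r ⌋ * (∑[ s ] g f (θ s r ⟨$⟩ʳ b)))
          ≤⟨ 𝟙*-≤ (not (exc r)) (λ e → inner (not-true e)) ⟩
        𝟙 (not (exc r)) * (∑[ s ] gBall f (θ s r ⟨$⟩ʳ r)) ∎
        where
        inner : exc r ≡ false → (∑[ b ] 𝟙 ⌊ root b ≟ r ⌋ * (∑[ s ] g f (θ s r ⟨$⟩ʳ b))) ≤ (∑[ s ] gBall f (θ s r ⟨$⟩ʳ r))
        inner e = begin
          (∑[ b ] 𝟙 ⌊ root b ≟ r ⌋ * (∑[ s ] g f (θ s r ⟨$⟩ʳ b)))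
            ≡⟨ trans (∑-cong λ b → ∑-*ˡ (𝟙 ⌊ root b ≟ r ⌋) (λ s → g f (θ s r ⟨$⟩ʳ b))) (∑-swap (λ b s → 𝟙 ⌊ root b ≟ r ⌋ * g f (θ s r ⟨$⟩ʳ b))) ⟩
          (∑[ s ] ∑[ b ] 𝟙 ⌊ root b ≟ r ⌋ * g f (θ s r ⟨$⟩ʳ b))
            ≤⟨ ∑-mono (λ s → ∑-mono λ b → *-monoˡ-≤ (g f (θ s r ⟨$⟩ʳ b)) (𝟙-mono λ h → walk⇒reach B
                 (good-walk (θ s r) (θ-good s r e) K≤1+R (subst (λ ρ → Walk A K ρ b) (⌊⌋-elim (root b ≟ r) h) (rooted b))))) ⟩
          (∑[ s ] ∑[ b ] 𝟙 (reach B K (θ s r ⟨$⟩ʳ r) (θ s r ⟨$⟩ʳ b)) * g f (θ s r ⟨$⟩ʳ b))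
            ≡⟨ ∑-cong (λ s → ∑-perm (θ s r) (λ z → 𝟙 (reach B K (θ s r ⟨$⟩ʳ r) z) * g f z)) ⟩
          (∑[ s ] gBall f (θ s r ⟨$⟩ʳ r)) ∎

    count : (Fin n → ℕ) → ℕ
    count f = ∑[ b ] ∑[ s ] f (θ s (root b) ⟨$⟩ʳ b)

  -- The reference value is exact: averaging preserves sums and `π` is a permutation, so the means
  -- at radius R₀ along `π` add up to n ! * ∑ f. Only the pointwise deviations contribute.
  transfer : ∀ {f} → (∀ z → f z ≤ 1) →
    n ! * ∣ (∑[ b ] ∑[ s ] f (θ s (root b) ⟨$⟩ʳ b)) - t * ∑ f ∣
    ≤ t * (suc d ^ K * (∑[ z ] ∣ mean B (K + R) f z - mean B R₀ f z ∣)) + ∑ (𝟙 ∘ excᵣ) * (t * n !)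
  transfer {f} f≤1 = begin
    L * ∣ count f - t * ∑ f ∣           ≡⟨ *-distribˡ-∣-∣ L (count f) (t * ∑ f) ⟩
    ∣ L * count f - L * (t * ∑ f) ∣     ≡⟨ cong₂ ∣_-_∣ (∑-*ˡ L (λ b → ∑[ s ] f (θ s (root b) ⟨$⟩ʳ b))) (≡-sym (∑-before f)) ⟩
    ∣ (∑[ b ] L * (∑[ s ] f (θ s (root b) ⟨$⟩ʳ b))) - (∑[ b ] t * before f (π ⟨$⟩ʳ b)) ∣
                                            ≤⟨ ∣∑-∑∣≤ _ _ ⟩
    _                                       ≤⟨ ∑-mono (deviation f≤1) ⟩
    (∑[ b ] ((∑[ s ] 𝟙 (not (exc (root b))) * g f (θ s (root b) ⟨$⟩ʳ b)) + 𝟙 (excᵣ b) * (t * L)))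
                                            ≡⟨ ∑-+ (λ b → ∑[ s ] 𝟙 (not (exc (root b))) * g f (θ s (root b) ⟨$⟩ʳ b)) _ ⟩
    (∑[ b ] ∑[ s ] 𝟙 (not (exc (root b))) * g f (θ s (root b) ⟨$⟩ʳ b)) + (∑[ b ] 𝟙 (excᵣ b) * (t * L))
                                            ≤⟨ +-mono-≤ (transport f) (≤-reflexive (≡-sym (∑-*ʳ (t * L) (𝟙 ∘ excᵣ)))) ⟩
    t * (Δ * ∑ (g f)) + X * (t * L)         ∎
    where open ≤-Reasoning

-- The radius at which the means settle depends on B and γ and is found only here. Similarity is
-- therefore assumed at the last level, which covers every candidate, and only goodness at radius K
-- is returned. The first error term is the energy bound, the second counts exceptions once per
-- colour.
equidistribution : ∀ {d} {A B : Adj n} → Symmetric B → DegreeBound d B →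
  (γ : Fin n → Fin k) (K l : ℕ) → 1 ≤ l →
  (π : Permutation′ n) (exc : Fin n → Bool) → (∀ x → exc x ≡ false → Similar A B (level K (l * l)) x (π ⟨$⟩ʳ x)) →
  (root : Fin n → Fin n) → (∀ b → Walk A K (root b) b) →
  Σ (Fin ((n !) !) → Fin n → Permutation′ n) λ θ →
    (∀ s r → exc r ≡ false → Good A B (θ s r) K r) ×
    l * (∑[ c ] ∣ (∑[ b ] ∑[ s ] 𝟙 ⌊ γ (θ s (root b) ⟨$⟩ʳ b) ≟ c ⌋) - (n !) ! * (∑[ z ] 𝟙 ⌊ γ z ≟ c ⌋) ∣)
    ≤ (n !) ! * (2 * (suc d ^ K * (k * n)) + l * (k * (∑[ b ] 𝟙 (exc b ∨ exc (root b)))))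
equidistribution {n} {k} {d} {A} {B} SB DB γ K l 1≤l π exc sim root rooted = from regular
  where
  f : Fin k → Fin n → ℕ
  f c z = 𝟙 ⌊ γ z ≟ c ⌋

  change : ℕ → ℕ
  change i = ∑[ c ] ∑[ z ] ∣ mean B (level K (suc i)) (f c) z - mean B (level K i) (f c) z ∣

  opaque
    unfolding mean

    regular : ∃[ i ] i < l * l × l * change i ≤ 2 * (k * n) * n !
    regular = regular-step (λ x i y → similarᵇ B (level K i) x y) (λ i → similarᵇ-isEquiv B (level K i))
      (λ i {x} {y} h → ⌊⌋-intro (similar? B B (level K i) x y)
        (similar-mono (≤-trans (m≤n+m _ K) (m≤n+m _ K)) (⌊⌋-elim (similar? B B (level K (suc i)) x y) h)))
      f (λ c z → 𝟙≤1 ⌊ γ z ≟ c ⌋) l 1≤l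

  from : ∃[ i ] i < l * l × l * change i ≤ 2 * (k * n) * n ! → _
  from (i , i<l² , small) = θ , (λ s r e → good-mono (θ s r) (m≤m+n K _) (θ-good s r e)) ,
    *-cancelˡ-≤ L {{ℕ.>-nonZero (1≤n! n)}} (begin
      L * (l * (∑[ c ] ∣ count c - t * ∑ (f c) ∣))
        ≡⟨ trans (x∙yz≈y∙xz L l _) (cong (l *_) (∑-*ˡ L (λ c → ∣ count c - t * ∑ (f c) ∣))) ⟩
      l * (∑[ c ] L * ∣ count c - t * ∑ (f c) ∣)
        ≤⟨ *-monoʳ-≤ l (∑-mono (λ c → transfer (λ z → 𝟙≤1 ⌊ γ z ≟ c ⌋))) ⟩
      l * (∑[ c ] (t * (Δ * g c) + X * (t * L)))
        ≡⟨ cong (l *_) (trans (∑-+ (λ c → t * (Δ * g c)) _) (cong₂ _+_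
             (≡-sym (trans (cong (t *_) (∑-*ˡ Δ g)) (∑-*ˡ t (λ c → Δ * g c)))) (∑-const k _))) ⟩
      l * (t * (Δ * change i) + k * (X * (t * L)))
        ≡⟨ solve 7 (λ l t Δ S k X L → l :* (t :* (Δ :* S) :+ k :* (X :* (t :* L))) := t :* (Δ :* (l :* S)) :+ L :* (t :* (l :* (k :* X))))
             refl l t Δ (change i) k X L ⟩
      t * (Δ * (l * change i)) + L * (t * (l * (k * X)))
        ≤⟨ +-monoˡ-≤ _ (*-monoʳ-≤ t (*-monoʳ-≤ Δ small)) ⟩
      t * (Δ * (2 * (k * n) * L)) + L * (t * (l * (k * X)))
        ≡⟨ solve 7 (λ l t Δ n k X L → t :* (Δ :* (con 2 :* (k :* n) :* L)) :+ L :* (t :* (l :* (k :* X))) := L :* (t :* (con 2 :* (Δ :* (k :* n)) :+ l :* (k :* X))))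
             refl l t Δ n k X L ⟩
      L * (t * (2 * (Δ * (k * n)) + l * (k * X))) ∎)
    where
    open ≤-Reasoning
    open +-*-Solver
    open Transfer SB DB K (level K i) π exc
      (λ x e → similar-mono (≤-trans (m≤n+m (K + level K i) K) (level-mono K i<l²)) (sim x e)) root rooted
    L Δ X : ℕ
    L = n !
    Δ = suc d ^ K
    X = ∑[ b ] 𝟙 (exc b ∨ exc (root b))
    g : Fin k → ℕ
    g c = ∑[ z ] ∣ mean B (level K (suc i)) (f c) z - mean B (level K i) (f c) z ∣
    count : Fin k → ℕ
    count c = ∑[ b ] ∑[ s ] f c (θ s (root b) ⟨$⟩ʳ b)

-- Pulling back a partition

module Product (t n : ℕ) where

  opaque
    copy : Fin (t * n) → Fin t
    copy = Fin.quotient {t} n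

    base : Fin (t * n) → Fin n
    base = Fin.remainder {t} n

    pair : Fin t → Fin n → Fin (t * n)
    pair = combine

    copy-pair : ∀ s x → copy (pair s x) ≡ s
    copy-pair s x = cong proj₁ (Finₚ.remQuot-combine s x)

    base-pair : ∀ s x → base (pair s x) ≡ x
    base-pair s x = cong proj₂ (Finₚ.remQuot-combine s x)

    pair-eta : ∀ v → pair (copy v) (base v) ≡ v
    pair-eta v = Finₚ.combine-remQuot {t} n v

    ∑-pair : (f : Fin (t * n) → ℕ) → ∑ f ≡ (∑[ s ] ∑[ x ] f (pair s x))
    ∑-pair = ∑-combine t

  pair-ext : ∀ {v w} → copy v ≡ copy w → base v ≡ base w → v ≡ w
  pair-ext {v} {w} c b = trans (≡-sym (pair-eta v)) (trans (cong₂ pair c b) (pair-eta w))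

  ∑-copy-base : (f : Fin t → Fin n → ℕ) → (∑[ v ] f (copy v) (base v)) ≡ (∑[ s ] ∑[ x ] f s x)
  ∑-copy-base f = trans (∑-pair _) (∑-cong λ s → ∑-cong λ x → cong₂ f (copy-pair s x) (base-pair s x))

  ∑-base : (f : Fin n → ℕ) → (∑[ v ] f (base v)) ≡ t * ∑ f
  ∑-base f = trans (∑-copy-base (λ _ → f)) (∑-const t _)

blowup : ∀ t → Adj n → Adj (t * n)
blowup {n} t A v w = ⌊ copy v ≟ copy w ⌋ ∧ A (base v) (base w)
  where open Product t n

-- The one number k bounds the size of a part, through the enumeration by `elem` (repetitions
-- allowed), and the distance of its members from the representative. The enumeration from the
-- representative is the canonical one. A vertex is cut if some edge at it leaves its part.
record Partition {n : ℕ} (A : Adj n) (k : ℕ) : Set where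
  field
    rep      : Fin n → Fin n
    rep-rep  : ∀ x → rep (rep x) ≡ rep x
    elem     : Fin n → Fin k → Fin n
    idx      : Fin n → Fin k
    elem-idx : ∀ x → elem (rep x) (idx x) ≡ x
    rep-elem : ∀ x i → rep (elem x i) ≡ rep x
    rep-walk : ∀ x → Walk A k (rep x) x

  cut : Fin n → Bool
  cut x = anyF n (λ y → A x y ∧ not ⌊ rep y ≟ rep x ⌋)

  uncut : ∀ {x} → cut x ≡ false → ∀ {y} → A x y ≡ true → rep y ≡ rep x
  uncut {x} h {y} a with rep y ≟ rep x in eq
  ... | yes e = e
  ... | no  _ = contradiction h (true≢false (anyF-intro _ y (∧-intro a (cong (not ∘ ⌊_⌋) eq))))

bit : Bool → Fin 2
bit false = Fin.zero
bit true  = Fin.suc Fin.zero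

bit-injective : ∀ {a b} → bit a ≡ bit b → a ≡ b
bit-injective {false} {false} _ = refl
bit-injective {true}  {true}  _ = refl

funToFin-injective : {f g : Fin m → Fin n} → Fin.funToFin f ≡ Fin.funToFin g → ∀ i → f i ≡ g i
funToFin-injective {m} {n} {f} {g} h i = trans (≡-sym (Finₚ.finToFun-funToFin f i))
  (trans (cong (λ c → Fin.finToFun {n} {m} c i) h) (Finₚ.finToFun-funToFin g i))

-- The number of p by p tables with four bits in each entry.
colours : ℕ → ℕ
colours p = ((2 * (2 * (2 * 2))) ^ p) ^ p

-- The colour of a representative records its part as an enumerated graph, together with the cut vertices.
module Colour {n p : ℕ} {B : Adj n} (P : Partition B p) where
  open Partition P

  private
    entry : Fin n → Fin p → Fin p → Fin (2 * (2 * (2 * 2)))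
    entry z i j = combine (bit ⌊ rep z ≟ z ⌋) (combine (bit ⌊ elem z i ≟ elem z j ⌋)
      (combine (bit (B (elem z i) (elem z j))) (bit (cut (elem z i)))))

  opaque
    colour : Fin n → Fin (colours p)
    colour z = Fin.funToFin λ i → Fin.funToFin λ j → entry z i j

    private
      entry-≡ : ∀ {y z} → colour y ≡ colour z → ∀ i j → entry y i j ≡ entry z i j
      entry-≡ {y} {z} h i j = funToFin-injective (funToFin-injective h i) j

    -- The bit is repeated in every entry of the table; an index is requested because for p = 0 the
    -- table is empty.
    colour-rep : ∀ {y z} → colour y ≡ colour z → Fin p → rep y ≡ y → rep z ≡ z
    colour-rep {y} {z} h i e = ⌊⌋-elim (rep z ≟ z) (trans (≡-sym (bit-injective
      (Finₚ.combine-injectiveˡ _ _ _ _ (entry-≡ h i i)))) (⌊⌋-intro (rep y ≟ y) e))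

    colour-eq : ∀ {y z} → colour y ≡ colour z → ∀ i j → elem y i ≡ elem y j → elem z i ≡ elem z j
    colour-eq {y} {z} h i j e = ⌊⌋-elim (elem z i ≟ elem z j) (trans (≡-sym (bit-injective
      (Finₚ.combine-injectiveˡ (bit ⌊ elem y i ≟ elem y j ⌋) _ (bit ⌊ elem z i ≟ elem z j ⌋) _
        (Finₚ.combine-injectiveʳ (bit ⌊ rep y ≟ y ⌋) _ (bit ⌊ rep z ≟ z ⌋) _ (entry-≡ h i j)))))
      (⌊⌋-intro (elem y i ≟ elem y j) e))

    private
      entry-tail : ∀ {y z} → colour y ≡ colour z → ∀ i j →
        combine (bit (B (elem y i) (elem y j))) (bit (cut (elem y i))) ≡ combine (bit (B (elem z i) (elem z j))) (bit (cut (elem z i)))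
      entry-tail {y} {z} h i j = Finₚ.combine-injectiveʳ (bit ⌊ elem y i ≟ elem y j ⌋) _ (bit ⌊ elem z i ≟ elem z j ⌋) _
        (Finₚ.combine-injectiveʳ (bit ⌊ rep y ≟ y ⌋) _ (bit ⌊ rep z ≟ z ⌋) _ (entry-≡ h i j))

    colour-adj : ∀ {y z} → colour y ≡ colour z → ∀ i j → B (elem y i) (elem y j) ≡ B (elem z i) (elem z j)
    colour-adj {y} {z} h i j = bit-injective (Finₚ.combine-injectiveˡ _ (bit (cut (elem y i))) _ (bit (cut (elem z i))) (entry-tail h i j))

    colour-cut : ∀ {y z} → colour y ≡ colour z → ∀ i → cut (elem y i) ≡ cut (elem z i)
    colour-cut {y} {z} h i = bit-injective (Finₚ.combine-injectiveʳ (bit (B (elem y i) (elem y i))) _ (bit (B (elem z i) (elem z i))) _ (entry-tail h i i))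

module PullBack {n p q t : ℕ} {A B : Adj n} (P : Partition B p) (Q : Partition A q)
  (exc : Fin n → Bool) (θ : Fin t → Fin n → Permutation′ n)
  (θ-good : ∀ s r → exc r ≡ false → Good A B (θ s r) (q + p) r)
  (σ : Permutation′ (t * n)) where

  private
    module P = Partition P
    module Q = Partition Q
  open Product t n
  open Colour P

  pulled : Fin t → Fin n → Fin n
  pulled s x = θ s (Q.rep x) ⟨$⟩ʳ x

  colour₁ colour₂ : Fin (t * n) → Fin (colours p)
  colour₁ v = colour (pulled (copy v) (base v))
  colour₂ v = colour (base v)

  mis : Fin (t * n) → Bool
  mis = mismatch colour₁ colour₂ σ

  -- Within p steps lies the preimage of the representative of the fine part; the additional step
  -- ensures that neighbours are covered even if p = 0.
  deep : Fin n → Bool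
  deep x = not (anyF n (λ y → reach A (suc p) x y ∧ not ⌊ Q.rep y ≟ Q.rep x ⌋))

  private
    -- A pulled-back part is handled through a single vertex, the preimage of the representative of
    -- the fine part. `σ` has to be right only at these vertices; the other members follow by their
    -- index.
    anchor anchor⁻ : Fin t → Fin n → Fin n
    anchor  s x = P.rep (pulled s x)
    anchor⁻ s x = θ s (Q.rep x) ⟨$⟩ˡ anchor s x

    origin image : Fin (t * n) → Fin (t * n)
    origin v = pair (copy v) (anchor⁻ (copy v) (base v))
    image v = σ ⟨$⟩ʳ origin v

    index : Fin (t * n) → Fin p
    index v = P.idx (pulled (copy v) (base v))

    -- `colour₁` at the origin uses the local isomorphism of the origin's own coarse part. If this
    -- is also the part of v, the result is the colour of the anchor.
    within ok : Fin (t * n) → Bool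
    within v = ⌊ Q.rep (anchor⁻ (copy v) (base v)) ≟ Q.rep (base v) ⌋
    ok v = within v ∧ not (mis (origin v))

    target : Fin (t * n) → Fin (t * n)
    target v = pair (copy (image v)) (P.elem (base (image v)) (index v))

    elem-anchor : ∀ s x → P.elem (anchor s x) (P.idx (pulled s x)) ≡ pulled s x
    elem-anchor s x = P.elem-idx (pulled s x)

    same-colour : ∀ v → ok v ≡ true → colour (anchor (copy v) (base v)) ≡ colour (base (image v))
    same-colour v h = ≡-sym (trans (matched (∧-elimʳ {within v} h)) (cong colour (trans
      (cong₂ (λ s b → θ s (Q.rep b) ⟨$⟩ʳ b) (copy-pair _ _) (base-pair _ _))
      (trans (cong (λ r → θ (copy v) r ⟨$⟩ʳ anchor⁻ (copy v) (base v)) (⌊⌋-elim (_ ≟ _) (∧-elimˡ {within v} h))) (inverseʳ (θ (copy v) (Q.rep (base v))))))))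
      where
      matched : not (mis (origin v)) ≡ true → colour₂ (image v) ≡ colour₁ (origin v)
      matched e with colour₂ (image v) ≟ colour₁ (origin v)
      ... | yes c = c

    image-rep : ∀ v → ok v ≡ true → P.rep (base (image v)) ≡ base (image v)
    image-rep v h = colour-rep (same-colour v h) (index v) (P.rep-rep (pulled (copy v) (base v)))

    rep-target : ∀ v → ok v ≡ true → P.rep (base (target v)) ≡ base (image v)
    rep-target v h = trans (cong P.rep (base-pair _ _)) (trans (P.rep-elem _ _) (image-rep v h))

    origin-determines : ∀ v w → within v ≡ true → within w ≡ true → origin v ≡ origin w →
      copy v ≡ copy w × Q.rep (base v) ≡ Q.rep (base w) × anchor (copy v) (base v) ≡ anchor (copy w) (base w)
    origin-determines v w hv hw e = s≡ , r≡ , (begin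
        anchor (copy v) (base v)                                          ≡⟨ inverseʳ (θ (copy v) (Q.rep (base v))) ⟨
        θ (copy v) (Q.rep (base v)) ⟨$⟩ʳ anchor⁻ (copy v) (base v)        ≡⟨ cong₂ (λ s r → θ s r ⟨$⟩ʳ anchor⁻ (copy v) (base v)) s≡ r≡ ⟩
        θ (copy w) (Q.rep (base w)) ⟨$⟩ʳ anchor⁻ (copy v) (base v)        ≡⟨ cong (θ (copy w) (Q.rep (base w)) ⟨$⟩ʳ_) b≡ ⟩
        θ (copy w) (Q.rep (base w)) ⟨$⟩ʳ anchor⁻ (copy w) (base w)        ≡⟨ inverseʳ (θ (copy w) (Q.rep (base w))) ⟩
        anchor (copy w) (base w)                                          ∎)
      where
      open ≡-Reasoning
      s≡ : copy v ≡ copy w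
      s≡ = trans (≡-sym (copy-pair _ _)) (trans (cong copy e) (copy-pair _ _))
      b≡ : anchor⁻ (copy v) (base v) ≡ anchor⁻ (copy w) (base w)
      b≡ = trans (≡-sym (base-pair _ _)) (trans (cong base e) (base-pair _ _))
      r≡ : Q.rep (base v) ≡ Q.rep (base w)
      r≡ = trans (≡-sym (⌊⌋-elim (_ ≟ _) hv)) (trans (cong Q.rep b≡) (⌊⌋-elim (_ ≟ _) hw))

    determines : ∀ v w → within v ≡ true → within w ≡ true → origin v ≡ origin w →
      P.elem (anchor (copy v) (base v)) (index v) ≡ P.elem (anchor (copy v) (base v)) (index w) → v ≡ w
    determines v w hv hw e ee with origin-determines v w hv hw e
    ... | s≡ , r≡ , a≡ = pair-ext s≡ (perm-injective (θ (copy w) (Q.rep (base w))) (begin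
        θ (copy w) (Q.rep (base w)) ⟨$⟩ʳ base v        ≡⟨ cong₂ (λ s r → θ s r ⟨$⟩ʳ base v) s≡ r≡ ⟨
        pulled (copy v) (base v)                       ≡⟨ elem-anchor (copy v) (base v) ⟨
        P.elem (anchor (copy v) (base v)) (index v)    ≡⟨ ee ⟩
        P.elem (anchor (copy v) (base v)) (index w)    ≡⟨ cong (λ a → P.elem a (index w)) a≡ ⟩
        P.elem (anchor (copy w) (base w)) (index w)    ≡⟨ elem-anchor (copy w) (base w) ⟩
        pulled (copy w) (base w)                       ∎))
      where open ≡-Reasoning

    -- The representative of the target's part recovers the image and hence the origin. A
    -- coincidence of members in the image part carries back to the anchor's part, because equal
    -- colours record the same coincidences.
    target-injective : ∀ v w → ok v ≡ true → ok w ≡ true → target v ≡ target w → v ≡ w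
    target-injective v w hv hw e = determines v w (∧-elimˡ hv) (∧-elimˡ hw) (perm-injective σ image≡)
      (colour-eq (≡-sym (same-colour v hv)) (index v) (index w)
        (trans (≡-sym (base-pair _ _)) (trans (cong base e) (trans (base-pair _ _) (cong (λ u → P.elem (base u) (index w)) (≡-sym image≡))))))
      where
      image≡ : image v ≡ image w
      image≡ = pair-ext (trans (≡-sym (copy-pair _ _)) (trans (cong copy e) (copy-pair _ _)))
        (trans (≡-sym (rep-target v hv)) (trans (cong (P.rep ∘ base) e) (rep-target w hw)))

    extension = extend-injection ok target target-injective

  τ : Permutation′ (t * n)
  τ = proj₁ extension

  private
    τ-ok : ∀ v → ok v ≡ true → τ ⟨$⟩ʳ v ≡ target v
    τ-ok = proj₂ extension

    deep-rep : ∀ {x} → deep x ≡ true → ∀ {y} → Walk A (suc p) x y → Q.rep y ≡ Q.rep x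
    deep-rep {x} h {y} w with Q.rep y ≟ Q.rep x in eq
    ... | yes e = e
    ... | no  _ = contradiction h (λ h′ → true≢false (anyF-intro _ y (∧-intro (walk⇒reach A w) (cong (not ∘ ⌊_⌋) eq))) (not-true h′))

    good-at : ∀ s x → exc (Q.rep x) ≡ false → Good A B (θ s (Q.rep x)) p x
    good-at s x e = good-recentre (θ s (Q.rep x)) (θ-good s (Q.rep x) e) (Q.rep-walk x)

    -- The walk of length p in B from the pulled vertex to its representative lifts along the local
    -- isomorphism, and a walk of that length from a deep vertex stays in the coarse part.
    deep-within : ∀ v → deep (base v) ≡ true → exc (Q.rep (base v)) ≡ false → Symmetric B → within v ≡ true
    deep-within v h e SB = ⌊⌋-intro (_ ≟ _) (deep-rep h (walk-mono (n≤1+n p)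
      (good-walk⁻ (θ (copy v) (Q.rep (base v))) (good-at (copy v) (base v) e) (n≤1+n p) (walk-sym SB (P.rep-walk (pulled (copy v) (base v)))))))

    module Fine (v : Fin (t * n)) (dx : deep (base v) ≡ true) (ex : exc (Q.rep (base v)) ≡ false)
      (okv : ok v ≡ true) (uncutv : P.cut (base (τ ⟨$⟩ʳ v)) ≡ false) where

      s : Fin t
      s = copy v

      x a a′ z : Fin n
      x = base v
      z = pulled s x
      a = anchor s x
      a′ = base (image v)

      ϑ : Permutation′ n
      ϑ = θ s (Q.rep x)

      col : colour a ≡ colour a′
      col = same-colour v okv

      τv : τ ⟨$⟩ʳ v ≡ target v
      τv = τ-ok v okv

      base-τv : base (τ ⟨$⟩ʳ v) ≡ P.elem a′ (index v)
      base-τv = trans (cong base τv) (base-pair _ _)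

      copy-τv : copy (τ ⟨$⟩ʳ v) ≡ copy (image v)
      copy-τv = trans (cong copy τv) (copy-pair _ _)

      -- Being uncut is assumed at the target, where a permutation lets it be counted, and is
      -- brought back to the pulled vertex by the colour.
      uncutz : P.cut z ≡ false
      uncutz = trans (cong P.cut (≡-sym (elem-anchor s x)))
        (trans (colour-cut col (index v)) (trans (cong P.cut (≡-sym base-τv)) uncutv))

      module _ (u : Fin n) (xu : A x u ≡ true) where
        rep-u : Q.rep u ≡ Q.rep x
        rep-u = deep-rep dx (step xu here)

        pulled-u : pulled s u ≡ ϑ ⟨$⟩ʳ u
        pulled-u = cong (λ r → θ s r ⟨$⟩ʳ u) rep-u

        zu : B z (pulled s u) ≡ true
        zu = trans (cong (B z) pulled-u) (trans (≡-sym (star (good-at s x ex) x here u)) xu)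

        anchor-u : anchor s u ≡ a
        anchor-u = P.uncut uncutz zu

        anchor⁻-u : anchor⁻ s u ≡ anchor⁻ s x
        anchor⁻-u = cong₂ (λ r a → θ s r ⟨$⟩ˡ a) rep-u anchor-u

        w : Fin (t * n)
        w = pair s u

        anchor⁻-w : anchor⁻ (copy w) (base w) ≡ anchor⁻ s x
        anchor⁻-w = trans (cong₂ anchor⁻ (copy-pair s u) (base-pair s u)) anchor⁻-u

        origin-w : origin w ≡ origin v
        origin-w = cong₂ pair (copy-pair s u) anchor⁻-w

        ok-w : ok w ≡ true
        ok-w = ∧-intro (⌊⌋-intro (_ ≟ _) (trans (cong Q.rep anchor⁻-w)
            (trans (⌊⌋-elim (_ ≟ _) (∧-elimˡ okv)) (trans (≡-sym rep-u) (cong Q.rep (≡-sym (base-pair s u)))))))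
          (trans (cong (not ∘ mis) origin-w) (∧-elimʳ {within v} okv))

        τw : τ ⟨$⟩ʳ w ≡ pair (copy (image v)) (P.elem a′ (P.idx (pulled s u)))
        τw = trans (τ-ok w ok-w) (cong₂ (λ o i → pair (copy (σ ⟨$⟩ʳ o)) (P.elem (base (σ ⟨$⟩ʳ o)) i)) origin-w
          (cong P.idx (cong₂ pulled (copy-pair s u) (base-pair s u))))

        elem-u : P.elem a (P.idx (pulled s u)) ≡ pulled s u
        elem-u = trans (cong (λ a → P.elem a (P.idx (pulled s u))) (≡-sym anchor-u)) (elem-anchor s u)

        forward : B (base (τ ⟨$⟩ʳ v)) (base (τ ⟨$⟩ʳ w)) ≡ true
        forward = trans (cong₂ B base-τv (trans (cong base τw) (base-pair _ _)))
          (trans (≡-sym (colour-adj col (index v) (P.idx (pulled s u)))) (trans (cong₂ B (elem-anchor s x) elem-u) zu))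

      -- A neighbour of a deep vertex is moved by the same local isomorphism, and as the pulled
      -- vertex is uncut it lands in the same fine part. It therefore shares the origin of v and is
      -- sent to the same target part, where adjacency agrees by colour.
      ⇒ : ∀ w → blowup t A v w ≡ true → blowup t B (τ ⟨$⟩ʳ v) (τ ⟨$⟩ʳ w) ≡ true
      ⇒ w h = subst (λ w → blowup t B (τ ⟨$⟩ʳ v) (τ ⟨$⟩ʳ w) ≡ true) w≡ (∧-intro
          (⌊⌋-intro (_ ≟ _) (trans copy-τv (trans (≡-sym (copy-pair _ _)) (cong copy (≡-sym (τw (base w) xw))))))
          (forward (base w) xw))
        where
        xw : A x (base w) ≡ true
        xw = ∧-elimʳ {⌊ copy v ≟ copy w ⌋} h
        w≡ : pair s (base w) ≡ w
        w≡ = trans (cong (λ c → pair c (base w)) (⌊⌋-elim (copy v ≟ copy w) (∧-elimˡ h))) (pair-eta w)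

      -- The target is uncut, so its neighbour is a member of the target part with some index. The
      -- member with this index in the pulled part is adjacent to z and comes from a neighbour u of
      -- x; injectivity of `τ` identifies u with w.
      ⇐ : ∀ w → blowup t B (τ ⟨$⟩ʳ v) (τ ⟨$⟩ʳ w) ≡ true → blowup t A v w ≡ true
      ⇐ w h = subst (λ w → blowup t A v w ≡ true) (perm-injective τ τ≡)
          (∧-intro (⌊⌋-intro (_ ≟ _) (≡-sym (copy-pair s u))) (trans (cong (A x) (base-pair s u)) xu))
        where
        y′ z′ u : Fin n
        y′ = base (τ ⟨$⟩ʳ w)
        z′ = P.elem a (P.idx y′)
        u = ϑ ⟨$⟩ˡ z′
        By′ : B (base (τ ⟨$⟩ʳ v)) y′ ≡ true
        By′ = ∧-elimʳ {⌊ copy (τ ⟨$⟩ʳ v) ≟ copy (τ ⟨$⟩ʳ w) ⌋} h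
        rep-y′ : P.rep y′ ≡ a′
        rep-y′ = trans (P.uncut uncutv By′) (trans (cong (P.rep ∘ base) τv) (rep-target v okv))
        elem-y′ : P.elem a′ (P.idx y′) ≡ y′
        elem-y′ = trans (cong (λ a → P.elem a (P.idx y′)) (≡-sym rep-y′)) (P.elem-idx y′)
        zz′ : B z z′ ≡ true
        zz′ = trans (cong (λ z → B z z′) (≡-sym (elem-anchor s x))) (trans (colour-adj col (index v) (P.idx y′))
          (trans (cong₂ B (≡-sym base-τv) elem-y′) By′))
        xu : A x u ≡ true
        xu = trans (star (good-at s x ex) x here u) (trans (cong (B z) (inverseʳ ϑ)) zz′)
        pulled≡z′ : pulled s u ≡ z′
        pulled≡z′ = trans (pulled-u u xu) (inverseʳ ϑ)
        τ≡ : τ ⟨$⟩ʳ pair s u ≡ τ ⟨$⟩ʳ w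
        τ≡ = trans (τw u xu) (trans (cong₂ pair
            (trans (≡-sym copy-τv) (⌊⌋-elim (_ ≟ _) (∧-elimˡ h)))
            (trans (colour-eq col _ _ (trans (elem-u u xu) pulled≡z′)) elem-y′)) (pair-eta _))

      star-preserved : ∀ w → blowup t A v w ≡ blowup t B (τ ⟨$⟩ʳ v) (τ ⟨$⟩ʳ w)
      star-preserved w = ⇔⇒≡ (⇒ w) (⇐ w)

  bad : Fin (t * n) → Bool
  bad v = anyF (t * n) (λ w → blowup t A v w xor blowup t B (τ ⟨$⟩ʳ v) (τ ⟨$⟩ʳ w))

  private
    xor-same : ∀ b → b xor b ≡ false
    xor-same true  = refl
    xor-same false = refl

    bad-reason : Symmetric B → ∀ v → 𝟙 (bad v) ≤ (𝟙 (not (deep (base v))) + 𝟙 (exc (Q.rep (base v))))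
      + (𝟙 (within v ∧ mis (origin v)) + 𝟙 (P.cut (base (τ ⟨$⟩ʳ v))))
    bad-reason SB v = by (deep (base v)) (exc (Q.rep (base v))) (mis (origin v)) (P.cut (base (τ ⟨$⟩ʳ v))) refl refl refl refl
      where
      by : ∀ a b c d → deep (base v) ≡ a → exc (Q.rep (base v)) ≡ b → mis (origin v) ≡ c → P.cut (base (τ ⟨$⟩ʳ v)) ≡ d →
        𝟙 (bad v) ≤ (𝟙 (not a) + 𝟙 b) + (𝟙 (within v ∧ c) + 𝟙 d)
      by false _    _ _ _ _ _ _ = ≤-trans (𝟙≤1 (bad v)) (s≤s z≤n)
      by true  true _ _ _ _ _ _ = ≤-trans (𝟙≤1 (bad v)) (s≤s z≤n)
      by true false true  d ha hb hc hd = ≤-trans (𝟙≤1 (bad v)) (≤-trans (≤-reflexive (≡-sym (cong 𝟙 (∧-intro (deep-within v ha hb SB) refl)))) (m≤m+n _ _))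
      by true false false true  ha hb hc hd = ≤-trans (𝟙≤1 (bad v)) (m≤n+m 1 (𝟙 (within v ∧ false)))
      by true false false false ha hb hc hd = ≤-trans (≤-reflexive (cong 𝟙 (≢true⇒≡false λ h →
          let w , e = anyF-elim _ h in true≢false e (trans (cong (_xor blowup t B (τ ⟨$⟩ʳ v) (τ ⟨$⟩ʳ w)) (star-preserved w)) (xor-same (blowup t B (τ ⟨$⟩ʳ v) (τ ⟨$⟩ʳ w))))))) z≤n
        where open Fine v ha hb (∧-intro (deep-within v ha hb SB) (cong not hc)) hd

    -- The origin and an index below p determine v, so one mismatch spoils at most p vertices.
    ∑-mis : (∑[ v ] 𝟙 (within v ∧ mis (origin v))) ≤ ∑ (𝟙 ∘ mis) * p
    ∑-mis = ≤-trans (count-inj _ (λ u → mis (T.copy u)) (λ v → T.pair (origin v) (index v))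
        (λ v h → trans (cong mis (T.copy-pair _ _)) (∧-elimʳ {within v} h))
        (λ v w hv hw e → inj v w (∧-elimˡ hv) (∧-elimˡ hw)
          (trans (≡-sym (T.copy-pair _ _)) (trans (cong T.copy e) (T.copy-pair _ _)))
          (trans (≡-sym (T.base-pair _ _)) (trans (cong T.base e) (T.base-pair _ _)))))
      (≤-reflexive (trans (T.∑-copy-base (λ u _ → 𝟙 (mis u))) (trans (∑-cong λ u → trans (∑-const p _) (*-comm p _)) (≡-sym (∑-*ʳ p (𝟙 ∘ mis))))))
      where
      module T = Product (t * n) p
      inj : ∀ v w → within v ≡ true → within w ≡ true → origin v ≡ origin w → index v ≡ index w → v ≡ w
      inj v w hv hw e i = determines v w hv hw e (cong (P.elem (anchor (copy v) (base v))) i)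

  bad-count : Symmetric B → ∑ (𝟙 ∘ bad) ≤
    t * ((∑[ x ] 𝟙 (not (deep x))) + (∑[ x ] 𝟙 (exc (Q.rep x))) + ∑ (𝟙 ∘ P.cut)) + ∑ (𝟙 ∘ mis) * p
  bad-count SB = begin
    ∑ (𝟙 ∘ bad)
      ≤⟨ ∑-mono (bad-reason SB) ⟩
    ∑ (λ v → (𝟙 (not (deep (base v))) + 𝟙 (exc (Q.rep (base v)))) + (𝟙 (within v ∧ mis (origin v)) + 𝟙 (P.cut (base (τ ⟨$⟩ʳ v)))))
      ≡⟨ trans (∑-+ _ _) (cong₂ _+_ (∑-+ _ _) (∑-+ _ _)) ⟩
    ((∑[ v ] 𝟙 (not (deep (base v)))) + (∑[ v ] 𝟙 (exc (Q.rep (base v))))) + ((∑[ v ] 𝟙 (within v ∧ mis (origin v))) + (∑[ v ] 𝟙 (P.cut (base (τ ⟨$⟩ʳ v)))))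
      ≤⟨ +-mono-≤ (≤-reflexive (cong₂ _+_ (∑-base (λ x → 𝟙 (not (deep x)))) (∑-base (λ x → 𝟙 (exc (Q.rep x))))))
           (+-mono-≤ ∑-mis (≤-reflexive (trans (∑-perm τ (λ v → 𝟙 (P.cut (base v)))) (∑-base (𝟙 ∘ P.cut))))) ⟩
    (t * D + t * E) + (∑ (𝟙 ∘ mis) * p + t * C)
      ≡⟨ solve 6 (λ t D E C m p → (t :* D :+ t :* E) :+ (m :* p :+ t :* C) := t :* (D :+ E :+ C) :+ m :* p) refl t D E C (∑ (𝟙 ∘ mis)) p ⟩
    t * (D + E + C) + ∑ (𝟙 ∘ mis) * p ∎
    where
    open ≤-Reasoning
    open +-*-Solver
    D E C : ℕ
    D = ∑[ x ] 𝟙 (not (deep x))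
    E = ∑[ x ] 𝟙 (exc (Q.rep x))
    C = ∑ (𝟙 ∘ P.cut)

  pull-back : Symmetric B → Σ (Permutation′ (t * n)) λ τ →
    (∑[ v ] 𝟙 (anyF (t * n) (λ w → blowup t A v w xor blowup t B (τ ⟨$⟩ʳ v) (τ ⟨$⟩ʳ w)))) ≤
    t * ((∑[ x ] 𝟙 (not (deep x))) + (∑[ x ] 𝟙 (exc (Q.rep x))) + ∑ (𝟙 ∘ P.cut)) + ∑ (𝟙 ∘ mis) * p
  pull-back SB = τ , bad-count SB

-- Components of hyperfinite graphs

findFirst : (Fin n → Bool) → Maybe (Fin n)
findFirst {zero}  P = nothing
findFirst {suc n} P = if P Fin.zero then just Fin.zero else Maybe.map Fin.suc (findFirst (P ∘ Fin.suc))

findFirst-cong : {P Q : Fin n → Bool} → (∀ x → P x ≡ Q x) → findFirst P ≡ findFirst Q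
findFirst-cong {zero}  h = refl
findFirst-cong {suc n} h = cong₂ (λ b m → if b then just Fin.zero else Maybe.map Fin.suc m)
  (h Fin.zero) (findFirst-cong (h ∘ Fin.suc))

findFirst-complete : (P : Fin n → Bool) → ∀ x → P x ≡ true → ∃[ y ] findFirst P ≡ just y × P y ≡ true
findFirst-complete {suc n} P x Px with P Fin.zero in eq
... | true = Fin.zero , refl , eq
findFirst-complete {suc n} P Fin.zero    Px | false = contradiction eq (true≢false Px)
findFirst-complete {suc n} P (Fin.suc x) Px | false with findFirst-complete (P ∘ Fin.suc) x Px
... | y , e , Py = Fin.suc y , cong (Maybe.map Fin.suc) e , Py

module FromEquivalence {n k : ℕ} {A : Adj n} (_~_ : Adj n) (isEquiv : IsEquiv _~_)
  (class≤k : ∀ x → (∑[ y ] 𝟙 (x ~ y)) ≤ k) (~-walk : ∀ {x y} → x ~ y ≡ true → Walk A k x y) where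

  private
    least : ∀ x → ∃[ y ] findFirst (x ~_) ≡ just y × x ~ y ≡ true
    least x = findFirst-complete (x ~_) x (~-refl isEquiv x)

    -- Taking the least member makes the representative a function of the class. The default x never
    -- occurs, since x is in its own class.
    rep : Fin n → Fin n
    rep x = fromMaybe x (findFirst (x ~_))

    ~-rep : ∀ x → x ~ rep x ≡ true
    ~-rep x with least x
    ... | y , e , h = trans (cong (λ m → x ~ fromMaybe x m) e) h

    ~⇒rep : ∀ {x y} → x ~ y ≡ true → rep x ≡ rep y
    ~⇒rep {x} {y} h with least x
    ... | z , e , _ = trans (cong (fromMaybe x) e) (≡-sym (cong (fromMaybe y)
          (trans (≡-sym (findFirst-cong λ w → ⇔⇒≡ (~-trans isEquiv (~-sym isEquiv h)) (~-trans isEquiv h))) e)))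

    module E x = Enumeration (enumerate (x ~_))

    -- Indices beyond the class size repeat x, so that every index still names a member of the part.
    elem : Fin n → Fin k → Fin n
    elem x i with toℕ i ℕ.<? (∑[ y ] 𝟙 (x ~ y))
    ... | yes i<c = E.elem x (Fin.fromℕ< i<c)
    ... | no  _   = x

    ~-elem : ∀ x i → x ~ elem x i ≡ true
    ~-elem x i with toℕ i ℕ.<? (∑[ y ] 𝟙 (x ~ y))
    ... | yes i<c = E.sound x (Fin.fromℕ< i<c)
    ... | no  _   = ~-refl isEquiv x

    position : ∀ x → ∃[ i ] E.elem (rep x) i ≡ x
    position x = E.complete (rep x) x (~-sym isEquiv (~-rep x))

    idx : Fin n → Fin k
    idx x = Fin.inject≤ (proj₁ (position x)) (class≤k (rep x))

    elem-idx : ∀ x → elem (rep x) (idx x) ≡ x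
    elem-idx x with toℕ (idx x) ℕ.<? (∑[ y ] 𝟙 (rep x ~ y))
    ... | yes i<c = trans (cong (E.elem (rep x)) (Finₚ.toℕ-injective (trans (Finₚ.toℕ-fromℕ< i<c)
                      (Finₚ.toℕ-inject≤ (proj₁ (position x)) (class≤k (rep x)))))) (proj₂ (position x))
    ... | no i≮c = contradiction (subst (ℕ._< (∑[ y ] 𝟙 (rep x ~ y)))
                      (≡-sym (Finₚ.toℕ-inject≤ (proj₁ (position x)) (class≤k (rep x)))) (Finₚ.toℕ<n (proj₁ (position x)))) i≮c

  partition : Partition A k
  partition = record
    { rep      = rep
    ; rep-rep  = λ x → ≡-sym (~⇒rep (~-rep x))
    ; elem     = elem
    ; idx      = idx
    ; elem-idx = elem-idx
    ; rep-elem = λ x i → ≡-sym (~⇒rep (~-elem x i))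
    ; rep-walk = λ x → ~-walk (~-sym isEquiv (~-rep x))
    }

  partition-rep : ∀ {x y} → x ~ y ≡ true → Partition.rep partition x ≡ Partition.rep partition y
  partition-rep = ~⇒rep

-- The balls around x grow strictly until they become stable.
shorten : (A : Adj n) (x : Fin n) → ∀ k → (∀ j → (∑[ y ] 𝟙 (reach A j x y)) ≤ k) →
  ∀ {j y} → Walk A j x y → Walk A k x y
shorten {n} A x k bounded w with grow k
  where
  Stable : ℕ → Set
  Stable i = ∀ y → Walk A (suc i) x y → Walk A i x y
  grow : ∀ j → (∃[ i ] i ≤ j × Stable i) ⊎ suc j ≤ (∑[ y ] 𝟙 (reach A j x y))
  grow zero    = inj₂ (≤-reflexive (≡-sym (∑-δ₁ x)))
  grow (suc j) with grow j
  ... | inj₁ (i , i≤j , s) = inj₁ (i , m≤n⇒m≤1+n i≤j , s)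
  ... | inj₂ large with anyF n (λ y → reach A (suc j) x y ∧ not (reach A j x y)) in eq
  ...   | false = inj₁ (j , n≤1+n j , λ y v → reach⇒walk A j (not-not (anyF-false _ eq y) (walk⇒reach A v)))
    where
    not-not : ∀ {a b} → a ∧ not b ≡ false → a ≡ true → b ≡ true
    not-not {true} {true} _ _ = refl
  ...   | true with anyF-elim _ eq
  ...     | y , h = inj₂ (≤-trans (s≤s large) (∑-mono-< (λ z → 𝟙-mono (∨-introˡ {reach A j x z})) y
              (≤-reflexive (trans (cong (suc ∘ 𝟙) (not-true (∧-elimʳ {reach A (suc j) x y} h))) (≡-sym (cong 𝟙 (∧-elimˡ h)))))))
... | inj₂ large = contradiction (≤-trans large (bounded k)) 1+n≰n
... | inj₁ (i , i≤k , stable) = walk-mono i≤k (go here w)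
  where
  go : ∀ {j z y} → Walk A i x z → Walk A j z y → Walk A i x y
  go v here       = v
  go v (step a w) = go (stable _ (walk-snoc v a)) w

walk-map : {A B : Adj n} → (∀ {x y} → A x y ≡ true → B x y ≡ true) → ∀ {r x y} → Walk A r x y → Walk B r x y
walk-map h here       = here
walk-map h (step a w) = step (h a) (walk-map h w)

edges : Adj n → ℕ
edges A = ∑[ x ] ∑[ y ] 𝟙 ((toℕ x ℕ.<ᵇ toℕ y) ∧ A x y)

module Components {n k : ℕ} {A H : Adj n} (SH : Symmetric H) (H⊆A : ∀ x y → H x y ≡ true → A x y ≡ true)
  (small : ∀ x → (∑[ y ] 𝟙 (reach H n x y)) ≤ k) where

  private
    -- No ball has more than n vertices, so radius n already exhausts the component; this gives
    -- transitivity.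
    to-n : ∀ {j x y} → Walk H j x y → Walk H n x y
    to-n {x = x} = shorten H x n λ j → ≤-trans (∑-mono λ y → 𝟙≤1 (reach H j x y)) (≤-reflexive (trans (∑-const n 1) (*-identityʳ n)))

    connected : ∀ {x y} → reach H n x y ≡ true → Walk H n x y
    connected = reach⇒walk H n

    isEquiv : IsEquiv (reach H n)
    isEquiv = record
      { ~-refl  = λ x → walk⇒reach H {n} here
      ; ~-sym   = λ h → walk⇒reach H (walk-sym SH (connected h))
      ; ~-trans = λ h h′ → walk⇒reach H (to-n (walk-++ (connected h) (connected h′)))
      }

    close : ∀ {x y} → reach H n x y ≡ true → Walk A k x y
    close {x} h = walk-map (H⊆A _ _) (shorten H x k
      (λ j → ≤-trans (∑-mono λ y → 𝟙-mono λ r → walk⇒reach H (to-n (reach⇒walk H j r))) (small x)) (connected h))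

  open FromEquivalence {A = A} (reach H n) isEquiv small close public

  private
    open Partition partition using (rep; cut)

    F : Adj n
    F x y = A x y ∧ not (H x y)

    cut-≤ : ∀ x → 𝟙 (cut x) ≤ (∑[ y ] 𝟙 (F x y))
    cut-≤ x = ≤-trans (𝟙-anyF (λ y → A x y ∧ not ⌊ rep y ≟ rep x ⌋)) (∑-mono λ y → 𝟙-mono λ h →
      ∧-intro (∧-elimˡ h) (cong not (≢true⇒≡false λ e → true≢false (⌊⌋-intro (rep y ≟ rep x)
        (≡-sym (partition-rep (walk⇒reach H (to-n (step {r = 0} e here)))))) (not-true (∧-elimʳ {A x y} h)))))

  -- Every cut vertex is an end of a removed edge, and an edge has two ends. As H lies inside A, the
  -- truncated difference is the exact number of removed edges.
  cut-count : Symmetric A → (∀ x → A x x ≡ false) → ∑ (𝟙 ∘ cut) ≤ 2 * (edges A ∸ edges H)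
  cut-count SA irr = begin
    ∑ (𝟙 ∘ cut)                                     ≤⟨ ∑-mono cut-≤ ⟩
    (∑[ x ] ∑[ y ] 𝟙 (F x y))                       ≤⟨ ∑-mono (λ x → ∑-mono λ y → oriented x y) ⟩
    (∑[ x ] ∑[ y ] (up x y + up y x))               ≡⟨ trans (∑-cong λ x → ∑-+ (up x) (λ y → up y x)) (∑-+ (λ x → ∑ (up x)) _) ⟩
    (∑[ x ] ∑[ y ] up x y) + (∑[ x ] ∑[ y ] up y x) ≡⟨ cong ((∑[ x ] ∑[ y ] up x y) +_) (trans (∑-swap (λ x y → up y x)) (≡-sym (+-identityʳ _))) ⟩
    2 * edges F                                     ≡⟨ cong (2 *_) (trans (≡-sym (m+n∸n≡m (edges F) (edges H))) (cong (_∸ edges H) split)) ⟩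
    2 * (edges A ∸ edges H)                         ∎
    where
    open ≤-Reasoning
    up : Fin n → Fin n → ℕ
    up x y = 𝟙 ((toℕ x ℕ.<ᵇ toℕ y) ∧ F x y)
    <ᵇ-true : ∀ {a b} → a < b → (a ℕ.<ᵇ b) ≡ true
    <ᵇ-true {a} {b} a<b with a ℕ.<ᵇ b | <⇒<ᵇ a<b
    ... | true | _ = refl
    oriented : ∀ x y → 𝟙 (F x y) ≤ up x y + up y x
    oriented x y with <-cmp (toℕ x) (toℕ y)
    ... | tri< x<y _ _ = ≤-trans (𝟙-mono (λ h → ∧-intro (<ᵇ-true x<y) h)) (m≤m+n _ _)
    ... | tri≈ _ x≡y _ = ≤-trans (≤-reflexive (cong 𝟙 (≢true⇒≡false λ h → true≢false (∧-elimˡ h)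
            (subst (λ y → A x y ≡ false) (Finₚ.toℕ-injective x≡y) (irr x))))) z≤n
    ... | tri> _ _ y<x = ≤-trans (𝟙-mono (λ h → ∧-intro (<ᵇ-true y<x) (trans (cong₂ (λ a b → a ∧ not b) (SA y x) (SH y x)) h))) (m≤n+m _ (up x y))
    𝟙-split : ∀ c a h → (h ≡ true → a ≡ true) → 𝟙 (c ∧ (a ∧ not h)) + 𝟙 (c ∧ h) ≡ 𝟙 (c ∧ a)
    𝟙-split false a     h     _   = refl
    𝟙-split true  true  true  _   = refl
    𝟙-split true  true  false _   = refl
    𝟙-split true  false true  imp = contradiction (imp refl) λ ()
    𝟙-split true  false false _   = refl
    split : edges F + edges H ≡ edges A
    split = trans (≡-sym (∑-+ (λ x → ∑ (up x)) _)) (∑-cong λ x → trans (≡-sym (∑-+ (up x) _))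
      (∑-cong λ y → 𝟙-split (toℕ x ℕ.<ᵇ toℕ y) (A x y) (H x y) (H⊆A x y)))

module _ {n k d : ℕ} {A : Adj n} (SA : Symmetric A) (DA : DegreeBound d A) (Q : Partition A k) where
  open Partition Q

  private
    find-cut : ∀ {r x y} → Walk A r x y → rep y ≢ rep x → ∃[ w ] Walk A r x w × cut w ≡ true
    find-cut here ne = contradiction refl ne
    find-cut {x = x} (step {z = z} a w) ne = by (rep z ≟ rep x)
      where
      by : Dec (rep z ≡ rep x) → _
      by (yes e) with find-cut w (λ e′ → ne (trans e′ e))
      ... | c , v , h = c , step a v , h
      by (no ne′) = x , here , anyF-intro _ z (∧-intro a (cong not (⌊⌋-false (rep z ≟ rep x) ne′)))

  -- A walk that leaves its part passes through a cut vertex on the way, and each cut vertex is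
  -- within r of at most (d + 1) ^ r vertices.
  shallow-count : ∀ r → (∑[ x ] 𝟙 (anyF n (λ y → reach A r x y ∧ not ⌊ rep y ≟ rep x ⌋))) ≤ suc d ^ r * ∑ (𝟙 ∘ cut)
  shallow-count r = begin
    (∑[ x ] 𝟙 (anyF n (λ y → reach A r x y ∧ not ⌊ rep y ≟ rep x ⌋)))
      ≤⟨ ∑-mono (λ x → ≤-trans (𝟙-mono (near-cut x)) (𝟙-anyF (λ w → reach A r x w ∧ cut w))) ⟩
    (∑[ x ] ∑[ w ] 𝟙 (reach A r x w ∧ cut w))
      ≡⟨ ∑-swap (λ x w → 𝟙 (reach A r x w ∧ cut w)) ⟩
    (∑[ w ] ∑[ x ] 𝟙 (reach A r x w ∧ cut w))
      ≡⟨ ∑-cong (λ w → trans (∑-cong λ x → trans (𝟙-∧ (reach A r x w) (cut w)) (cong (λ b → 𝟙 b * 𝟙 (cut w)) (reach-sym SA r x w)))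
           (≡-sym (∑-*ʳ (𝟙 (cut w)) (λ x → 𝟙 (reach A r w x))))) ⟩
    (∑[ w ] (∑[ x ] 𝟙 (reach A r w x)) * 𝟙 (cut w))
      ≤⟨ ∑-mono (λ w → *-monoˡ-≤ (𝟙 (cut w)) (ball-size DA r w)) ⟩
    (∑[ w ] suc d ^ r * 𝟙 (cut w))
      ≡⟨ ∑-*ˡ (suc d ^ r) (𝟙 ∘ cut) ⟨
    suc d ^ r * ∑ (𝟙 ∘ cut) ∎
    where
    open ≤-Reasoning
    near-cut : ∀ x → anyF n (λ y → reach A r x y ∧ not ⌊ rep y ≟ rep x ⌋) ≡ true → anyF n (λ w → reach A r x w ∧ cut w) ≡ true
    near-cut x h with anyF-elim _ h
    ... | y , e with find-cut (reach⇒walk A r (∧-elimˡ e)) (λ r≡ → true≢false (∧-elimʳ {reach A r x y} e) (cong not (⌊⌋-intro (rep y ≟ rep x) r≡)))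
    ...   | w , v , c = anyF-intro _ w (∧-intro (walk⇒reach A v) c)

-- Disjoint copies

-- Disjoint copies occur with several numberings of the vertices: `blowup`, `copies`, casts, and
-- copies of copies. This interface makes the arguments independent of the numbering.
record Copies {n N : ℕ} (t : ℕ) (A : Adj n) (A′ : Adj N) : Set where
  field
    copy      : Fin N → Fin t
    base      : Fin N → Fin n
    pair      : Fin t → Fin n → Fin N
    copy-pair : ∀ s x → copy (pair s x) ≡ s
    base-pair : ∀ s x → base (pair s x) ≡ x
    pair-eta  : ∀ v → pair (copy v) (base v) ≡ v
    adjacent  : ∀ v w → A′ v w ≡ ⌊ copy v ≟ copy w ⌋ ∧ A (base v) (base w)

  pair-ext : ∀ {v w} → copy v ≡ copy w → base v ≡ base w → v ≡ w
  pair-ext {v} {w} c b = trans (≡-sym (pair-eta v)) (trans (cong₂ pair c b) (pair-eta w))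

  adjacent⁻ : ∀ {v w} → A′ v w ≡ true → copy v ≡ copy w × A (base v) (base w) ≡ true
  adjacent⁻ {v} {w} h = ⌊⌋-elim (copy v ≟ copy w) (∧-elimˡ h′) , ∧-elimʳ {⌊ copy v ≟ copy w ⌋} h′
    where h′ = trans (≡-sym (adjacent v w)) h

  adjacent⁺ : ∀ {v w} → copy v ≡ copy w → A (base v) (base w) ≡ true → A′ v w ≡ true
  adjacent⁺ {v} {w} c a = trans (adjacent v w) (∧-intro (⌊⌋-intro (copy v ≟ copy w) c) a)

  walk⁻ : ∀ {r v w} → Walk A′ r v w → copy v ≡ copy w × Walk A r (base v) (base w)
  walk⁻ here       = refl , here
  walk⁻ (step a w) with adjacent⁻ a | walk⁻ w
  ... | c , b | c′ , w′ = trans c c′ , step b w′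

  walk⁺ : ∀ {r x y} s → Walk A r x y → Walk A′ r (pair s x) (pair s y)
  walk⁺ s here = here
  walk⁺ {x = x} s (step {z = z} a w) = step
    (adjacent⁺ (trans (copy-pair s x) (≡-sym (copy-pair s z))) (trans (cong₂ A (base-pair s x) (base-pair s z)) a)) (walk⁺ s w)

  ∑-copies : (f : Fin t → Fin n → ℕ) → (∑[ v ] f (copy v) (base v)) ≡ (∑[ s ] ∑[ x ] f s x)
  ∑-copies f = trans (≡-sym (∑-bij (λ u → pair (P.copy u) (P.base u)) (λ v → P.pair (copy v) (base v))
      (λ u → trans (cong₂ P.pair (copy-pair _ _) (base-pair _ _)) (P.pair-eta u))
      (λ v → trans (cong₂ pair (P.copy-pair _ _) (P.base-pair _ _)) (pair-eta v))
      (λ v → f (copy v) (base v))))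
    (trans (∑-cong λ u → cong₂ f (copy-pair _ _) (base-pair _ _)) (P.∑-copy-base f))
    where module P = Product t n

  ∑-base : (f : Fin n → ℕ) → (∑[ v ] f (base v)) ≡ t * ∑ f
  ∑-base f = trans (∑-copies (λ _ → f)) (∑-const t _)

  copies-symmetric : Symmetric A → Symmetric A′
  copies-symmetric S v w = trans (adjacent v w) (trans (cong₂ _∧_ (≟-comm (copy v) (copy w)) (S (base v) (base w))) (≡-sym (adjacent w v)))

  copies-degree : ∀ {d} → DegreeBound d A → DegreeBound d A′
  copies-degree D v = ≤-trans (≤-reflexive (begin
    (∑[ w ] 𝟙 (A′ v w))                                              ≡⟨ ∑-cong (λ w → trans (cong 𝟙 (adjacent v w)) (𝟙-∧ ⌊ copy v ≟ copy w ⌋ _)) ⟩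
    (∑[ w ] 𝟙 ⌊ copy v ≟ copy w ⌋ * 𝟙 (A (base v) (base w)))         ≡⟨ ∑-copies (λ s x → 𝟙 ⌊ copy v ≟ s ⌋ * 𝟙 (A (base v) x)) ⟩
    (∑[ s ] ∑[ x ] 𝟙 ⌊ copy v ≟ s ⌋ * 𝟙 (A (base v) x))              ≡⟨ ∑-cong (λ s → ∑-*ˡ (𝟙 ⌊ copy v ≟ s ⌋) (λ x → 𝟙 (A (base v) x))) ⟨
    (∑[ s ] 𝟙 ⌊ copy v ≟ s ⌋ * (∑[ x ] 𝟙 (A (base v) x)))            ≡⟨ ∑-δ (copy v) _ ⟩
    (∑[ x ] 𝟙 (A (base v) x))                                        ∎)) (D (base v))
    where open ≡-Reasoning

  module _ {k : ℕ} (P : Partition A k) where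
    private module P = Partition P

    copies-partition : Partition A′ k
    copies-partition = record
      { rep      = λ v → pair (copy v) (P.rep (base v))
      ; rep-rep  = λ v → cong₂ pair (copy-pair _ _) (trans (cong P.rep (base-pair _ _)) (P.rep-rep (base v)))
      ; elem     = λ v i → pair (copy v) (P.elem (base v) i)
      ; idx      = λ v → P.idx (base v)
      ; elem-idx = λ v → trans (cong₂ (λ s x → pair s (P.elem x (P.idx (base v)))) (copy-pair _ _) (base-pair _ _))
                     (trans (cong (pair (copy v)) (P.elem-idx (base v))) (pair-eta v))
      ; rep-elem = λ v i → cong₂ pair (copy-pair _ _) (trans (cong P.rep (base-pair _ _)) (P.rep-elem (base v) i))
      ; rep-walk = λ v → subst (Walk A′ k _) (pair-eta v) (walk⁺ (copy v) (P.rep-walk (base v)))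
      }

    copies-cut : ∑ (𝟙 ∘ Partition.cut copies-partition) ≤ t * ∑ (𝟙 ∘ P.cut)
    copies-cut = ≤-trans (∑-mono λ v → 𝟙-mono (cut⁻ v)) (≤-reflexive (∑-base (𝟙 ∘ P.cut)))
      where
      module P′ = Partition copies-partition
      cut⁻ : ∀ v → P′.cut v ≡ true → P.cut (base v) ≡ true
      cut⁻ v h with anyF-elim _ h
      ... | w , e with adjacent⁻ {v} {w} (∧-elimˡ e)
      ...   | c , a = anyF-intro _ (base w) (∧-intro a (cong not (⌊⌋-false (P.rep (base w) ≟ P.rep (base v)) λ r →
                true≢false (∧-elimʳ {A′ v w} e) (cong not (⌊⌋-intro (P′.rep w ≟ P′.rep v) (cong₂ pair (≡-sym c) r))))))

blowup-copies : ∀ t (A : Adj n) → Copies t A (blowup t A)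
blowup-copies {n} t A = record
  { copy = copy ; base = base ; pair = pair ; copy-pair = copy-pair ; base-pair = base-pair ; pair-eta = pair-eta
  ; adjacent = λ _ _ → refl }
  where open Product t n

graph-copies : ∀ q (G : Graph) → Copies q (adj G) (copies q G)
graph-copies q G = record
  { copy      = λ v → proj₂ (Fin.quotRem {q} (size G) v)
  ; base      = λ v → proj₁ (Fin.quotRem {q} (size G) v)
  ; pair      = combine
  ; copy-pair = λ s x → cong proj₁ (Finₚ.remQuot-combine s x)
  ; base-pair = λ s x → cong proj₂ (Finₚ.remQuot-combine s x)
  ; pair-eta  = Finₚ.combine-remQuot {q} (size G)
  ; adjacent  = λ _ _ → refl
  }

cast-copies : ∀ {t k} {A : Adj n} {A′ : Adj m} (e : m ≡ k) → Copies t A A′ → Copies t A (castAdj e A′)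
cast-copies {A = A} {A′} refl C = record
  { copy = copy ; base = base ; pair = pair ; copy-pair = copy-pair ; base-pair = base-pair ; pair-eta = pair-eta
  ; adjacent = λ v w → trans (cong₂ A′ (Finₚ.cast-is-id refl v) (Finₚ.cast-is-id refl w)) (adjacent v w) }
  where open Copies C

copies-∘ : ∀ {k s t} {A : Adj n} {B : Adj m} {C : Adj k} → Copies s B C → Copies t A B → Copies (s * t) A C
copies-∘ {s = s} {t} {A} D E = record
  { copy      = λ v → P.pair (D.copy v) (E.copy (D.base v))
  ; base      = λ v → E.base (D.base v)
  ; pair      = λ c x → D.pair (P.copy c) (E.pair (P.base c) x)
  ; copy-pair = λ c x → trans (cong₂ P.pair (D.copy-pair _ _) (trans (cong E.copy (D.base-pair _ _)) (E.copy-pair _ _))) (P.pair-eta c)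
  ; base-pair = λ c x → trans (cong E.base (D.base-pair _ _)) (E.base-pair _ _)
  ; pair-eta  = λ v → trans (cong₂ (λ a b → D.pair a (E.pair b (E.base (D.base v)))) (P.copy-pair _ _) (P.base-pair _ _))
                  (trans (cong (D.pair (D.copy v)) (E.pair-eta (D.base v))) (D.pair-eta v))
  ; adjacent  = λ v w → ⇔⇒≡
      (λ h → let c , b = D.adjacent⁻ h ; c′ , a = E.adjacent⁻ b in ∧-intro (⌊⌋-intro (_ ≟ _) (cong₂ P.pair c c′)) a)
      (λ h → let c = ⌊⌋-elim (_ ≟ _) (∧-elimˡ {⌊ P.pair (D.copy v) (E.copy (D.base v)) ≟ P.pair (D.copy w) (E.copy (D.base w)) ⌋} h) in
        D.adjacent⁺ (trans (≡-sym (P.copy-pair _ _)) (trans (cong P.copy c) (P.copy-pair _ _)))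
          (E.adjacent⁺ (trans (≡-sym (P.base-pair _ _)) (trans (cong P.base c) (P.base-pair _ _)))
            (∧-elimʳ {⌊ P.pair (D.copy v) (E.copy (D.base v)) ≟ P.pair (D.copy w) (E.copy (D.base w)) ⌋} h)))
  }
  where
  module P = Product s t
  module D = Copies D
  module E = Copies E

module Reindex {n N M t : ℕ} {A : Adj n} {X : Adj N} {Y : Adj M} (C : Copies t A X) (D : Copies t A Y) where
  private
    module C = Copies C
    module D = Copies D

  to : Fin N → Fin M
  to v = D.pair (C.copy v) (C.base v)

  from : Fin M → Fin N
  from w = C.pair (D.copy w) (D.base w)

  from-to : ∀ v → from (to v) ≡ v
  from-to v = trans (cong₂ C.pair (D.copy-pair _ _) (D.base-pair _ _)) (C.pair-eta v)

  to-from : ∀ w → to (from w) ≡ w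
  to-from w = trans (cong₂ D.pair (C.copy-pair _ _) (C.base-pair _ _)) (D.pair-eta w)

  to-adjacent : ∀ v w → X v w ≡ Y (to v) (to w)
  to-adjacent v w = trans (C.adjacent v w) (≡-sym (trans (D.adjacent _ _)
    (cong₂ _∧_ (cong₂ (λ a b → ⌊ a ≟ b ⌋) (D.copy-pair _ _) (D.copy-pair _ _)) (cong₂ A (D.base-pair _ _) (D.base-pair _ _)))))

-- A rooted isomorphism of balls in graphs of different sizes, where no permutation is available.
-- Its values outside the ball are arbitrary.
record LocalIso {n m : ℕ} (A : Adj n) (B : Adj m) (R : ℕ) (x : Fin n) (y : Fin m) : Set where
  field
    map       : Fin n → Fin m
    map-root  : map x ≡ y
    injective : ∀ {u v} → Walk A R x u → Walk A R x v → map u ≡ map v → u ≡ v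
    onto      : ∀ {w} → Walk B R y w → ∃[ u ] Walk A R x u × map u ≡ w
    adjacency : ∀ {u v} → Walk A R x u → Walk A R x v → A u v ≡ B (map u) (map v)

  map-walk : ∀ {r u} → r ≤ R → Walk A r x u → Walk B r y (map u)
  map-walk r≤R w = subst (λ y → Walk B _ y _) map-root (go 0 here r≤R w)
    where
    go : ∀ p {r z u} → Walk A p x z → p + r ≤ R → Walk A r z u → Walk B r (map z) (map u)
    go p xz h here = here
    go p {suc r} xz h (step a w) = step (trans (≡-sym (adjacency (walk-mono (m+n≤o⇒m≤o p h) xz)
        (walk-mono (m+n≤o⇒m≤o (suc p) h′) (walk-snoc xz a)))) a) (go (suc p) (walk-snoc xz a) h′ w)
      where
      h′ : suc p + r ≤ R
      h′ = subst (_≤ R) (+-suc p r) h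

-- One unit of radius is lost because whole stars at distance R must be preserved, and these reach
-- distance R + 1. The map on one copy of the ball extends to a permutation. An edge of B′ at an
-- image ends in the image of the ball, so `onto` and injectivity of the permutation give the
-- reverse direction.
localIso⇒similar : ∀ {N s t R} {A : Adj n} {B : Adj m} {A′ B′ : Adj N} (C : Copies s A A′) (D : Copies t B B′) →
  ∀ v w → LocalIso A B (suc R) (Copies.base C v) (Copies.base D w) → Similar A′ B′ R v w
localIso⇒similar {N = N} {R = R} {A} {B} {A′} {B′} C D v w I = θ , good star-θ , θv
  where
  module C = Copies C
  module D = Copies D
  open LocalIso I
  inside : Fin N → Bool
  inside u = ⌊ C.copy v ≟ C.copy u ⌋ ∧ reach A (suc R) (C.base v) (C.base u)
  φ : Fin N → Fin N
  φ u = D.pair (D.copy w) (map (C.base u))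
  inside-copy : ∀ u → inside u ≡ true → C.copy v ≡ C.copy u
  inside-copy u h = ⌊⌋-elim (C.copy v ≟ C.copy u) (∧-elimˡ h)
  inside-walk : ∀ u → inside u ≡ true → Walk A (suc R) (C.base v) (C.base u)
  inside-walk u h = reach⇒walk A (suc R) (∧-elimʳ {⌊ C.copy v ≟ C.copy u ⌋} h)
  inside⁺ : ∀ {u} → C.copy v ≡ C.copy u → Walk A (suc R) (C.base v) (C.base u) → inside u ≡ true
  inside⁺ {u} c a = ∧-intro (⌊⌋-intro (C.copy v ≟ C.copy u) c) (walk⇒reach A a)
  extension = extend-injection inside φ λ a b ha hb e → C.pair-ext (trans (≡-sym (inside-copy a ha)) (inside-copy b hb))
    (injective (inside-walk a ha) (inside-walk b hb) (trans (≡-sym (D.base-pair _ _)) (trans (cong D.base e) (D.base-pair _ _))))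
  θ : Permutation′ N
  θ = proj₁ extension
  θ-inside : ∀ {u} → inside u ≡ true → θ ⟨$⟩ʳ u ≡ φ u
  θ-inside {u} = proj₂ extension u
  θv : θ ⟨$⟩ʳ v ≡ w
  θv = trans (θ-inside (inside⁺ refl here)) (trans (cong (D.pair (D.copy w)) map-root) (D.pair-eta w))
  star-θ : ∀ u → Walk A′ R v u → ∀ z → A′ u z ≡ B′ (θ ⟨$⟩ʳ u) (θ ⟨$⟩ʳ z)
  star-θ u vu z = ⇔⇒≡ ⇒ ⇐
    where
    cu : C.copy v ≡ C.copy u
    cu = proj₁ (C.walk⁻ vu)
    wu : Walk A R (C.base v) (C.base u)
    wu = proj₂ (C.walk⁻ vu)
    wu⁺ : Walk A (suc R) (C.base v) (C.base u)
    wu⁺ = walk-mono (n≤1+n R) wu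
    θu : θ ⟨$⟩ʳ u ≡ φ u
    θu = θ-inside (inside⁺ cu wu⁺)
    copy-θu : D.copy (θ ⟨$⟩ʳ u) ≡ D.copy w
    copy-θu = trans (cong D.copy θu) (D.copy-pair _ _)
    base-θu : D.base (θ ⟨$⟩ʳ u) ≡ map (C.base u)
    base-θu = trans (cong D.base θu) (D.base-pair _ _)
    ⇒ : A′ u z ≡ true → B′ (θ ⟨$⟩ʳ u) (θ ⟨$⟩ʳ z) ≡ true
    ⇒ h with C.adjacent⁻ h
    ... | c , a = D.adjacent⁺ (trans copy-θu (≡-sym (trans (cong D.copy θz) (D.copy-pair _ _))))
                    (trans (cong₂ B base-θu (trans (cong D.base θz) (D.base-pair _ _))) (trans (≡-sym (adjacency wu⁺ (walk-snoc wu a))) a))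
      where
      θz : θ ⟨$⟩ʳ z ≡ φ z
      θz = θ-inside (inside⁺ (trans cu c) (walk-snoc wu a))
    ⇐ : B′ (θ ⟨$⟩ʳ u) (θ ⟨$⟩ʳ z) ≡ true → A′ u z ≡ true
    ⇐ h with D.adjacent⁻ h
    ... | c , b with onto (walk-snoc (map-walk (n≤1+n R) wu) (trans (cong (λ y → B y (D.base (θ ⟨$⟩ʳ z))) (≡-sym base-θu)) b))
    ...   | y , wy , map-y = C.adjacent⁺ (trans (≡-sym cu) (≡-sym (trans (cong C.copy z≡) (C.copy-pair _ _))))
              (trans (cong (A (C.base u)) (trans (cong C.base z≡) (C.base-pair _ _)))
                (trans (adjacency wu⁺ wy) (trans (cong₂ B (≡-sym base-θu) map-y) b)))
      where
      z≡ : z ≡ C.pair (C.copy v) y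
      z≡ = perm-injective θ (D.pair-ext
        (trans (trans (≡-sym c) copy-θu) (≡-sym (trans (cong D.copy θy) (D.copy-pair _ _))))
        (trans (≡-sym map-y) (≡-sym (trans (cong D.base θy) (trans (D.base-pair _ _) (cong map (C.base-pair _ _)))))))
        where
        θy : θ ⟨$⟩ʳ C.pair (C.copy v) y ≡ φ (C.pair (C.copy v) y)
        θy = θ-inside (inside⁺ (≡-sym (C.copy-pair _ _)) (subst (Walk A (suc R) (C.base v)) (≡-sym (C.base-pair _ _)) wy))

-- Types of balls

opaque
  ballIso? : ∀ G r x α → Dec (BallIso G r x α)
  ballIso? G r x α = map′ (λ (c , h) → Fin.finToFun c , h) (λ (f , h) → Fin.funToFin f , resp f h)
    (Finₚ.any? λ c → iso? (Fin.finToFun c))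
    where
    V W : Set
    V = Fin (size (graph α))
    W = Fin (size G)
    IsIso : (V → W) → Set
    IsIso f = (∀ i j → f i ≡ f j → i ≡ j) × (f (root α) ≡ x) × (∀ i → reach (adj G) r x (f i) ≡ true) ×
      (∀ y → reach (adj G) r x y ≡ true → ∃[ i ] f i ≡ y) × (∀ i j → adj (graph α) i j ≡ adj G (f i) (f j))
    iso? : ∀ f → Dec (IsIso f)
    iso? f = (Finₚ.all? λ i → Finₚ.all? λ j → (f i ≟ f j) →-dec (i ≟ j)) ×-dec (f (root α) ≟ x) ×-dec
      (Finₚ.all? λ i → reach (adj G) r x (f i) ≟ᵇ true) ×-dec
      (Finₚ.all? λ y → (reach (adj G) r x y ≟ᵇ true) →-dec Finₚ.any? λ i → f i ≟ y) ×-dec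
      (Finₚ.all? λ i → Finₚ.all? λ j → adj (graph α) i j ≟ᵇ adj G (f i) (f j))
    resp : ∀ f → IsIso f → IsIso (Fin.finToFun (Fin.funToFin f))
    resp f (inj , rt , into , onto , ad) =
      (λ i j e → inj i j (trans (≡-sym (eq i)) (trans e (eq j)))) , trans (eq (root α)) rt ,
      (λ i → trans (cong (reach (adj G) r x) (eq i)) (into i)) ,
      (λ y h → proj₁ (onto y h) , trans (eq _) (proj₂ (onto y h))) ,
      (λ i j → trans (ad i j) (≡-sym (cong₂ (adj G) (eq i) (eq j))))
      where
      eq : ∀ i → Fin.finToFun (Fin.funToFin f) i ≡ f i
      eq = Finₚ.finToFun-funToFin f

Within : Rooted → ℕ → Set
Within α r = ∀ v → reach (adj (graph α)) r (root α) v ≡ true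

module _ {G : Graph} {R : ℕ} {x : Fin (size G)} {β : Rooted} (I : BallIso G R x β) where
  private
    f = proj₁ I
    f-inj = proj₁ (proj₂ I)
    f-root = proj₁ (proj₂ (proj₂ I))
    f-into = proj₁ (proj₂ (proj₂ (proj₂ I)))
    f-onto = proj₁ (proj₂ (proj₂ (proj₂ (proj₂ I))))
    f-adj = proj₂ (proj₂ (proj₂ (proj₂ (proj₂ I))))

    push : ∀ {r i j} → Walk (adj (graph β)) r i j → Walk (adj G) r (f i) (f j)
    push here       = here
    push (step a w) = step (trans (≡-sym (f-adj _ _)) a) (push w)

    pull : ∀ p {r i y} → Walk (adj G) p x (f i) → p + r ≤ R → Walk (adj G) r (f i) y →
      ∃[ j ] f j ≡ y × Walk (adj (graph β)) r i j
    pull p {i = i} v h here = i , refl , here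
    pull p {suc r} {i} v h (step {z = z} a w) with f-onto z (walk⇒reach (adj G) (walk-mono (m+n≤o⇒m≤o (suc p) h′) (walk-snoc v a)))
      where
      h′ : suc p + r ≤ R
      h′ = subst (_≤ R) (+-suc p r) h
    ... | k , refl with pull (suc p) (walk-snoc v a) (subst (_≤ R) (+-suc p r) h) w
    ...   | j , e , u = j , e , step (trans (f-adj i k) a) u

  reach⁺ : ∀ {r j} → Walk (adj (graph β)) r (root β) j → Walk (adj G) r x (f j)
  reach⁺ w = subst (λ y → Walk (adj G) _ y _) f-root (push w)

  reach⁻ : ∀ {r j} → r ≤ R → Walk (adj G) r x (f j) → Walk (adj (graph β)) r (root β) j
  reach⁻ {r} {j} r≤R w with pull 0 {i = root β} (subst (Walk (adj G) 0 x) (≡-sym f-root) here) r≤R (subst (λ y → Walk (adj G) r y (f j)) (≡-sym f-root) w)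
  ... | j′ , e , u = subst (Walk (adj (graph β)) r (root β)) (f-inj _ _ e) u

  ballIso-within : Within β R
  ballIso-within v = walk⇒reach (adj (graph β)) (reach⁻ ≤-refl (reach⇒walk (adj G) R (f-into v)))

  ballIso-degree : ∀ {d} → MaxDegLe d G → MaxDegLe d (graph β)
  ballIso-degree D i = ≤-trans (≤-reflexive (countF≡∑ _)) (≤-trans
    (count-inj _ (adj G (f i)) f (λ j h → trans (≡-sym (f-adj i j)) h) (λ j k _ _ → f-inj j k))
    (≤-trans (≤-reflexive (≡-sym (countF≡∑ _))) (D (f i))))

  -- Distances from the centre up to R are the same in the model β as in G, so the smaller balls
  -- around x can be examined in β.
  restrict⁺ : ∀ {r γ} → r ≤ R → BallIso G r x γ → BallIso (graph β) r (root β) γ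
  restrict⁺ {r} {γ} r≤R (h , h-inj , h-root , h-into , h-onto , h-adj) = g ,
      (λ i j e → h-inj i j (trans (≡-sym (fg i)) (trans (cong f e) (fg j)))) ,
      f-inj _ _ (trans (fg (root γ)) (trans h-root (≡-sym f-root))) ,
      (λ i → walk⇒reach (adj (graph β)) (reach⁻ r≤R (subst (Walk (adj G) r x) (≡-sym (fg i)) (reach⇒walk (adj G) r (h-into i))))) ,
      (λ k q → let i , e = h-onto (f k) (walk⇒reach (adj G) (reach⁺ (reach⇒walk (adj (graph β)) r q))) in i , f-inj _ _ (trans (fg i) e)) ,
      (λ i j → trans (h-adj i j) (≡-sym (trans (f-adj (g i) (g j)) (cong₂ (adj G) (fg i) (fg j)))))
    where
    preimage : ∀ i → ∃[ k ] f k ≡ h i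
    preimage i = f-onto (h i) (walk⇒reach (adj G) (walk-mono r≤R (reach⇒walk (adj G) r (h-into i))))
    g = proj₁ ∘ preimage
    fg = proj₂ ∘ preimage

  restrict⁻ : ∀ {r γ} → r ≤ R → BallIso (graph β) r (root β) γ → BallIso G r x γ
  restrict⁻ {r} {γ} r≤R (g , g-inj , g-root , g-into , g-onto , g-adj) = f ∘ g ,
      (λ i j e → g-inj i j (f-inj _ _ e)) ,
      trans (cong f g-root) f-root ,
      (λ i → walk⇒reach (adj G) (reach⁺ (reach⇒walk (adj (graph β)) r (g-into i)))) ,
      onto ,
      (λ i j → trans (g-adj i j) (f-adj _ _))
    where
    onto : ∀ y → reach (adj G) r x y ≡ true → ∃[ i ] f (g i) ≡ y
    onto y q with f-onto y (walk⇒reach (adj G) (walk-mono r≤R (reach⇒walk (adj G) r q)))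
    ... | k , refl with g-onto k (walk⇒reach (adj (graph β)) (reach⁻ r≤R (reach⇒walk (adj G) r q)))
    ...   | i , refl = i , refl

ballIso-common : ∀ {G H R x y} (β : Rooted) → BallIso G R x β → BallIso H R y β → LocalIso (adj G) (adj H) R x y
ballIso-common {G} {H} {R} {x} {y} β (f , f-inj , f-root , f-into , f-onto , f-adj) (g , g-inj , g-root , g-into , g-onto , g-adj) = record
  { map       = g ∘ f⁻¹
  ; map-root  = trans (cong (g ∘ f⁻¹) (≡-sym f-root)) (trans (cong g (f⁻¹-f (root β))) g-root)
  ; injective = λ wu wv e → trans (≡-sym (f-f⁻¹ wu)) (trans (cong f (g-inj _ _ e)) (f-f⁻¹ wv))
  ; onto      = λ {w} w′ → let i , e = g-onto w (walk⇒reach (adj H) w′) in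
                  f i , reach⇒walk (adj G) R (f-into i) , trans (cong g (f⁻¹-f i)) e
  ; adjacency = λ wu wv → trans (cong₂ (adj G) (≡-sym (f-f⁻¹ wu)) (≡-sym (f-f⁻¹ wv))) (trans (≡-sym (f-adj _ _)) (g-adj _ _))
  }
  where
  f⁻¹ : Fin (size G) → Fin (size (graph β))
  f⁻¹ u with Finₚ.any? (λ i → f i ≟ u)
  ... | yes (i , _) = i
  ... | no  _       = root β
  f-f⁻¹ : ∀ {u} → Walk (adj G) R x u → f (f⁻¹ u) ≡ u
  f-f⁻¹ {u} w with Finₚ.any? (λ i → f i ≟ u)
  ... | yes (i , e) = e
  ... | no  ¬p      = contradiction (f-onto u (walk⇒reach (adj G) w)) ¬p
  f⁻¹-f : ∀ i → f⁻¹ (f i) ≡ i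
  f⁻¹-f i = f-inj _ _ (f-f⁻¹ (reach⇒walk (adj G) R (f-into i)))

-- Symmetrising and clearing the diagonal turns every Boolean matrix into a simple graph, so listing
-- matrices lists all graphs of a given size.
matrixGraph : (s : ℕ) → Fin s → (Fin s → Fin s → Bool) → Rooted
matrixGraph s r M = record
  { graph = record
    { size   = s
    ; adj    = λ i j → (M i j ∨ M j i) ∧ not ⌊ i ≟ j ⌋
    ; sym    = λ i j → cong₂ (λ a b → a ∧ not b) (∨-comm (M i j) (M j i)) (≟-comm i j)
    ; irrefl = λ i → trans (cong (λ b → (M i i ∨ M i i) ∧ not b) (⌊⌋-intro (i ≟ i) refl)) (∧-zeroʳ (M i i ∨ M i i))
    }
  ; root = r }

matrix : (s : ℕ) → Fin ((2 ^ s) ^ s) → Fin s → Fin s → Bool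
matrix s c i j = ⌊ Fin.finToFun {2} {s} (Fin.finToFun {2 ^ s} {s} c i) j ≟ Fin.suc Fin.zero ⌋

matrix-surjective : ∀ s (M : Fin s → Fin s → Bool) → ∃[ c ] ∀ i j → matrix s c i j ≡ M i j
matrix-surjective s M = Fin.funToFin (λ i → Fin.funToFin (λ j → bit (M i j))) , λ i j →
  trans (cong (λ e → ⌊ e ≟ Fin.suc Fin.zero ⌋) (trans (cong (λ c → Fin.finToFun c j) (Finₚ.finToFun-funToFin _ i)) (Finₚ.finToFun-funToFin _ j))) (bit-one (M i j))
  where
  bit-one : ∀ b → ⌊ bit b ≟ Fin.suc Fin.zero ⌋ ≡ b
  bit-one true  = refl
  bit-one false = refl

opaque
  rootedUpTo : ℕ → List Rooted
  rootedUpTo S = concatMap (λ s → concatMap (λ r → List.map (λ c → matrixGraph s r (matrix s c)) (allFin _)) (allFin s)) (upTo (suc S))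

  ∈-rootedUpTo : ∀ {S s} → s ≤ S → ∀ r c → matrixGraph s r (matrix s c) ∈ rootedUpTo S
  ∈-rootedUpTo {S} {s} s≤S r c = ∈-concatMap⁺ (λ s → concatMap (λ r → List.map (λ c → matrixGraph s r (matrix s c)) (allFin _)) (allFin s))
    (lose (∈-upTo⁺ (s≤s s≤S)) (∈-concatMap⁺ (λ r → List.map (λ c → matrixGraph s r (matrix s c)) (allFin _))
      (lose (∈-allFin r) (∈-map⁺ (λ c → matrixGraph s r (matrix s c)) (∈-allFin c)))))

module BallTypes (d R : ℕ) where

  -- Placed first, it keeps the list of models nonempty, which provides a default type; it is also
  -- the model of every ball of radius 0.
  point : Rooted
  point = matrixGraph 1 Fin.zero (λ _ _ → false)

  family : List Rooted
  family = point ∷ rootedUpTo (suc d ^ R)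

  types : ℕ
  types = length family

  rooted : Fin types → Rooted
  rooted = lookup family

  exists-type : ∀ G → MaxDegLe d G → ∀ {r} → r ≤ R → ∀ x → ∃[ c ] BallIso G r x (rooted c)
  exists-type G D {r} r≤R x = Any.index c∈ , subst (BallIso G r x) (lookup-index c∈) iso
    where
    s : ℕ
    s = ∑[ y ] 𝟙 (reach (adj G) r x y)
    s≤ : s ≤ suc d ^ R
    s≤ = ≤-trans (ball-size (λ y → ≤-trans (≤-reflexive (≡-sym (countF≡∑ _))) (D y)) r x) (^-monoʳ-≤ (suc d) r≤R)
    open Enumeration (enumerate (reach (adj G) r x))
    centre = complete x (walk⇒reach (adj G) {r} here)
    M : Fin s → Fin s → Bool
    M i j = adj G (elem i) (elem j)
    code = matrix-surjective s M
    γ : Rooted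
    γ = matrixGraph s (proj₁ centre) (matrix s (proj₁ code))
    c∈ : γ ∈ family
    c∈ = there (∈-rootedUpTo s≤ (proj₁ centre) (proj₁ code))
    adj-γ : ∀ i j → adj (graph γ) i j ≡ adj G (elem i) (elem j)
    adj-γ i j = trans (cong₂ (λ a b → (a ∨ b) ∧ not ⌊ i ≟ j ⌋) (proj₂ code i j) (trans (proj₂ code j i) (Graph.sym G _ _))) (by (i ≟ j))
      where
      by : (e : Dec (i ≡ j)) → (M i j ∨ M i j) ∧ not ⌊ e ⌋ ≡ M i j
      by (yes refl) = trans (∧-zeroʳ (M i i ∨ M i i)) (≡-sym (irrefl G (elem i)))
      by (no _)     = trans (∧-identityʳ _) (∨-idem (M i j))
    iso : BallIso G r x γ
    iso = elem , injective , proj₂ centre , sound , complete , adj-γ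

  opaque
    -- The list contains isomorphic models many times over; the first match makes the type a
    -- canonical name of the isomorphism class.
    type : ℕ → (G : Graph) → Fin (size G) → Fin types
    type r G x = fromMaybe Fin.zero (findFirst (λ c → ⌊ ballIso? G r x (rooted c) ⌋))

    type-cong : ∀ r s {G H x y} → (∀ c → BallIso G r x (rooted c) → BallIso H s y (rooted c)) →
      (∀ c → BallIso H s y (rooted c) → BallIso G r x (rooted c)) → type r G x ≡ type s H y
    type-cong r s {G} {H} {x} {y} f g = cong (fromMaybe Fin.zero) (findFirst-cong λ c → ⇔⇒≡
      (λ h → ⌊⌋-intro (ballIso? H s y (rooted c)) (f c (⌊⌋-elim (ballIso? G r x (rooted c)) h)))
      (λ h → ⌊⌋-intro (ballIso? G r x (rooted c)) (g c (⌊⌋-elim (ballIso? H s y (rooted c)) h))))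

    type-sound : ∀ {G} → MaxDegLe d G → ∀ {r} → r ≤ R → ∀ x → BallIso G r x (rooted (type r G x))
    type-sound {G} D {r} r≤R x with exists-type G D r≤R x
    ... | c , I with findFirst-complete (λ c → ⌊ ballIso? G r x (rooted c) ⌋) c (⌊⌋-intro (ballIso? G r x (rooted c)) I)
    ...   | c′ , e , h = subst (λ m → BallIso G r x (rooted (fromMaybe Fin.zero m))) (≡-sym e) (⌊⌋-elim (ballIso? G r x (rooted c′)) h)

  type-restrict : ∀ {G s x β r} → BallIso G s x β → r ≤ s → type r G x ≡ type r (graph β) (root β)
  type-restrict {G} {s} {x} {β} {r} I r≤s = type-cong r r
    (λ c → restrict⁺ {G} {s} {x} {β} I {r} {rooted c} r≤s) (λ c → restrict⁻ {G} {s} {x} {β} I {r} {rooted c} r≤s)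

  -- If the model of the (r + 1)-ball lies within radius r, the two balls have the same vertices and
  -- hence the same models.
  type-stable : ∀ {G} → MaxDegLe d G → ∀ {r} → suc r ≤ R → ∀ x → Within (rooted (type (suc r) G x)) r →
    type r G x ≡ type (suc r) G x
  type-stable {G} D {r} r<R x W = type-cong r (suc r) (λ c → same r (suc r) same-ball {rooted c}) (λ c → same (suc r) r (λ y → ≡-sym (same-ball y)) {rooted c})
    where
    β = rooted (type (suc r) G x)
    I = type-sound D r<R x
    same-ball : ∀ y → reach (adj G) r x y ≡ reach (adj G) (suc r) x y
    same-ball y = ⇔⇒≡ ∨-introˡ λ h → let i , e = proj₁ (proj₂ (proj₂ (proj₂ (proj₂ I)))) y h in
      walk⇒reach (adj G) (subst (Walk (adj G) r x) e (reach⁺ {G} {suc r} {x} {β} I (reach⇒walk (adj (graph β)) r (W i))))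
    same : ∀ r s → (∀ y → reach (adj G) r x y ≡ reach (adj G) s x y) → ∀ {γ} → BallIso G r x γ → BallIso G s x γ
    same _ _ e (f , inj , rt , into , onto , ad) =
      f , inj , rt , (λ i → trans (≡-sym (e (f i))) (into i)) , (λ y h → onto y (trans (e y) h)) , ad

-- Frequencies of ball types form Cauchy sequences

module Frequencies {d : ℕ} (G : ℕ → Graph) (D : ∀ n → MaxDegLe d (G n)) where

  -- (a n / size (G n))ₙ is a Cauchy sequence, with denominators cleared.
  record Cauchy (a : ℕ → ℕ) : Set where
    constructor cauchy
    field
      modulus : ∀ E → ∃[ N ] ∀ m k → N ≤ m → N ≤ k → E * ∣ a m * size (G k) - a k * size (G m) ∣ ≤ size (G m) * size (G k)
  open Cauchy

  private
    halves : ∀ E {x y z} → 2 * E * x ≤ z → 2 * E * y ≤ z → E * (x + y) ≤ z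
    halves E {x} {y} {z} hx hy = *-cancelˡ-≤ 2 (begin
      2 * (E * (x + y))         ≡⟨ solve 3 (λ E x y → con 2 :* (E :* (x :+ y)) := con 2 :* E :* x :+ con 2 :* E :* y) refl E x y ⟩
      2 * E * x + 2 * E * y     ≤⟨ +-mono-≤ hx hy ⟩
      z + z                     ≡⟨ cong (z +_) (+-identityʳ z) ⟨
      2 * z                     ∎)
      where
      open ≤-Reasoning
      open +-*-Solver

    cauchy-by : ∀ {a b c : ℕ → ℕ} →
      (∀ m k → ∣ a m * size (G k) - a k * size (G m) ∣ ≤
        ∣ b m * size (G k) - b k * size (G m) ∣ + ∣ c m * size (G k) - c k * size (G m) ∣) →
      Cauchy b → Cauchy c → Cauchy a
    cauchy-by h B C = cauchy λ E → let N , hB = modulus B (2 * E) ; M , hC = modulus C (2 * E) in N + M , λ m k Nm Nk → ≤-trans (*-monoʳ-≤ E (h m k))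
      (halves E (hB m k (m+n≤o⇒m≤o N Nm) (m+n≤o⇒m≤o N Nk)) (hC m k (m+n≤o⇒n≤o N Nm) (m+n≤o⇒n≤o N Nk)))

  cauchy-cong : ∀ {a b} → (∀ n → a n ≡ b n) → Cauchy a → Cauchy b
  cauchy-cong h A = cauchy λ E → let N , hA = modulus A E in N , λ m k Nm Nk → subst (λ z → E * z ≤ size (G m) * size (G k))
    (cong₂ (λ x y → ∣ x * size (G k) - y * size (G m) ∣) (h m) (h k)) (hA m k Nm Nk)

  cauchy-0 : Cauchy (λ _ → 0)
  cauchy-0 = cauchy λ E → 0 , λ m k _ _ → ≤-trans (≤-reflexive (*-zeroʳ E)) z≤n

  cauchy-+ : ∀ {a b} → Cauchy a → Cauchy b → Cauchy (λ n → a n + b n)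
  cauchy-+ {a} {b} = cauchy-by λ m k → begin
      ∣ (a m + b m) * size (G k) - (a k + b k) * size (G m) ∣
        ≡⟨ cong₂ ∣_-_∣ (*-distribʳ-+ (size (G k)) (a m) (b m)) (*-distribʳ-+ (size (G m)) (a k) (b k)) ⟩
      ∣ a m * size (G k) + b m * size (G k) - a k * size (G m) + b k * size (G m) ∣
        ≤⟨ ∣-∣-triangle (a m * size (G k) + b m * size (G k)) (a k * size (G m) + b m * size (G k)) _ ⟩
      _ ≡⟨ cong₂ _+_ (trans (cong₂ ∣_-_∣ (+-comm (a m * size (G k)) _) (+-comm (a k * size (G m)) _)) (∣m+n-m+o∣≡∣n-o∣ (b m * size (G k)) _ _))
             (∣m+n-m+o∣≡∣n-o∣ (a k * size (G m)) _ _) ⟩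
      ∣ a m * size (G k) - a k * size (G m) ∣ + ∣ b m * size (G k) - b k * size (G m) ∣ ∎
    where open ≤-Reasoning

  cauchy-difference : ∀ {a b c} → (∀ n → a n + b n ≡ c n) → Cauchy b → Cauchy c → Cauchy a
  cauchy-difference {a} {b} {c} h = λ B C → cauchy-by bound C B
    where
    open ≤-Reasoning
    bound : ∀ m k → ∣ a m * size (G k) - a k * size (G m) ∣ ≤
      ∣ c m * size (G k) - c k * size (G m) ∣ + ∣ b m * size (G k) - b k * size (G m) ∣
    bound m k = begin
      ∣ a m * size (G k) - a k * size (G m) ∣
        ≡⟨ trans (≡-sym (∣m+n-m+o∣≡∣n-o∣ (b m * size (G k)) (a m * size (G k)) (a k * size (G m)))) (cong₂ ∣_-_∣ (+-comm (b m * size (G k)) _) (+-comm (b m * size (G k)) _)) ⟩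
      ∣ a m * size (G k) + b m * size (G k) - a k * size (G m) + b m * size (G k) ∣
        ≤⟨ ∣-∣-triangle (a m * size (G k) + b m * size (G k)) (a k * size (G m) + b k * size (G m)) _ ⟩
      ∣ a m * size (G k) + b m * size (G k) - a k * size (G m) + b k * size (G m) ∣ + ∣ a k * size (G m) + b k * size (G m) - a k * size (G m) + b m * size (G k) ∣
        ≡⟨ cong₂ _+_
             (cong₂ ∣_-_∣ (trans (≡-sym (*-distribʳ-+ (size (G k)) (a m) (b m))) (cong (_* size (G k)) (h m)))
                          (trans (≡-sym (*-distribʳ-+ (size (G m)) (a k) (b k))) (cong (_* size (G m)) (h k))))
             (trans (∣m+n-m+o∣≡∣n-o∣ (a k * size (G m)) _ _) (∣-∣-comm (b k * size (G m)) _)) ⟩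
      ∣ c m * size (G k) - c k * size (G m) ∣ + ∣ b m * size (G k) - b k * size (G m) ∣ ∎

  opaque
    unfolding ∑

    cauchy-∑ : ∀ {k} (a : Fin k → ℕ → ℕ) → (∀ c → Cauchy (a c)) → Cauchy (λ n → ∑[ c ] a c n)
    cauchy-∑ {zero}  a h = cauchy-0
    cauchy-∑ {suc k} a h = cauchy-+ (h Fin.zero) (cauchy-∑ (a ∘ Fin.suc) (h ∘ Fin.suc))

  module _ (R : ℕ)
    (weak : ∀ r α → HasRadius α r → MaxDegLe d (graph α) → Cauchy (λ n → ∑[ x ] 𝟙 ⌊ ballIso? (G n) r x α ⌋)) where
    open BallTypes d R

    frequency : ℕ → Fin types → ℕ → ℕ
    frequency r c n = ∑[ x ] 𝟙 ⌊ type r (G n) x ≟ c ⌋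

    private
      absent : ∀ r c → (∀ n x → type r (G n) x ≢ c) → Cauchy (frequency r c)
      absent r c h = cauchy-cong (λ n → ≡-sym (∑-all-0 _ λ x → cong 𝟙 (⌊⌋-false (type r (G n) x ≟ c) (h n x)))) cauchy-0

      of-type : ∀ {r c} → r ≤ R → ∀ n x → type r (G n) x ≡ c → BallIso (G n) r x (rooted c)
      of-type r≤R n x refl = type-sound (D n) r≤R x

      -- A model of too large degree, or one that is not the first match of its own ball, is never a
      -- type and has frequency 0. For any other model, having type c means being isomorphic to it,
      -- so weak convergence applies.
      exact : ∀ {r} → r ≤ R → ∀ c → HasRadius (rooted c) r → Cauchy (frequency r c)
      exact {r} r≤R c hasRadius with Finₚ.all? (λ i → degree (graph (rooted c)) i ℕ.≤? d) | type r (graph (rooted c)) (root (rooted c)) ≟ c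
      ... | no ¬D | _     = absent r c λ n x e → ¬D (ballIso-degree {G n} {r} {x} {rooted c} (of-type r≤R n x e) (D n))
      ... | yes _ | no ne = absent r c λ n x e → ne (trans (≡-sym (type-restrict {G n} {r} {x} {rooted c} (of-type r≤R n x e) ≤-refl)) e)
      ... | yes D′ | yes first = cauchy-cong (λ n → ∑-cong λ x → cong 𝟙 (⇔⇒≡
              (λ h → ⌊⌋-intro (type r (G n) x ≟ c) (trans (type-restrict {G n} {r} {x} {rooted c} (⌊⌋-elim (ballIso? (G n) r x (rooted c)) h) ≤-refl) first))
              (λ h → ⌊⌋-intro (ballIso? (G n) r x (rooted c)) (of-type r≤R n x (⌊⌋-elim (type r (G n) x ≟ c) h)))))
            (weak r (rooted c) hasRadius D′)

      within? : ∀ r c → Dec (Within (rooted c) r)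
      within? r c = Finₚ.all? λ v → reach (adj (graph (rooted c))) r (root (rooted c)) v ≟ᵇ true

      outside : ∀ {r} → r ≤ R → ∀ c → ¬ Within (rooted c) r → Cauchy (frequency r c)
      outside {r} r≤R c ¬W = absent r c λ n x e → ¬W (ballIso-within {G n} {r} {x} {rooted c} (of-type r≤R n x e))

      -- A model not within radius r either exceeds radius r + 1 and never occurs, or has radius
      -- exactly r + 1.
      large : ∀ {r} → suc r ≤ R → ∀ c → ¬ Within (rooted c) r → Cauchy (frequency (suc r) c)
      large {r} r<R c ¬W with within? (suc r) c
      ... | no ¬W′ = outside r<R c ¬W′
      ... | yes W′ with Finₚ.¬∀⟶∃¬ _ _ (λ v → reach (adj (graph (rooted c))) r (root (rooted c)) v ≟ᵇ true) ¬W
      ...   | v , far = exact r<R c (W′ , λ r′ r′<1+r → v , ≢true⇒≡false λ h → far (walk⇒reach (adj (graph (rooted c)))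
                (walk-mono (≤-pred r′<1+r) (reach⇒walk (adj (graph (rooted c))) r′ h))))

    -- The hypothesis only concerns balls of radius exactly r.  A type of smaller radius is the type of the
    -- r-ball minus the types of the (r+1)-balls that extend it properly, and those have radius r + 1.
    frequency-cauchy : ∀ r → r ≤ R → ∀ c → Cauchy (frequency r c)
    frequency-cauchy zero    r≤R c with within? zero c
    ... | yes W = exact r≤R c (W , λ _ ())
    ... | no ¬W = outside r≤R c ¬W
    frequency-cauchy (suc r) r<R c with within? r c
    ... | no ¬W = large r<R c ¬W
    ... | yes W = cauchy-difference split (cauchy-∑ _ proper) (frequency-cauchy r (<⇒≤ r<R) c)
      where
      restriction : Fin types → Fin types
      restriction c = type r (graph (rooted c)) (root (rooted c))
      extends : Fin types → Bool
      extends c′ = not ⌊ c′ ≟ c ⌋ ∧ ⌊ restriction c′ ≟ c ⌋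
      proper : ∀ c′ → Cauchy (λ n → 𝟙 (extends c′) * frequency (suc r) c′ n)
      proper c′ with extends c′ in ext
      ... | false = cauchy-0
      ... | true with within? r c′
      ...   | no ¬W′ = cauchy-cong (λ n → ≡-sym (*-identityˡ _)) (large r<R c′ ¬W′)
      -- An (r + 1)-type that lies within radius r equals its own restriction, which is c; being
      -- different from c, it never occurs.
      ...   | yes W′ = cauchy-cong (λ n → ≡-sym (*-identityˡ _)) (absent (suc r) c′ λ n x e → true≢false (∧-elimˡ ext)
                (cong not (⌊⌋-intro (c′ ≟ c) (trans (≡-sym e) (trans (≡-sym (type-stable (D n) r<R x (subst (λ c → Within (rooted c) r) (≡-sym e) W′)))
                  (trans (type-restrict {G n} {suc r} {x} {rooted c′} (of-type r<R n x e) (n≤1+n r)) (⌊⌋-elim (restriction c′ ≟ c) (∧-elimʳ {not ⌊ c′ ≟ c ⌋} ext))))))))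
      split : ∀ n → frequency (suc r) c n + (∑[ c′ ] 𝟙 (extends c′) * frequency (suc r) c′ n) ≡ frequency r c n
      split n = begin
        frequency (suc r) c n + (∑[ c′ ] 𝟙 (extends c′) * frequency (suc r) c′ n)
          ≡⟨ cong (frequency (suc r) c n +_) (trans (∑-cong λ c′ → ∑-*ˡ (𝟙 (extends c′)) (λ x → 𝟙 ⌊ T x ≟ c′ ⌋)) (∑-swap (λ c′ x → 𝟙 (extends c′) * 𝟙 ⌊ T x ≟ c′ ⌋))) ⟩
        frequency (suc r) c n + (∑[ x ] ∑[ c′ ] 𝟙 (extends c′) * 𝟙 ⌊ T x ≟ c′ ⌋)
          ≡⟨ cong (frequency (suc r) c n +_) (∑-cong λ x → trans (∑-cong λ c′ → *-comm (𝟙 (extends c′)) _) (∑-δ (T x) (𝟙 ∘ extends))) ⟩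
        frequency (suc r) c n + (∑[ x ] 𝟙 (extends (T x)))
          ≡⟨ ∑-+ (λ x → 𝟙 ⌊ T x ≟ c ⌋) _ ⟨
        (∑[ x ] (𝟙 ⌊ T x ≟ c ⌋ + 𝟙 (extends (T x))))
          ≡⟨ ∑-cong pt ⟩
        frequency r c n ∎
        where
        open ≡-Reasoning
        T : Fin (size (G n)) → Fin types
        T = type (suc r) (G n)
        restricts : ∀ x → restriction (T x) ≡ type r (G n) x
        restricts x = ≡-sym (type-restrict {G n} {suc r} {x} {rooted (T x)} (type-sound (D n) r<R x) (n≤1+n r))
        pt : ∀ x → 𝟙 ⌊ T x ≟ c ⌋ + 𝟙 (extends (T x)) ≡ 𝟙 ⌊ type r (G n) x ≟ c ⌋
        pt x = by (T x ≟ c)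
          where
          by : (e : Dec (T x ≡ c)) → 𝟙 ⌊ e ⌋ + 𝟙 (not ⌊ e ⌋ ∧ ⌊ restriction (T x) ≟ c ⌋) ≡ 𝟙 ⌊ type r (G n) x ≟ c ⌋
          by (yes e) = ≡-sym (cong 𝟙 (⌊⌋-intro (type r (G n) x ≟ c)
            (trans (type-stable (D n) r<R x (subst (λ c → Within (rooted c) r) (≡-sym e) W)) e)))
          by (no _)  = cong (λ c′ → 𝟙 ⌊ c′ ≟ c ⌋) (restricts x)

-- Rational bounds and the theorem

unit-fraction : ℕ → ℚ
unit-fraction e = ℤ.+ 1 ℚ./ suc e

unit-fraction-positive : ∀ e → 0ℚ ℚ.< unit-fraction e
unit-fraction-positive e = ℚₚ.toℚᵘ-cancel-< (ℚᵘₚ.<-respʳ-≃ (ℚᵘₚ.≃-sym (ℚₚ.toℚᵘ-fromℚᵘ (mkℚᵘ (ℤ.+ 1) e)))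
  (ℚᵘ.*<* (ℤ.+<+ (s≤s z≤n))))

-- E is the denominator of ε: the numerator is at least 1, so 1 / E is at most ε.
frac-< : ∀ ε → 0ℚ ℚ.< ε → ∃[ E ] 1 ≤ E × ∀ {c t} → E * c < t → frac c t ℚ.< ε
frac-< (ℚ.mkℚ (ℤ.+ zero)  d _) (ℚ.*<* (ℤ.+<+ ()))
frac-< (ℚ.mkℚ -[1+ _ ]  d _) (ℚ.*<* ())
frac-< (ℚ.mkℚ (ℤ.+ suc n) d p) _ = suc d , s≤s z≤n , λ { {c} {suc t} h →
  ℚₚ.toℚᵘ-cancel-< (ℚᵘₚ.<-respˡ-≃ (ℚᵘₚ.≃-sym (ℚₚ.toℚᵘ-fromℚᵘ (mkℚᵘ (ℤ.+ c) t)))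
    (ℚᵘ.*<* (subst₂ ℤ._<_ (ℤₚ.pos-* c (suc d)) (ℤₚ.pos-* (suc n) (suc t))
      (ℤ.+<+ (≤-trans (subst (_< suc t) (*-comm (suc d) c) h) (m≤m+n (suc t) (n * suc t))))))) }

fraction-bound : ∀ e x y → ℕtoℚ x ℚ.< unit-fraction e ℚ.* ℕtoℚ y → suc e * x < y
fraction-bound e x y h = subst₂ _<_ (trans (*-comm x _) (cong (_* x) (*-identityʳ (suc e)))) (trans (*-identityʳ _) (+-identityʳ y)) (ℤₚ.drop‿+<+
    (subst₂ ℤ._<_ (≡-sym (ℤₚ.pos-* x (suc e * 1))) (trans (cong (ℤ._* (ℤ.+ 1)) (≡-sym (ℤₚ.pos-* 1 y))) (≡-sym (ℤₚ.pos-* (1 * y) 1)))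
      (ℚᵘₚ.drop-*<* unnormalised)))
  where
  unnormalised : mkℚᵘ (ℤ.+ x) 0 ℚᵘ.< mkℚᵘ (ℤ.+ 1) e ℚᵘ.* mkℚᵘ (ℤ.+ y) 0
  unnormalised = ℚᵘₚ.<-respˡ-≃ (ℚₚ.toℚᵘ-fromℚᵘ (mkℚᵘ (ℤ.+ x) 0)) (ℚᵘₚ.<-respʳ-≃
    (ℚᵘₚ.≃-trans (ℚₚ.toℚᵘ-homo-* (unit-fraction e) (ℕtoℚ y))
      (ℚᵘₚ.*-cong (ℚₚ.toℚᵘ-fromℚᵘ (mkℚᵘ (ℤ.+ 1) e)) (ℚₚ.toℚᵘ-fromℚᵘ (mkℚᵘ (ℤ.+ y) 0))))
    (ℚₚ.toℚᵘ-mono-< h))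

frac-distance : ∀ e a b s t → ℚ.∣ frac a (suc s) ℚ.- frac b (suc t) ∣ ℚ.< unit-fraction e →
  suc e * ∣ a * suc t - b * suc s ∣ ≤ suc s * suc t
frac-distance e a b s t h = <⇒≤ (subst₂ _<_ (trans (*-comm difference (suc e)) (cong (suc e *_) numerator)) (+-identityʳ _)
    (ℤₚ.drop‿+<+ (subst₂ ℤ._<_ (≡-sym (ℤₚ.pos-* difference (suc e))) (≡-sym (ℤₚ.pos-* 1 (suc s * suc t))) (ℚᵘₚ.drop-*<* unnormalised))))
  where
  unnormalised : ℚᵘ.∣ mkℚᵘ (ℤ.+ a) s ℚᵘ.- mkℚᵘ (ℤ.+ b) t ∣ ℚᵘ.< mkℚᵘ (ℤ.+ 1) e
  unnormalised = ℚᵘₚ.<-respʳ-≃ (ℚₚ.toℚᵘ-fromℚᵘ (mkℚᵘ (ℤ.+ 1) e)) (ℚᵘₚ.<-respˡ-≃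
    (ℚᵘₚ.≃-trans (ℚₚ.toℚᵘ-homo-∣-∣ (frac a (suc s) ℚ.- frac b (suc t))) (ℚᵘₚ.∣-∣-cong
      (ℚᵘₚ.≃-trans (ℚₚ.toℚᵘ-homo-+ (frac a (suc s)) (ℚ.- frac b (suc t))) (ℚᵘₚ.+-cong (ℚₚ.toℚᵘ-fromℚᵘ (mkℚᵘ (ℤ.+ a) s))
        (ℚᵘₚ.≃-trans (ℚₚ.toℚᵘ-homo‿- (frac b (suc t))) (ℚᵘₚ.-‿cong (ℚₚ.toℚᵘ-fromℚᵘ (mkℚᵘ (ℤ.+ b) t))))))))
    (ℚₚ.toℚᵘ-mono-< h))
  ∣⊖∣ : ∀ m n → ℤ.∣ m ℤ.⊖ n ∣ ≡ ∣ m - n ∣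
  ∣⊖∣ m n with ≤-total m n
  ... | inj₁ m≤n = trans (ℤₚ.∣⊖∣-≤ m≤n) (≡-sym (m≤n⇒∣m-n∣≡n∸m m≤n))
  ... | inj₂ n≤m = trans (cong ℤ.∣_∣ (ℤₚ.⊖-≥ n≤m)) (≡-sym (m≤n⇒∣n-m∣≡n∸m n≤m))
  difference : ℕ
  difference = ℤ.∣ ℤ.+ a ℤ.* ℤ.+ suc t ℤ.+ (ℤ.- (ℤ.+ b)) ℤ.* ℤ.+ suc s ∣
  numerator : difference ≡ ∣ a * suc t - b * suc s ∣
  numerator = trans (cong ℤ.∣_∣ (trans (cong₂ ℤ._+_ (≡-sym (ℤₚ.pos-* a (suc t)))
    (trans (≡-sym (ℤₚ.neg-distribˡ-* (ℤ.+ b) (ℤ.+ suc s))) (cong ℤ.-_ (≡-sym (ℤₚ.pos-* b (suc s)))))) (ℤₚ.m-n≡m⊖n (a * suc t) (b * suc s))))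
    (∣⊖∣ (a * suc t) (b * suc s))

module _ {d : ℕ} (G : ℕ → Graph) (D : ∀ n → MaxDegLe d (G n)) (W : WeaklyConvergent d G) where
  open Frequencies G D

  private
    hasCount : ∀ n r α → HasCount (size (G n)) (λ x → BallIso (G n) r x α) (∑[ x ] 𝟙 ⌊ ballIso? (G n) r x α ⌋)
    hasCount n r α = (λ x → ⌊ ballIso? (G n) r x α ⌋) ,
      (λ x → ⌊⌋-elim (ballIso? (G n) r x α) , ⌊⌋-intro (ballIso? (G n) r x α)) , countF≡∑ _

    ∑-empty : ∀ {n} → n ≡ 0 → (f : Fin n → ℕ) → ∑ f ≡ 0
    ∑-empty refl f = ∑-all-0 f λ ()

  -- Clearing denominators in a difference below 1 / (E + 1) gives the bound. If one of the graphs
  -- is empty, its count is 0 and the cleared difference vanishes.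
  weakly-convergent⇒cauchy : ∀ r α → HasRadius α r → MaxDegLe d (graph α) → Cauchy (λ n → ∑[ x ] 𝟙 ⌊ ballIso? (G n) r x α ⌋)
  weakly-convergent⇒cauchy r α hr hd = cauchy go
    where
    c : ℕ → ℕ
    c n = ∑[ x ] 𝟙 ⌊ ballIso? (G n) r x α ⌋
    by : ∀ e m k s t → size (G m) ≡ s → size (G k) ≡ t → ℚ.∣ frac (c m) s ℚ.- frac (c k) t ∣ ℚ.< unit-fraction e →
      suc e * ∣ c m * t - c k * s ∣ ≤ s * t
    by e m k zero    t       em ek h = ≤-reflexive (trans (cong (λ z → suc e * ∣ z * t - c k * 0 ∣) (∑-empty em _))
      (trans (cong (suc e *_) (*-zeroʳ (c k))) (*-zeroʳ (suc e))))
    by e m k (suc s) zero    em ek h = ≤-trans (≤-reflexive (trans (cong₂ (λ y z → suc e * ∣ y - z * suc s ∣) (*-zeroʳ (c m)) (∑-empty ek _)) (*-zeroʳ (suc e)))) z≤n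
    by e m k (suc s) (suc t) em ek h = frac-distance e (c m) (c k) s t h
    go : ∀ E → ∃[ N ] ∀ m k → N ≤ m → N ≤ k → E * ∣ c m * size (G k) - c k * size (G m) ∣ ≤ size (G m) * size (G k)
    go E with W r α hr hd (unit-fraction E) (unit-fraction-positive E)
    ... | N , h = N , λ m k Nm Nk → ≤-trans (*-monoˡ-≤ _ (n≤1+n E)) (by E m k _ _ refl refl
            (h m k Nm Nk _ _ (c m , hasCount m r α , refl) (c k , hasCount k r α , refl)))

  -- The single point models the 0-ball of every vertex, so its proportion is 1 in a nonempty graph
  -- and 0 in the empty one. Tolerance 1 excludes that both values occur in the tail.
  eventually-nonempty : ∃[ N ] ∀ m k → N ≤ m → N ≤ k → size (G m) ≡ 0 → size (G k) ≡ 0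
  eventually-nonempty with W 0 point within degrees (unit-fraction 0) (unit-fraction-positive 0)
    where
    open BallTypes d 0 using (point)
    within : HasRadius point 0
    within = (λ { Fin.zero → refl }) , λ _ ()
    degrees : MaxDegLe d (graph point)
    degrees Fin.zero = z≤n
  ... | N , h = N , λ m k Nm Nk e → by (size (G k)) refl (h m k Nm Nk _ _ (_ , hasCount m 0 point , refl) (_ , hasCount k 0 point , refl)) e
    where
    open BallTypes d 0 using (point)
    is-point : ∀ k x → BallIso (G k) 0 x point
    is-point k x = (λ _ → x) , (λ { Fin.zero Fin.zero _ → refl }) , refl , (λ _ → ⌊⌋-intro (x ≟ x) refl) ,
      (λ y h → Fin.zero , ⌊⌋-elim (x ≟ y) h) , λ { Fin.zero Fin.zero → ≡-sym (irrefl (G k) x) }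
    c : ℕ → ℕ
    c n = ∑[ x ] 𝟙 ⌊ ballIso? (G n) 0 x point ⌋
    full : ∀ k → c k ≡ size (G k)
    full k = trans (∑-cong λ x → cong 𝟙 (⌊⌋-intro (ballIso? (G k) 0 x point) (is-point k x))) (trans (∑-const _ 1) (*-identityʳ _))
    by : ∀ {m k} t → size (G k) ≡ t → ℚ.∣ frac (c m) (size (G m)) ℚ.- frac (c k) (size (G k)) ∣ ℚ.< unit-fraction 0 → size (G m) ≡ 0 → size (G k) ≡ 0
    by zero    e _ _ = e
    by {m} {k} (suc t) e h e₀ = contradiction (subst₂ (λ s u → ℚ.∣ frac (c m) s ℚ.- u ∣ ℚ.< unit-fraction 0) e₀ one h) (ℚₚ.<-irrefl refl)
      where
      one : frac (c k) (size (G k)) ≡ unit-fraction 0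
      one = trans (cong₂ frac (trans (full k) e) e) (ℚₚ.toℚᵘ-injective
        (ℚᵘₚ.≃-trans (ℚₚ.toℚᵘ-fromℚᵘ (mkℚᵘ (ℤ.+ suc t) t)) (ℚᵘ.*≡* (ℤₚ.*-comm (ℤ.+ suc t) (ℤ.+ 1)))))

-- Counting the errors and assembling the proof

module Core {n d p q : ℕ} {A B : Adj n} (SA : Symmetric A) (SB : Symmetric B) (DA : DegreeBound d A) (DB : DegreeBound d B)
  (P : Partition B p) (Q : Partition A q) (H l : ℕ) (1≤l : 1 ≤ l)
  (π : Permutation′ n) (exc : Fin n → Bool) (sim : ∀ x → exc x ≡ false → Similar A B (level (q + p) (l * l)) x (π ⟨$⟩ʳ x)) where

  private
    module P = Partition P
    module Q = Partition Q
    open Colour P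

    K M Δ t X : ℕ
    K = q + p
    M = colours p
    Δ = suc d ^ K
    t = (n !) !
    X = ∑[ b ] 𝟙 (exc b ∨ exc (Q.rep b))

    rooted : ∀ b → Walk A K (Q.rep b) b
    rooted b = walk-mono (m≤m+n q p) (Q.rep-walk b)

    choice = equidistribution SB DB colour K l 1≤l π exc sim Q.rep rooted

    θ : Fin t → Fin n → Permutation′ n
    θ = proj₁ choice

    θ-good : ∀ s r → exc r ≡ false → Good A B (θ s r) K r
    θ-good = proj₁ (proj₂ choice)

    pull : Fin (t * n) → Fin M
    pull v = colour (θ (copy v) (Q.rep (base v)) ⟨$⟩ʳ base v)
      where open Product t n

    matching = match-colours pull (λ v → colour (Product.base t n v))

    σ : Permutation′ (t * n)
    σ = proj₁ matching

    open PullBack P Q exc θ θ-good σ using (mis; deep; pull-back)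

    few-mis : l * ∑ (𝟙 ∘ mis) ≤ t * (2 * (Δ * (M * n)) + l * (M * X))
    few-mis = ≤-trans (*-monoʳ-≤ l (≤-trans (proj₂ matching) (≤-reflexive (∑-cong λ c → cong₂ ∣_-_∣
      (trans (∑-copy-base (λ s b → 𝟙 ⌊ colour (θ s (Q.rep b) ⟨$⟩ʳ b) ≟ c ⌋)) (∑-swap (λ s b → 𝟙 ⌊ colour (θ s (Q.rep b) ⟨$⟩ʳ b) ≟ c ⌋)))
      (∑-base (λ z → 𝟙 ⌊ colour z ≟ c ⌋)))))) (proj₂ (proj₂ choice))
      where open Product t n

    -- An exceptional root spoils its whole part, which lies in the K-ball around it.
    root-count : (∑[ b ] 𝟙 (exc (Q.rep b))) ≤ Δ * ∑ (𝟙 ∘ exc)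
    root-count = begin
      (∑[ b ] 𝟙 (exc (Q.rep b)))                                  ≡⟨ ∑-fibre Q.rep _ ⟩
      (∑[ r ] ∑[ b ] 𝟙 ⌊ Q.rep b ≟ r ⌋ * 𝟙 (exc (Q.rep b)))       ≤⟨ ∑-mono (λ r → ∑-mono λ b → pt r b) ⟩
      (∑[ r ] ∑[ b ] 𝟙 (reach A K r b) * 𝟙 (exc r))               ≡⟨ ∑-cong (λ r → ∑-*ʳ (𝟙 (exc r)) (λ b → 𝟙 (reach A K r b))) ⟨
      (∑[ r ] (∑[ b ] 𝟙 (reach A K r b)) * 𝟙 (exc r))             ≤⟨ ∑-mono (λ r → *-monoˡ-≤ (𝟙 (exc r)) (ball-size DA K r)) ⟩
      (∑[ r ] Δ * 𝟙 (exc r))                                      ≡⟨ ∑-*ˡ Δ (𝟙 ∘ exc) ⟨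
      Δ * ∑ (𝟙 ∘ exc)                                             ∎
      where
      open ≤-Reasoning
      pt : ∀ r b → 𝟙 ⌊ Q.rep b ≟ r ⌋ * 𝟙 (exc (Q.rep b)) ≤ 𝟙 (reach A K r b) * 𝟙 (exc r)
      pt r b with Q.rep b ≟ r
      ... | yes refl = ≤-reflexive (cong (λ e → 𝟙 e * 𝟙 (exc (Q.rep b))) (≡-sym (walk⇒reach A (rooted b))))
      ... | no  _    = z≤n

    X≤ : X ≤ suc Δ * ∑ (𝟙 ∘ exc)
    X≤ = ≤-trans (∑-mono λ b → 𝟙-∨ (exc b) (exc (Q.rep b))) (≤-trans (≤-reflexive (∑-+ (𝟙 ∘ exc) _)) (+-monoʳ-≤ _ root-count))

    shallow : (∑[ x ] 𝟙 (not (deep x))) ≤ suc d ^ suc p * ∑ (𝟙 ∘ Q.cut)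
    shallow = ≤-trans (≤-reflexive (∑-cong λ x → cong 𝟙 (not-involutive _))) (shallow-count SA DA Q (suc p))

    -- Five shares of t * n: shallow vertices, exceptional roots and fine cuts take one each,
    -- mismatches take two, one for the energy term and one for exceptions. The successors in the
    -- hypothesis on `exc` keep all factors positive, so that it serves both bounds involving
    -- exceptions.
    few-bad : ∀ b → b ≤ t * ((∑[ x ] 𝟙 (not (deep x))) + (∑[ x ] 𝟙 (exc (Q.rep x))) + ∑ (𝟙 ∘ P.cut)) + ∑ (𝟙 ∘ mis) * p →
      H * ∑ (𝟙 ∘ P.cut) ≤ n → H * (suc d ^ suc p * ∑ (𝟙 ∘ Q.cut)) ≤ n →
      H * p * (2 * (suc d ^ (q + p) * colours p)) ≤ l → H * suc p * suc (colours p) * suc (suc d ^ (q + p)) * ∑ (𝟙 ∘ exc) ≤ n →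
      H * b ≤ 5 * (t * n)
    few-bad b b≤ hP hQ hl hX = begin
      H * b                              ≤⟨ *-monoʳ-≤ H b≤ ⟩
      H * (t * (dd + ee + cc) + mm * p)            ≡⟨ solve 7 (λ H t dd ee cc m p → H :* (t :* (dd :+ ee :+ cc) :+ m :* p) := t :* (H :* dd :+ H :* ee :+ H :* cc) :+ H :* (m :* p)) refl H t dd ee cc mm p ⟩
      t * (H * dd + H * ee + H * cc) + H * (mm * p) ≤⟨ +-mono-≤ (*-monoʳ-≤ t (+-mono-≤ (+-mono-≤ (≤-trans (*-monoʳ-≤ H shallow) hQ) few-ee) hP)) few-m ⟩
      t * (n + n + n) + 2 * (t * n)                ≡⟨ solve 2 (λ t n → t :* (n :+ n :+ n) :+ con 2 :* (t :* n) := con 5 :* (t :* n)) refl t n ⟩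
      5 * (t * n)                                  ∎
      where
      open ≤-Reasoning
      open +-*-Solver
      dd ee cc mm e : ℕ
      dd = ∑[ x ] 𝟙 (not (deep x))
      ee = ∑[ x ] 𝟙 (exc (Q.rep x))
      cc = ∑ (𝟙 ∘ P.cut)
      mm = ∑ (𝟙 ∘ mis)
      e = ∑ (𝟙 ∘ exc)
      few-ee : H * ee ≤ n
      few-ee = begin
        H * ee                           ≤⟨ *-monoʳ-≤ H root-count ⟩
        H * (Δ * e)                      ≡⟨ solve 3 (λ H Δ e → H :* (Δ :* e) := H :* con 1 :* con 1 :* Δ :* e) refl H Δ e ⟩
        H * 1 * 1 * Δ * e                ≤⟨ *-monoˡ-≤ e (*-mono-≤ (*-mono-≤ (*-monoʳ-≤ H (s≤s (z≤n {p}))) (s≤s (z≤n {M}))) (n≤1+n Δ)) ⟩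
        H * suc p * suc M * suc Δ * e    ≤⟨ hX ⟩
        n                                ∎
      few-X : H * p * (M * X) ≤ n
      few-X = begin
        H * p * (M * X)                  ≤⟨ *-monoʳ-≤ (H * p) (*-monoʳ-≤ M X≤) ⟩
        H * p * (M * (suc Δ * e))        ≡⟨ solve 5 (λ H p M D e → H :* p :* (M :* (D :* e)) := H :* p :* M :* D :* e) refl H p M (suc Δ) e ⟩
        H * p * M * suc Δ * e            ≤⟨ *-monoˡ-≤ e (*-monoˡ-≤ (suc Δ) (*-mono-≤ (*-monoʳ-≤ H (n≤1+n p)) (n≤1+n M))) ⟩
        H * suc p * suc M * suc Δ * e    ≤⟨ hX ⟩
        n                                ∎
      few-m : H * (mm * p) ≤ 2 * (t * n)
      few-m = *-cancelˡ-≤ l {{ℕ.>-nonZero 1≤l}} (begin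
        l * (H * (mm * p))                                        ≡⟨ solve 4 (λ l H m p → l :* (H :* (m :* p)) := H :* p :* (l :* m)) refl l H mm p ⟩
        H * p * (l * mm)                                          ≤⟨ *-monoʳ-≤ (H * p) few-mis ⟩
        H * p * (t * (2 * (Δ * (M * n)) + l * (M * X)))           ≡⟨ solve 7 (λ h t Δ M n l X → h :* (t :* (con 2 :* (Δ :* (M :* n)) :+ l :* (M :* X))) := h :* (con 2 :* (Δ :* M)) :* (t :* n) :+ l :* (t :* (h :* (M :* X)))) refl (H * p) t Δ M n l X ⟩
        H * p * (2 * (Δ * M)) * (t * n) + l * (t * (H * p * (M * X))) ≤⟨ +-mono-≤ (*-monoˡ-≤ (t * n) hl) (*-monoʳ-≤ l (*-monoʳ-≤ t few-X)) ⟩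
        l * (t * n) + l * (t * n)                                 ≡⟨ solve 2 (λ l s → l :* s :+ l :* s := l :* (con 2 :* s)) refl l (t * n) ⟩
        l * (2 * (t * n))                                         ∎)

  approximate-isomorphism : H * ∑ (𝟙 ∘ P.cut) ≤ n → H * (suc d ^ suc p * ∑ (𝟙 ∘ Q.cut)) ≤ n →
    H * p * (2 * (suc d ^ (q + p) * colours p)) ≤ l → H * suc p * suc (colours p) * suc (suc d ^ (q + p)) * ∑ (𝟙 ∘ exc) ≤ n →
    ∃[ t ] 1 ≤ t × Σ (Permutation′ (t * n)) λ τ →
      H * (∑[ v ] 𝟙 (anyF (t * n) (λ w → blowup t A v w xor blowup t B (τ ⟨$⟩ʳ v) (τ ⟨$⟩ʳ w)))) ≤ 5 * (t * n)
  approximate-isomorphism hP hQ hl hX = t , 1≤n! (n !) , proj₁ pulled , few-bad _ (proj₂ pulled) hP hQ hl hX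
    where pulled = pull-back SB

opaque
  unfolding ∑

  sumF≡∑ : (f : Fin n → ℕ) → sumF n f ≡ ∑ f
  sumF≡∑ f = refl

numEdges≡edges : (A : Adj n) → numEdges A ≡ edges A
numEdges≡edges A = trans (sumF≡∑ _) (∑-cong λ i → countF≡∑ _)

graph-degree : ∀ {d} G → MaxDegLe d G → DegreeBound d (adj G)
graph-degree G D x = ≤-trans (≤-reflexive (≡-sym (countF≡∑ _))) (D x)

edges≤ : ∀ {d} {A : Adj n} → DegreeBound d A → edges A ≤ n * d
edges≤ {n} {d} D = ≤-trans (∑-mono λ x → ≤-trans (∑-mono λ y → 𝟙-mono (∧-elimʳ {toℕ x ℕ.<ᵇ toℕ y})) (D x)) (≤-reflexive (∑-const n d))

hyperfinite-partitions : ∀ {d} (G : ℕ → Graph) → (∀ n → MaxDegLe d (G n)) → Hyperfinite G → ∀ F →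
  ∃[ k ] ∀ n → Σ (Partition (adj (G n)) k) λ P → F * ∑ (𝟙 ∘ Partition.cut P) ≤ size (G n)
hyperfinite-partitions {d} G D hyperfinite F = K , λ n → from n (proj₂ family n)
  where
  e : ℕ
  -- The factor 2 pays for the two ends of a removed edge, and d + 1 for bounding edges by vertices;
  -- d + 1 instead of d allows cancellation when d = 0.
  e = 2 * suc d * F
  family = hyperfinite (unit-fraction e) (unit-fraction-positive e)
  K : ℕ
  K = proj₁ family
  from : ∀ n → _ → Σ (Partition (adj (G n)) K) λ P → F * ∑ (𝟙 ∘ Partition.cut P) ≤ size (G n)
  from n (H , SH , H⊆G , few , small) = partition , *-cancelˡ-≤ (2 * suc d) (begin
      2 * suc d * (F * c)          ≡⟨ *-assoc (2 * suc d) F c ⟨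
      e * c                        ≤⟨ *-mono-≤ (n≤1+n e) (cut-count (Graph.sym (G n)) (irrefl (G n))) ⟩
      suc e * (2 * (a ∸ h))        ≡⟨ solve 2 (λ e x → e :* (con 2 :* x) := con 2 :* (e :* x)) refl (suc e) (a ∸ h) ⟩
      2 * (suc e * (a ∸ h))        ≤⟨ *-monoʳ-≤ 2 (<⇒≤ (subst₂ (λ a h → suc e * (a ∸ h) < a) (numEdges≡edges (adj (G n))) (numEdges≡edges H) (fraction-bound e _ _ few))) ⟩
      2 * a                        ≤⟨ *-monoʳ-≤ 2 (≤-trans (edges≤ (graph-degree (G n) (D n))) (*-monoʳ-≤ s (n≤1+n d))) ⟩
      2 * (s * suc d)              ≡⟨ solve 2 (λ s d → con 2 :* (s :* d) := con 2 :* d :* s) refl s (suc d) ⟩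
      2 * suc d * s                ∎)
    where
    open ≤-Reasoning
    open +-*-Solver
    open Components {A = adj (G n)} SH H⊆G (λ x → ≤-trans (≤-reflexive (≡-sym (countF≡∑ _))) (small x))
    s c a h : ℕ
    s = size (G n)
    c = ∑ (𝟙 ∘ Partition.cut partition)
    a = edges (adj (G n))
    h = edges H

-- Passing to n₂ copies of A and n₁ copies of B equalises the numbers of vertices, so that the matching of ball
-- types can be a permutation.
module Matching {d : ℕ} (A B : Graph) (DA : MaxDegLe d A) (DB : MaxDegLe d B) (R : ℕ) where
  -- Types are taken at radius R + 1 because passing from isomorphic balls to similarity costs one
  -- unit.
  open BallTypes d (suc R)

  n₁ n₂ N : ℕ
  n₁ = size A
  n₂ = size B
  N = n₂ * n₁

  A′ B′ : Adj N
  A′ = blowup n₂ (adj A)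
  B′ = castAdj (*-comm n₁ n₂) (blowup n₁ (adj B))

  copiesA : Copies n₂ (adj A) A′
  copiesA = blowup-copies n₂ (adj A)

  copiesB : Copies n₁ (adj B) B′
  copiesB = cast-copies (*-comm n₁ n₂) (blowup-copies n₁ (adj B))

  private
    module A = Copies copiesA
    module B = Copies copiesB

    typeA typeB : Fin N → Fin types
    typeA v = type (suc R) A (A.base v)
    typeB v = type (suc R) B (B.base v)

    matching = match-colours typeA typeB

  π : Permutation′ N
  π = proj₁ matching

  exc : Fin N → Bool
  exc = mismatch typeA typeB π

  similar : ∀ v → exc v ≡ false → Similar A′ B′ R v (π ⟨$⟩ʳ v)
  similar v h = localIso⇒similar copiesA copiesB v (π ⟨$⟩ʳ v)
    (ballIso-common {A} {B} (rooted (typeA v)) (type-sound DA ≤-refl (A.base v))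
      (subst (λ c → BallIso B (suc R) (B.base (π ⟨$⟩ʳ v)) (rooted c)) matched (type-sound DB ≤-refl (B.base (π ⟨$⟩ʳ v)))))
    where
    matched : typeB (π ⟨$⟩ʳ v) ≡ typeA v
    matched with typeB (π ⟨$⟩ʳ v) ≟ typeA v
    ... | yes e = e

  exc-count : ∀ F →
    (∀ c → F * types * ∣ (∑[ x ] 𝟙 ⌊ type (suc R) A x ≟ c ⌋) * n₂ - (∑[ x ] 𝟙 ⌊ type (suc R) B x ≟ c ⌋) * n₁ ∣ ≤ n₁ * n₂) →
    F * ∑ (𝟙 ∘ exc) ≤ N
  exc-count F h = *-cancelˡ-≤ types (begin
    types * (F * ∑ (𝟙 ∘ exc))                   ≡⟨ trans (≡-sym (*-assoc types F _)) (cong (_* ∑ (𝟙 ∘ exc)) (*-comm types F)) ⟩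
    F * types * ∑ (𝟙 ∘ exc)                     ≤⟨ *-monoʳ-≤ (F * types) (proj₂ matching) ⟩
    F * types * (∑[ c ] ∣ (∑[ v ] 𝟙 ⌊ typeA v ≟ c ⌋) - (∑[ v ] 𝟙 ⌊ typeB v ≟ c ⌋) ∣)
      ≡⟨ ∑-*ˡ (F * types) _ ⟩
    (∑[ c ] F * types * ∣ (∑[ v ] 𝟙 ⌊ typeA v ≟ c ⌋) - (∑[ v ] 𝟙 ⌊ typeB v ≟ c ⌋) ∣)
      ≤⟨ ∑-mono (λ c → ≤-trans (≤-reflexive (cong (F * types *_) (cong₂ ∣_-_∣
           (trans (A.∑-base (λ x → 𝟙 ⌊ type (suc R) A x ≟ c ⌋)) (*-comm n₂ _))
           (trans (B.∑-base (λ x → 𝟙 ⌊ type (suc R) B x ≟ c ⌋)) (*-comm n₁ _))))) (h c)) ⟩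
    (∑[ c ] n₁ * n₂)                            ≡⟨ ∑-const types (n₁ * n₂) ⟩
    types * (n₁ * n₂)                           ≡⟨ cong (types *_) (*-comm n₁ n₂) ⟩
    types * N                                   ∎)
    where open ≤-Reasoning

relabelling : ∀ {N M g h s t} {A : Adj g} {B : Adj h} {X Y : Adj N} {X̂ Ŷ : Adj M} →
  Copies s A X → Copies s A X̂ → Copies t B Y → Copies t B Ŷ → (τ : Permutation′ N) →
  Σ (Permutation′ M) λ σ → countF M (λ v → anyF M (λ u → X̂ v u xor relabel σ Ŷ v u))
    ≤ (∑[ v ] 𝟙 (anyF N (λ w → X v w xor Y (τ ⟨$⟩ʳ v) (τ ⟨$⟩ʳ w))))
relabelling {N} {M} {X = X} {Y} {X̂} {Ŷ} CX CX̂ CY CŶ τ = σ , ≤-trans (≤-reflexive (countF≡∑ bad))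
    (count-inj bad bad′ I.to transfer λ v w _ _ h → trans (≡-sym (I.from-to v)) (trans (cong I.from h) (I.from-to w)))
  where
  module I = Reindex CX̂ CX
  module J = Reindex CY CŶ
  σ : Permutation′ M
  -- `relabel` applies the inverse of `σ`, so `τ` is placed in the backward direction.
  σ = permutation (λ v → I.from (τ ⟨$⟩ˡ J.from v)) (λ v → J.to (τ ⟨$⟩ʳ I.to v))
    (λ v → trans (cong (I.from ∘ (τ ⟨$⟩ˡ_)) (J.from-to _)) (trans (cong I.from (inverseˡ τ)) (I.from-to v)))
    (λ v → trans (cong (J.to ∘ (τ ⟨$⟩ʳ_)) (I.to-from _)) (trans (cong J.to (inverseʳ τ)) (J.to-from v)))
  bad : Fin M → Bool
  bad v = anyF M (λ u → X̂ v u xor relabel σ Ŷ v u)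
  bad′ : Fin N → Bool
  bad′ v = anyF N (λ w → X v w xor Y (τ ⟨$⟩ʳ v) (τ ⟨$⟩ʳ w))
  transfer : ∀ v → bad v ≡ true → bad′ (I.to v) ≡ true
  transfer v h with anyF-elim _ h
  ... | u , b = anyF-intro _ (I.to u) (trans (≡-sym (cong₂ _xor_ (I.to-adjacent v u) (≡-sym (J.to-adjacent _ _)))) b)

deltaRho : ∀ (G H : Graph) t {ε N} {X Y : Adj N} → N ≡ t * (size H * size G) →
  Copies (t * size H) (adj G) X → Copies (t * size G) (adj H) Y →
  1 ≤ t * size G → 1 ≤ t * size H → (τ : Permutation′ N) →
  (∀ {c} → c ≤ (∑[ v ] 𝟙 (anyF N (λ w → X v w xor Y (τ ⟨$⟩ʳ v) (τ ⟨$⟩ʳ w)))) → frac c N ℚ.< ε) →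
  DeltaRhoLt G H ε
deltaRho G H t {ε} {N} N≡ CX CY 1≤p 1≤q τ small = inj₂ (t * size G , t * size H , 1≤p , 1≤q , e , proj₁ r ,
    subst (λ N → frac count N ℚ.< ε) sizes (small (proj₂ r)))
  where
  e : t * size H * size G ≡ t * size G * size H
  e = solve 3 (λ t g h → t :* h :* g := t :* g :* h) refl t (size G) (size H)
    where open +-*-Solver
  sizes : N ≡ t * size G * size H
  sizes = trans N≡ (solve 3 (λ t g h → t :* (h :* g) := t :* g :* h) refl t (size G) (size H))
    where open +-*-Solver
  r = relabelling CX (cast-copies e (graph-copies (t * size H) G)) CY (graph-copies (t * size G) H) τ
  count : ℕ
  count = countF (t * size G * size H) (λ v → anyF (t * size G * size H)
    (λ u → castAdj e (copies (t * size H) G) v u xor relabel (proj₁ r) (copies (t * size G) H) v u))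

deltaRho-empty : ∀ G H {ε} → 0ℚ ℚ.< ε → size G ≡ 0 → size H ≡ 0 → DeltaRhoLt G H ε
deltaRho-empty G H {ε} 0<ε g h = inj₂ (1 , 1 , ≤-refl , ≤-refl , cong (1 *_) (trans g (≡-sym h)) , Perm.id , empty _ (cong (1 *_) h))
  where
  empty : ∀ c {N} → N ≡ 0 → frac c N ℚ.< ε
  empty c refl = 0<ε

-- Five error terms, each at most s / H, are kept below s / E; the spare room in 8 makes the bound strict.
five-eighths : ∀ {E H b s} → 8 * E ≤ H → H * b ≤ 5 * s → 1 ≤ s → E * b < s
five-eighths {E} {H} {b} {s} 8E≤H Hb≤5s 1≤s = *-cancelˡ-< 8 (E * b) s (begin-strict
  8 * (E * b)   ≡⟨ *-assoc 8 E b ⟨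
  8 * E * b     ≤⟨ *-monoˡ-≤ b 8E≤H ⟩
  H * b         ≤⟨ Hb≤5s ⟩
  5 * s         <⟨ *-monoˡ-< s {{ℕ.>-nonZero 1≤s}} {5} {8} (s≤s (s≤s (s≤s (s≤s (s≤s (s≤s z≤n)))))) ⟩
  8 * s         ∎)
  where open ≤-Reasoning

deltaRho-close : ∀ {ε E H} → (∀ c t → E * c < t → frac c t ℚ.< ε) → 8 * E ≤ H →
  ∀ (A B : Graph) t → 1 ≤ t → 1 ≤ size A → 1 ≤ size B → {A′ B′ : Adj (size B * size A)} →
  Copies (size B) (adj A) A′ → Copies (size A) (adj B) B′ → (τ : Permutation′ (t * (size B * size A))) →
  H * (∑[ v ] 𝟙 (anyF (t * (size B * size A)) (λ w → blowup t A′ v w xor blowup t B′ (τ ⟨$⟩ʳ v) (τ ⟨$⟩ʳ w))))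
    ≤ 5 * (t * (size B * size A)) → DeltaRhoLt A B ε
deltaRho-close {ε} {E} fine 8E≤H A B t 1≤t 1≤A 1≤B {A′} {B′} CA CB τ few = deltaRho A B t refl
  (copies-∘ (blowup-copies t A′) CA) (copies-∘ (blowup-copies t B′) CB)
  (*-mono-≤ 1≤t 1≤A) (*-mono-≤ 1≤t 1≤B) τ
  λ {c} c≤ → fine c (t * (size B * size A)) (≤-<-trans (*-monoʳ-≤ E c≤) (five-eighths {E} 8E≤H few (*-mono-≤ 1≤t (*-mono-≤ 1≤B 1≤A))))

module SimilarGraphs {d : ℕ} {ε : ℚ} {E p q : ℕ} (A B : Graph) (DA : MaxDegLe d A) (DB : MaxDegLe d B)
  (fine : ∀ c t → E * c < t → frac c t ℚ.< ε) (P₀ : Partition (adj B) p) (Q₀ : Partition (adj A) q)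
  (H : ℕ) (8E≤H : 8 * E ≤ H) (l : ℕ) (1≤l : 1 ≤ l) (large-l : H * p * (2 * (suc d ^ (q + p) * colours p)) ≤ l)
  (few-P₀ : H * ∑ (𝟙 ∘ Partition.cut P₀) ≤ size B) (few-Q₀ : H * suc d ^ suc p * ∑ (𝟙 ∘ Partition.cut Q₀) ≤ size A)
  (similar-types : ∀ c → H * suc p * suc (colours p) * suc (suc d ^ (q + p)) * BallTypes.types d (suc (level (q + p) (l * l)))
    * ∣ (∑[ x ] 𝟙 ⌊ BallTypes.type d (suc (level (q + p) (l * l))) (suc (level (q + p) (l * l))) A x ≟ c ⌋) * size B - (∑[ x ] 𝟙 ⌊ BallTypes.type d (suc (level (q + p) (l * l))) (suc (level (q + p) (l * l))) B x ≟ c ⌋) * size A ∣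
    ≤ size A * size B)
  (1≤A : 1 ≤ size A) (1≤B : 1 ≤ size B) where

  open Matching A B DA DB (level (q + p) (l * l))
  module A = Copies copiesA
  module B = Copies copiesB
  P = B.copies-partition P₀
  Q = A.copies-partition Q₀
  open Core (A.copies-symmetric (Graph.sym A)) (B.copies-symmetric (Graph.sym B))
    (A.copies-degree (graph-degree A DA)) (B.copies-degree (graph-degree B DB))
    P Q H l 1≤l π exc similar
  few-cut : ∀ F {n s c c′} → c′ ≤ s * c → F * c ≤ n → F * c′ ≤ s * n
  few-cut F {n} {s} {c} {c′} c′≤ h = ≤-trans (*-monoʳ-≤ F c′≤) (≤-trans (≤-reflexive (x∙yz≈y∙xz F s c)) (*-monoʳ-≤ s h))
  few-P : H * ∑ (𝟙 ∘ Partition.cut P) ≤ N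
  few-P = ≤-trans (few-cut H {s = n₁} (B.copies-cut P₀) few-P₀) (≤-reflexive (*-comm n₁ n₂))
  few-Q : H * (suc d ^ suc p * ∑ (𝟙 ∘ Partition.cut Q)) ≤ N
  few-Q = ≤-trans (≤-reflexive (≡-sym (*-assoc H (suc d ^ suc p) _))) (few-cut (H * suc d ^ suc p) {s = n₂} (A.copies-cut Q₀) few-Q₀)
  F : ℕ
  F = H * suc p * suc (colours p) * suc (suc d ^ (q + p))
  few-exc : F * ∑ (𝟙 ∘ exc) ≤ N
  few-exc = exc-count F similar-types
  finish : (∃[ t ] 1 ≤ t × Σ (Permutation′ (t * N)) λ τ →
    H * (∑[ v ] 𝟙 (anyF (t * N) (λ w → blowup t A′ v w xor blowup t B′ (τ ⟨$⟩ʳ v) (τ ⟨$⟩ʳ w)))) ≤ 5 * (t * N)) → DeltaRhoLt A B ε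
  finish (t , 1≤t , τ , few) = deltaRho-close {ε} {E} {H} fine 8E≤H A B t 1≤t 1≤A 1≤B copiesA copiesB τ few

  deltaRho-small : DeltaRhoLt A B ε
  deltaRho-small = finish (approximate-isomorphism few-P few-Q large-l few-exc)

theorem3p1 : (d : ℕ) (G : ℕ → Graph) →
    (∀ n → MaxDegLe d (G n)) →
    WeaklyConvergent d G →
    Hyperfinite G →
    StronglyConvergent G
theorem3p1 d G D weak hyperfinite ε 0<ε = N₀ , λ m k Nm Nk → by m k Nm Nk (size (G m)) (size (G k)) refl refl
  where
  open Frequencies G D
  bound : ∃[ E ] 1 ≤ E × ∀ {c t} → E * c < t → frac c t ℚ.< ε
  bound = frac-< ε 0<ε
  E H : ℕ
  E = proj₁ bound
  H = 8 * E
  P-family : ∃[ p ] ∀ n → Σ (Partition (adj (G n)) p) λ P → H * ∑ (𝟙 ∘ Partition.cut P) ≤ size (G n)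
  P-family = hyperfinite-partitions G D hyperfinite H
  p : ℕ
  p = proj₁ P-family
  -- The coarse cuts must stay rare after being thickened to radius p + 1, hence the dependence on
  -- p.
  Q-family : ∃[ q ] ∀ n → Σ (Partition (adj (G n)) q) λ Q → H * suc d ^ suc p * ∑ (𝟙 ∘ Partition.cut Q) ≤ size (G n)
  Q-family = hyperfinite-partitions G D hyperfinite (H * suc d ^ suc p)
  q M l R F : ℕ
  q = proj₁ Q-family
  M = colours p
  -- Large enough that the energy term, times p vertices per mismatch, is one share of the error;
  -- the successor makes l positive.
  l = suc (H * p * (2 * (suc d ^ (q + p) * M)))
  R = level (q + p) (l * l)
  F = H * suc p * suc M * suc (suc d ^ (q + p))
  open BallTypes d (suc R) using (types; type)
  frequencies : ∀ c → Cauchy (frequency (suc R) (weakly-convergent⇒cauchy G D weak) (suc R) c)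
  frequencies = frequency-cauchy (suc R) (weakly-convergent⇒cauchy G D weak) (suc R) ≤-refl
  modulus-of : Fin types → ℕ
  modulus-of c = proj₁ (Cauchy.modulus (frequencies c) (F * types))
  N₁ N₀ : ℕ
  N₁ = proj₁ (eventually-nonempty G D weak)
  -- A sum dominates the moduli of all types simultaneously.
  N₀ = N₁ + ∑ modulus-of

  by : ∀ m k → N₀ ≤ m → N₀ ≤ k → ∀ s u → size (G m) ≡ s → size (G k) ≡ u → DeltaRhoLt (G m) (G k) ε
  by m k Nm Nk zero    u       em eu = deltaRho-empty (G m) (G k) 0<ε em
    (proj₂ (eventually-nonempty G D weak) m k (m+n≤o⇒m≤o N₁ Nm) (m+n≤o⇒m≤o N₁ Nk) em)
  by m k Nm Nk (suc s) zero    em eu = deltaRho-empty (G m) (G k) 0<ε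
    (proj₂ (eventually-nonempty G D weak) k m (m+n≤o⇒m≤o N₁ Nk) (m+n≤o⇒m≤o N₁ Nm) eu) eu
  by m k Nm Nk (suc s) (suc u) em eu = SimilarGraphs.deltaRho-small {d} {ε} {E} {p} {q} (G m) (G k) (D m) (D k) (λ c t → proj₂ (proj₂ bound) {c} {t})
    (proj₁ (proj₂ P-family k)) (proj₁ (proj₂ Q-family m)) H ≤-refl l (s≤s z≤n) (n≤1+n (H * p * (2 * (suc d ^ (q + p) * M))))
    (proj₂ (proj₂ P-family k)) (proj₂ (proj₂ Q-family m))
    (λ c → proj₂ (Cauchy.modulus (frequencies c) (F * types)) m k
      (≤-trans (≤-∑ modulus-of c) (m+n≤o⇒n≤o N₁ Nm)) (≤-trans (≤-∑ modulus-of c) (m+n≤o⇒n≤o N₁ Nk)))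
    (subst (1 ≤_) (≡-sym em) (s≤s z≤n)) (subst (1 ≤_) (≡-sym eu) (s≤s z≤n))
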